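{- There exist a constant $\gamma \ge 1$ and a reallocating scheduler for unit-length jobs such that, for every number of machines $m \ge 1$ and every $m$-machine $\gamma$-underallocated sequence of scheduling requests, the following holds for every $i$. Let $n_i$ be the number of jobs in the schedule and $\Delta_i$ the largest window span at the time the $i$th request is processed. Then processing the $i$th request (1) has reallocation cost $O(\min\{\log^* n_i, \log^* \Delta_i\})$, and (2) has migration cost at most $1$, i.e. at most one job changes machine.
   Context: There are $m$ identical machines and discrete unit timeslots. Each job has length (processing time) $1$, an integer arrival time $a_j$ and an integer deadline $d_j > a_j$. Its window is $[a_j,d_j]$, and the span of the window (and of the job) is $d_j - a_j$. A feasible schedule assigns each job to a machine and to a unit timeslot lying inside the job's window, with no two jobs on the same machine in the same timeslot. An online sequence of requests consists of operations InsertJob(name, arrival, deadline) and DeleteJob(name). The active jobs after a request are those inserted and not yet deleted. A reallocating scheduler processes the requests one at a time and, after each request, outputs a feasible schedule of all currently active jobs; previously scheduled jobs may be moved. The reallocation cost of a request is the number of jobs whose scheduled position (time or machine) changes when the request is processed. The migration cost is the number of jobs whose machine changes. A set of jobs is $m$-machine $\gamma$-underallocated ($\gamma \ge 1$) if it has a feasible non-preemptive schedule on $m$ machines even when every job's processing time is multiplied by $\gamma$, with each job executed entirely within its window. A request sequence is $\gamma$-underallocated if the set of active jobs is $\gamma$-underallocated after every request. $\log^*$ denotes the iterated logarithm. -}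

module Defs where

open import Data.Nat as N using (ℕ; zero; suc; _≤?_; _⊔_)
open import Data.Nat.Logarithm using (⌊log₂_⌋)
open import Data.Integer as Z using (ℤ; +_; ∣_∣)
open import Data.Product using (Σ; _×_; _,_; proj₁; proj₂)
open import Data.Sum using (_⊎_)
open import Data.Unit using (⊤)
open import Data.List using (List; []; _∷_; filter; foldl; foldr; take; length)
open import Data.List.Relation.Unary.All using (All)
open import Data.List.Relation.Unary.Any using (Any; any?)
open import Data.List.Membership.Propositional using (_∈_)
open import Relation.Nullary using (¬_; ¬?)
open import Relation.Binary.PropositionalEquality using (_≡_; _≢_)
open import Data.Product.Properties using (≡-dec)

-- Iterated logarithm (base 2): log* n = 0 for n ≤ 1, else 1 + log*(⌊log₂ n⌋).
-- Implemented with fuel n (log* n ≤ n, so the fuel never runs out).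
logStarFuel : ℕ → ℕ → ℕ
logStarFuel zero    _ = 0
logStarFuel (suc f) n with n ≤? 1
... | Relation.Nullary.yes _ = 0
... | Relation.Nullary.no  _ = suc (logStarFuel f ⌊log₂ n ⌋)

logStar : ℕ → ℕ
logStar n = logStarFuel n n

record Job : Set where
  constructor job
  field
    name : ℕ
    arr  : ℤ
    dl   : ℤ
open Job public

span : Job → ℕ
span j = ∣ dl j Z.- arr j ∣

data Request : Set where
  InsertJob : (n : ℕ) (a d : ℤ) → Request
  DeleteJob : (n : ℕ) → Request

step : List Job → Request → List Job
step js (InsertJob n a d) = job n a d ∷ js
step js (DeleteJob n)     = filter (λ j → ¬? (name j N.≟ n)) js

active : List Request → List Job
active = foldl step []

Valid : List Job → Request → Set
Valid js (InsertJob n a d) = (a Z.< d) × All (λ j → name j ≢ n) js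
Valid js (DeleteJob n)     = Any (λ j → name j ≡ n) js

WellFormedFrom : List Job → List Request → Set
WellFormedFrom js []       = ⊤
WellFormedFrom js (r ∷ rs) = Valid js r × WellFormedFrom (step js r) rs

WellFormed : List Request → Set
WellFormed = WellFormedFrom []

-- A schedule assigns to each job name a (machine, timeslot).
-- Timeslot t is the unit interval [t, t+1].
Schedule : Set
Schedule = ℕ → ℕ × ℤ

machineOf : Schedule → ℕ → ℕ
machineOf σ n = proj₁ (σ n)

slotOf : Schedule → ℕ → ℤ
slotOf σ n = proj₂ (σ n)

Feasible : ℕ → List Job → Schedule → Set
Feasible m js σ =
  (∀ j → j ∈ js →
      (machineOf σ (name j) N.< m)
    × (arr j Z.≤ slotOf σ (name j))
    × (slotOf σ (name j) Z.+ + 1 Z.≤ dl j))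
  × (∀ j k → j ∈ js → k ∈ js → name j ≢ name k → σ (name j) ≢ σ (name k))

-- m-machine γ-underallocated (γ a natural number ≥ 1): a feasible
-- non-preemptive schedule exists where every job has length γ and runs
-- entirely inside its window (start s with a ≤ s and s + γ ≤ d).
Underallocated : ℕ → ℕ → List Job → Set
Underallocated γ m js =
  Σ (ℕ → ℕ × ℤ) λ τ →
    (∀ j → j ∈ js →
        (proj₁ (τ (name j)) N.< m)
      × (arr j Z.≤ proj₂ (τ (name j)))
      × (proj₂ (τ (name j)) Z.+ + γ Z.≤ dl j))
  × (∀ j k → j ∈ js → k ∈ js → name j ≢ name k →
       proj₁ (τ (name j)) ≡ proj₁ (τ (name k)) →
       (proj₂ (τ (name j)) Z.+ + γ Z.≤ proj₂ (τ (name k)))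
     ⊎ (proj₂ (τ (name k)) Z.+ + γ Z.≤ proj₂ (τ (name j))))

UnderallocatedSeq : ℕ → ℕ → List Request → Set
UnderallocatedSeq γ m rs = ∀ i → i N.≤ length rs → Underallocated γ m (active (take i rs))

-- An (online, deterministic) reallocating scheduler: given m and the
-- requests processed so far, it outputs the current schedule.
Scheduler : Set
Scheduler = ℕ → List Request → Schedule

persisting : List Job → List Job → List Job
persisting before after = filter (λ j → any? (λ k → name k N.≟ name j) after) before

reallocCost : List Job → List Job → Schedule → Schedule → ℕ
reallocCost before after σ σ' =
  length (filter (λ j → ¬? (≡-dec N._≟_ Z._≟_ (σ (name j)) (σ' (name j))))
                 (persisting before after))

migrationCost : List Job → List Job → Schedule → Schedule → ℕ
migrationCost before after σ σ' =
  length (filter (λ j → ¬? (machineOf σ (name j) N.≟ machineOf σ' (name j)))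
                 (persisting before after))

maxSpan : List Job → ℕ
maxSpan = foldr (λ j acc → span j ⊔ acc) 0

{-# OPTIONS --safe #-}
module Submission where

open import Defs
open import Data.Bool using (Bool; true; false)
open import Data.Empty using (⊥)
open import Data.Integer as ℤ using (ℤ; -[1+_]) renaming (+_ to pos)
import Data.Integer.Properties as ℤₚ
import Data.Integer.Tactic.RingSolver as ℤSolver
open import Data.List using (List; []; _∷_; _++_; cartesianProduct; filter; foldl; length; map; take; upTo)
open import Data.List.Membership.Propositional using (_∈_; _∉_; find; lose)
open import Data.List.Membership.Propositional.Properties using (∈-++⁺ˡ; ∈-++⁺ʳ; ∈-cartesianProduct⁺; ∈-filter⁺; ∈-filter⁻; ∈-upTo⁺; ∈-∃++)
open import Data.List.Properties using (filter-accept; filter-all; filter-reject; length-++; length-map; length-upTo)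
open import Data.List.Relation.Unary.All as All using (All; []; _∷_; all?)
open import Data.List.Relation.Unary.AllPairs as AllPairs using (AllPairs; []; _∷_)
import Data.List.Relation.Unary.AllPairs.Properties as AllPairsₚ
open import Data.List.Relation.Unary.Any as Any using (Any; any?; here; there)
open import Data.Maybe using (Maybe; fromMaybe; just; nothing)
import Data.Maybe.Properties as Maybeₚ
open import Data.Nat
open import Data.Nat.Logarithm using (⌊log₂_⌋; ⌊log₂⌋-mono-≤; ⌊log₂[2^n]⌋≡n)
open import Data.Nat.Properties
open import Data.Nat.Tactic.RingSolver using (solve-∀)
open import Data.Product using (Σ; ∃; _×_; _,_; proj₁; proj₂)
import Data.Product.Properties as ×ₚ
open import Data.Sum using (_⊎_; inj₁; inj₂; [_,_]′)
open import Data.Unit using (⊤; tt)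
open import Function using (_∘_; case_of_; id)
open import Relation.Binary.Definitions using (tri<; tri≈; tri>)
open import Relation.Binary.PropositionalEquality
open import Relation.Nullary using (¬_; Dec; contradiction; no; yes)
open import Relation.Nullary.Decidable using (_×-dec_; ¬?; decidable-stable)

-- Every job is confined to a dyadic window inside its own window.  Exponents of windows are grouped into levels
-- growing like a tower of powers of two: intervals of length L serve the windows of length up to about 2^(L/4).
-- Each window reserves one slot in each of its intervals plus twice its number of jobs, spread evenly; an interval
-- grants reservations to shorter windows first, after setting aside the reservations of lower levels.  Density
-- makes the granted reservations (quotas) of a window exceed its number of jobs, and the schedule keeps the number
-- of jobs of each window in each interval within its quota.
--
-- One more reservation costs at most one quota per level, by one.  A job over quota moves to another interval of
-- its window, trading slots with at most one job of a higher level, whose window contains both slots; so nothing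
-- else changes.  A new job takes a slot granted to its window and may evict a job of a higher level, which is
-- placed next.  At levels whose intervals are much longer than the number of jobs all reservations are granted and
-- free slots abound, which bounds the cost by log* of the number of jobs as well as of the largest span.  A
-- deletion lowers quotas only for the window of the deleted job, at constant cost.
--
-- Jobs with the same window are balanced over the machines: insertion uses the least loaded machine, and before a
-- deletion a job from a fuller machine may take over the position of the deleted one, the only migration.

-- Indicators and finite sums

-- The cost of an insertion hinges on a queue. An interval ranks its claims by window length and
-- grants them until it is full. A further claim pushes all claims behind it back by one slot, yet
-- only the window at the end of the interval notices: those before it still fit, and those after it
-- had nothing. A withdrawn claim hurts nobody but its owner.
--
-- Quotas are a function of the current loads alone, so the schedule needs no memory beyond the
-- invariant that counts stay within quotas. The same invariant produces slots: since all jobs of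
-- the level and of lower levels stay within their claims, a window below its quota in some interval
-- finds a slot there that holds no job of its own or a lower level.
--
-- The one slot reserved per window and interval dictates the tower. The windows of a level that
-- contain a given interval may take only a fixed fraction of it in this way, here a quarter, so
-- intervals of length L can serve no more than L/4 window lengths.

⟦_⟧ : ∀ {p} {P : Set p} → Dec P → ℕ
⟦ yes _ ⟧ = 1
⟦ no _ ⟧ = 0

⟦⟧-yes : ∀ {p} {P : Set p} (d : Dec P) → P → ⟦ d ⟧ ≡ 1
⟦⟧-yes (yes _) x = refl
⟦⟧-yes (no ¬x) x = contradiction x ¬x

⟦⟧-no : ∀ {p} {P : Set p} (d : Dec P) → ¬ P → ⟦ d ⟧ ≡ 0
⟦⟧-no (yes x) ¬x = contradiction x ¬x
⟦⟧-no (no _)  ¬x = refl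

⟦⟧-pos : ∀ {p} {P : Set p} (d : Dec P) → 0 < ⟦ d ⟧ → P
⟦⟧-pos (yes x) _ = x

⟦⟧≤1 : ∀ {p} {P : Set p} (d : Dec P) → ⟦ d ⟧ ≤ 1
⟦⟧≤1 (yes _) = ≤-refl
⟦⟧≤1 (no _)  = z≤n

⟦⟧-mono : ∀ {p q} {P : Set p} {Q : Set q} (d : Dec P) (d′ : Dec Q) →
          (P → Q) → ⟦ d ⟧ ≤ ⟦ d′ ⟧
⟦⟧-mono (yes x) d′ f = ≤-reflexive (sym (⟦⟧-yes d′ (f x)))
⟦⟧-mono (no _) d′ f = z≤n

⟦⟧-cong : ∀ {p q} {P : Set p} {Q : Set q} (d : Dec P) (d′ : Dec Q) →
          (P → Q) → (Q → P) → ⟦ d ⟧ ≡ ⟦ d′ ⟧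
⟦⟧-cong d d′ f g = ≤-antisym (⟦⟧-mono d d′ f) (⟦⟧-mono d′ d g)

∑ : ∀ {a} {A : Set a} → List A → (A → ℕ) → ℕ
∑ []       f = 0
∑ (x ∷ xs) f = f x + ∑ xs f

interchange : ∀ a b c d → (a + b) + (c + d) ≡ (a + c) + (b + d)
interchange = solve-∀

module _ {a} {A : Set a} where
  ∑-mono : ∀ (xs : List A) {f g} → (∀ x → x ∈ xs → f x ≤ g x) → ∑ xs f ≤ ∑ xs g
  ∑-mono []       h = z≤n
  ∑-mono (x ∷ xs) h = +-mono-≤ (h x (here refl)) (∑-mono xs (λ y m → h y (there m)))

  ∑-cong : ∀ (xs : List A) {f g} → (∀ x → x ∈ xs → f x ≡ g x) → ∑ xs f ≡ ∑ xs g
  ∑-cong []       h = refl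
  ∑-cong (x ∷ xs) h = cong₂ _+_ (h x (here refl)) (∑-cong xs (λ y m → h y (there m)))

  ∑-+ : ∀ (xs : List A) f g → ∑ xs (λ x → f x + g x) ≡ ∑ xs f + ∑ xs g
  ∑-+ []       f g = refl
  ∑-+ (x ∷ xs) f g =
    trans (cong (f x + g x +_) (∑-+ xs f g)) (interchange (f x) (g x) _ _)

  ∑-∈ : ∀ {xs : List A} {x} f → x ∈ xs → f x ≤ ∑ xs f
  ∑-∈ f (here refl) = m≤m+n _ _
  ∑-∈ f (there m)   = ≤-trans (∑-∈ f m) (m≤n+m _ _)

  ∑-0 : ∀ (xs : List A) → ∑ xs (λ _ → 0) ≡ 0
  ∑-0 []       = refl
  ∑-0 (x ∷ xs) = ∑-0 xs

  ∑≤length : ∀ (xs : List A) {f} → (∀ x → f x ≤ 1) → ∑ xs f ≤ length xs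
  ∑≤length []       h = z≤n
  ∑≤length (x ∷ xs) h = +-mono-≤ (h x) (∑≤length xs h)

  ∑-pos : ∀ (xs : List A) f → 0 < ∑ xs f → ∃ λ x → x ∈ xs × 0 < f x
  ∑-pos (x ∷ xs) f p with f x in eq
  ... | suc n = x , here refl , subst (0 <_) (sym eq) z<s
  ... | zero with ∑-pos xs f p
  ...   | y , m , q = y , there m , q

-- Dyadic intervals

double : ℕ → ℕ
double zero    = zero
double (suc n) = suc (suc (double n))

⌊double/2⌋ : ∀ n → ⌊ double n /2⌋ ≡ n
⌊double/2⌋ zero    = refl
⌊double/2⌋ (suc n) = cong suc (⌊double/2⌋ n)

⌊1+double/2⌋ : ∀ n → ⌊ suc (double n) /2⌋ ≡ n
⌊1+double/2⌋ zero    = refl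
⌊1+double/2⌋ (suc n) = cong suc (⌊1+double/2⌋ n)

-- Floor division by two on all of ℤ, and its two inverses 2i and 2i + 1; rounding towards minus
-- infinity lets the dyadic intervals tile ℤ without a break at zero.
half lo hi : ℤ → ℤ
half (pos n)  = pos ⌊ n /2⌋
half -[1+ n ] = -[1+ ⌊ n /2⌋ ]
lo (pos n)  = pos (double n)
lo -[1+ n ] = -[1+ suc (double n) ]
hi (pos n)  = pos (suc (double n))
hi -[1+ n ] = -[1+ double n ]

half-lo : ∀ i → half (lo i) ≡ i
half-lo (pos n)    = cong pos (⌊double/2⌋ n)
half-lo -[1+ n ] = cong -[1+_] (⌊1+double/2⌋ n)

half-hi : ∀ i → half (hi i) ≡ i
half-hi (pos n)    = cong pos (⌊1+double/2⌋ n)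
half-hi -[1+ n ] = cong -[1+_] (⌊double/2⌋ n)

odd : ℕ → Bool
odd zero          = false
odd (suc zero)    = true
odd (suc (suc n)) = odd n

oddℤ : ℤ → Bool
oddℤ (pos n)    = odd n
oddℤ -[1+ n ] = odd (suc n)

odd-double : ∀ n → odd (double n) ≡ false
odd-double zero    = refl
odd-double (suc n) = odd-double n

odd-1+double : ∀ n → odd (suc (double n)) ≡ true
odd-1+double zero    = refl
odd-1+double (suc n) = odd-1+double n

odd-lo : ∀ i → oddℤ (lo i) ≡ false
odd-lo (pos n)    = odd-double n
odd-lo -[1+ n ] = odd-double (suc n)

odd-hi : ∀ i → oddℤ (hi i) ≡ true
odd-hi (pos n)    = odd-1+double n
odd-hi -[1+ n ] = odd-1+double n

lo≢hi : ∀ i → lo i ≢ hi i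
lo≢hi i eq with trans (sym (odd-lo i)) (trans (cong oddℤ eq) (odd-hi i))
... | ()

parityℕ : ∀ n → n ≡ double ⌊ n /2⌋ ⊎ n ≡ suc (double ⌊ n /2⌋)
parityℕ zero          = inj₁ refl
parityℕ (suc zero)    = inj₂ refl
parityℕ (suc (suc n)) with parityℕ n
... | inj₁ eq = inj₁ (cong (suc ∘ suc) eq)
... | inj₂ eq = inj₂ (cong (suc ∘ suc) eq)

lo⊎hi : ∀ z → z ≡ lo (half z) ⊎ z ≡ hi (half z)
lo⊎hi (pos n) with parityℕ n
... | inj₁ eq = inj₁ (cong pos eq)
... | inj₂ eq = inj₂ (cong pos eq)
lo⊎hi -[1+ n ] with parityℕ n
... | inj₁ eq = inj₂ (cong -[1+_] eq)
... | inj₂ eq = inj₁ (cong -[1+_] eq)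

-- block k t = ⌊t / 2ᵏ⌋, so that block k t ≡ i says that slot t lies in the dyadic interval (k , i).
block : ℕ → ℤ → ℤ
block zero    t = t
block (suc k) t = half (block k t)

block-+ : ∀ d k t → block (d + k) t ≡ block d (block k t)
block-+ zero    k t = refl
block-+ (suc d) k t = cong half (block-+ d k t)

block-∸ : ∀ {k l} → k ≤ l → ∀ t → block l t ≡ block (l ∸ k) (block k t)
block-∸ {k} {l} k≤l t =
  trans (cong (λ z → block z t) (sym (m∸n+n≡m k≤l))) (block-+ (l ∸ k) k t)

-- The sum of `f j` over the 2ᵈ indices `j` with `block d j ≡ i`, in a form that splits along `lo`
-- and `hi`.
ΣL : ℕ → ℤ → (ℤ → ℕ) → ℕ
ΣL zero    i f = f i
ΣL (suc d) i f = ΣL d (lo i) f + ΣL d (hi i) f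

∈lo : ∀ {d i j} → block d j ≡ lo i → block (suc d) j ≡ i
∈lo {i = i} eq = trans (cong half eq) (half-lo i)

∈hi : ∀ {d i j} → block d j ≡ hi i → block (suc d) j ≡ i
∈hi {i = i} eq = trans (cong half eq) (half-hi i)

∈⇒lo⊎hi : ∀ {d i j} → block (suc d) j ≡ i → block d j ≡ lo i ⊎ block d j ≡ hi i
∈⇒lo⊎hi {d} {i} {j} eq with lo⊎hi (block d j)
... | inj₁ p = inj₁ (trans p (cong lo eq))
... | inj₂ p = inj₂ (trans p (cong hi eq))

ΣL-mono : ∀ d i {f g} → (∀ j → block d j ≡ i → f j ≤ g j) → ΣL d i f ≤ ΣL d i g
ΣL-mono zero    i h = h i refl
ΣL-mono (suc d) i h =
  +-mono-≤ (ΣL-mono d (lo i) (λ j e → h j (∈lo {d} e))) (ΣL-mono d (hi i) (λ j e → h j (∈hi {d} e)))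

ΣL-cong : ∀ d i {f g} → (∀ j → block d j ≡ i → f j ≡ g j) → ΣL d i f ≡ ΣL d i g
ΣL-cong d i h = ≤-antisym (ΣL-mono d i (λ j e → ≤-reflexive (h j e)))
                          (ΣL-mono d i (λ j e → ≤-reflexive (sym (h j e))))

ΣL-+ : ∀ d i f g → ΣL d i (λ j → f j + g j) ≡ ΣL d i f + ΣL d i g
ΣL-+ zero    i f g = refl
ΣL-+ (suc d) i f g =
  trans (cong₂ _+_ (ΣL-+ d (lo i) f g) (ΣL-+ d (hi i) f g))
        (interchange (ΣL d (lo i) f) (ΣL d (lo i) g) _ _)

ΣL-* : ∀ d i c f → ΣL d i (λ j → c * f j) ≡ c * ΣL d i f
ΣL-* zero    i c f = refl
ΣL-* (suc d) i c f =
  trans (cong₂ _+_ (ΣL-* d (lo i) c f) (ΣL-* d (hi i) c f)) (sym (*-distribˡ-+ c _ _))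

ΣL-const : ∀ d i c → ΣL d i (λ _ → c) ≡ 2 ^ d * c
ΣL-const zero    i c = sym (+-identityʳ c)
ΣL-const (suc d) i c =
  trans (cong₂ _+_ (ΣL-const d (lo i) c) (ΣL-const d (hi i) c)) (lemma (2 ^ d) c)
  where
  lemma : ∀ q c → q * c + q * c ≡ 2 * q * c
  lemma = solve-∀

ΣL-∑ : ∀ {a} {A : Set a} d i (xs : List A) (f : A → ℤ → ℕ) →
       ΣL d i (λ j → ∑ xs (λ x → f x j)) ≡ ∑ xs (λ x → ΣL d i (f x))
ΣL-∑ d i []       f = trans (ΣL-const d i 0) (*-zeroʳ (2 ^ d))
ΣL-∑ d i (x ∷ xs) f = trans (ΣL-+ d i (f x) _) (cong (ΣL d i (f x) +_) (ΣL-∑ d i xs f))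

ΣL-δ : ∀ d i c → ΣL d i (λ j → ⟦ c ℤ.≟ j ⟧) ≡ ⟦ block d c ℤ.≟ i ⟧
ΣL-δ zero    i c = refl
ΣL-δ (suc d) i c = trans (cong₂ _+_ (ΣL-δ d (lo i) c) (ΣL-δ d (hi i) c)) lemma
  where
  lemma : ⟦ block d c ℤ.≟ lo i ⟧ + ⟦ block d c ℤ.≟ hi i ⟧ ≡ ⟦ block (suc d) c ℤ.≟ i ⟧
  lemma with block d c ℤ.≟ lo i | block d c ℤ.≟ hi i
  ... | yes p | yes q = contradiction (trans (sym p) q) (lo≢hi i)
  ... | yes p | no _  = sym (⟦⟧-yes (block (suc d) c ℤ.≟ i) (∈lo {d} p))
  ... | no _  | yes q = sym (⟦⟧-yes (block (suc d) c ℤ.≟ i) (∈hi {d} q))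
  ... | no p  | no q  = sym (⟦⟧-no (block (suc d) c ℤ.≟ i)
                              (λ eq → [ p , q ]′ (∈⇒lo⊎hi {d} eq)))

-- The pigeonhole principle that yields both an interval with quota to spare (`roomy`) and a vacant
-- slot (`vacant`).
ΣL-find : ∀ d i f g → ΣL d i f < ΣL d i g → ∃ λ j → block d j ≡ i × f j < g j
ΣL-find zero    i f g lt = i , refl , lt
ΣL-find (suc d) i f g lt with ΣL d (lo i) f <? ΣL d (lo i) g
... | yes p = let j , e , q = ΣL-find d (lo i) f g p in j , ∈lo {d} e , q
... | no ¬p with ΣL d (hi i) f <? ΣL d (hi i) g
...   | yes p = let j , e , q = ΣL-find d (hi i) f g p in j , ∈hi {d} e , q
...   | no ¬q = contradiction lt (≤⇒≯ (+-mono-≤ (≮⇒≥ ¬p) (≮⇒≥ ¬q)))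

-- Loads of windows

-- The load of the window (k , i) for every exponent k and index i; subtotal adds up all windows inside (k , i).
Config : Set
Config = ℕ → ℤ → ℕ

subtotal : Config → Config
subtotal y zero    i = y zero i
subtotal y (suc k) i = y (suc k) i + (subtotal y k (lo i) + subtotal y k (hi i))

subtotal-mono : ∀ {y y′ : Config} → (∀ k i → y k i ≤ y′ k i) → ∀ k i → subtotal y k i ≤ subtotal y′ k i
subtotal-mono h zero    i = h 0 i
subtotal-mono h (suc k) i = +-mono-≤ (h (suc k) i) (+-mono-≤ (subtotal-mono h k (lo i)) (subtotal-mono h k (hi i)))

subtotal-cong : ∀ {y y′ : Config} → (∀ k i → y k i ≡ y′ k i) → ∀ k i → subtotal y k i ≡ subtotal y′ k i
subtotal-cong h k i = ≤-antisym (subtotal-mono (λ k i → ≤-reflexive (h k i)) k i)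
                         (subtotal-mono (λ k i → ≤-reflexive (sym (h k i))) k i)

subtotal-+ : ∀ (y y′ : Config) k i → subtotal (λ k i → y k i + y′ k i) k i ≡ subtotal y k i + subtotal y′ k i
subtotal-+ y y′ zero    i = refl
subtotal-+ y y′ (suc k) i = trans (cong (y (suc k) i + y′ (suc k) i +_)
    (cong₂ _+_ (subtotal-+ y y′ k (lo i)) (subtotal-+ y y′ k (hi i)))) (lemma (y (suc k) i) (y′ (suc k) i) (subtotal y k (lo i)) (subtotal y′ k (lo i)) (subtotal y k (hi i)) (subtotal y′ k (hi i)))
  where
  lemma : ∀ a b c d e f → a + b + ((c + d) + (e + f)) ≡ (a + (c + e)) + (b + (d + f))
  lemma = solve-∀

subtotal-* : ∀ c (y : Config) k i → subtotal (λ k i → c * y k i) k i ≡ c * subtotal y k i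
subtotal-* c y zero    i = refl
subtotal-* c y (suc k) i = trans (cong (c * y (suc k) i +_)
    (cong₂ _+_ (subtotal-* c y k (lo i)) (subtotal-* c y k (hi i)))) (lemma c (y (suc k) i) (subtotal y k (lo i)) (subtotal y k (hi i)))
  where
  lemma : ∀ c a b d → c * a + (c * b + c * d) ≡ c * (a + (b + d))
  lemma = solve-∀

at : ℕ → ℤ → Config
at k i k′ i′ = ⟦ (k′ ≟ k) ×-dec (i′ ℤ.≟ i) ⟧

within? : ∀ k i k′ i′ → Dec (k ≤ k′ × block (k′ ∸ k) i ≡ i′)
within? k i k′ i′ = (k ≤? k′) ×-dec (block (k′ ∸ k) i ℤ.≟ i′)

subtotal-at : ∀ k i k′ i′ → subtotal (at k i) k′ i′ ≡ ⟦ within? k i k′ i′ ⟧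
subtotal-at k i zero i′ = ⟦⟧-cong ((zero ≟ k) ×-dec (i′ ℤ.≟ i)) (within? k i 0 i′)
  (λ { (refl , refl) → z≤n , refl })
  (λ { (z≤n , eq) → refl , sym eq })
subtotal-at k i (suc k′) i′ = begin
  ⟦ (suc k′ ≟ k) ×-dec (i′ ℤ.≟ i) ⟧ + (subtotal (at k i) k′ (lo i′) + subtotal (at k i) k′ (hi i′))
    ≡⟨ cong (⟦ (suc k′ ≟ k) ×-dec (i′ ℤ.≟ i) ⟧ +_) (cong₂ _+_ (subtotal-at k i k′ (lo i′)) (subtotal-at k i k′ (hi i′))) ⟩
  ⟦ (suc k′ ≟ k) ×-dec (i′ ℤ.≟ i) ⟧ + (⟦ within? k i k′ (lo i′) ⟧ + ⟦ within? k i k′ (hi i′) ⟧)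
    ≡⟨ split ⟩
  ⟦ within? k i (suc k′) i′ ⟧ ∎
  where
  open ≡-Reasoning
  split : ⟦ (suc k′ ≟ k) ×-dec (i′ ℤ.≟ i) ⟧ + (⟦ within? k i k′ (lo i′) ⟧ + ⟦ within? k i k′ (hi i′) ⟧)
          ≡ ⟦ within? k i (suc k′) i′ ⟧
  split with k ≤? k′
  ... | no k≰k′ = trans (cong₂ _+_ (⟦⟧-cong ((suc k′ ≟ k) ×-dec (i′ ℤ.≟ i)) (within? k i (suc k′) i′)
                       (λ { (refl , refl) → ≤-refl , cong (λ z → block z i) (n∸n≡0 k′) })
                       (λ { (le , eq) → let e = ≤-antisym (≰⇒> k≰k′) le in
                            e , trans (sym eq) (cong (λ z → block z i) (trans (cong (suc k′ ∸_) (sym e)) (n∸n≡0 k′))) }))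
                     refl)
                   (+-identityʳ _)
  ... | yes k≤k′ rewrite +-∸-assoc 1 k≤k′ =
    cong₂ _+_ (⟦⟧-no ((suc k′ ≟ k) ×-dec (i′ ℤ.≟ i)) (λ { (refl , _) → 1+n≰n k≤k′ }))
      halves
    where
    c : ℤ
    c = block (k′ ∸ k) i
    halves : ⟦ yes k≤k′ ×-dec (c ℤ.≟ lo i′) ⟧ + ⟦ yes k≤k′ ×-dec (c ℤ.≟ hi i′) ⟧
             ≡ ⟦ (k ≤? suc k′) ×-dec (half c ℤ.≟ i′) ⟧
    halves = trans (cong₂ _+_
        (⟦⟧-cong (yes k≤k′ ×-dec (c ℤ.≟ lo i′)) (c ℤ.≟ lo i′) proj₂ (k≤k′ ,_))
        (⟦⟧-cong (yes k≤k′ ×-dec (c ℤ.≟ hi i′)) (c ℤ.≟ hi i′) proj₂ (k≤k′ ,_)))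
      (trans (ΣL-δ 1 i′ c)
        (⟦⟧-cong (half c ℤ.≟ i′) ((k ≤? suc k′) ×-dec (half c ℤ.≟ i′)) (m≤n⇒m≤1+n k≤k′ ,_) proj₂))

-- Quotas

-- The left half, which has even index, takes the odd unit. A fixed rule makes the shares depend on
-- the load only.
pick : Bool → ℕ → ℕ
pick false y = ⌈ y /2⌉
pick true  y = ⌊ y /2⌋

-- The part of y units, spread evenly over the 2ᵈ subintervals of an interval, that subinterval j receives.
share : ℕ → ℕ → ℤ → ℕ
share zero    y j = y
share (suc d) y j = share d (pick (oddℤ (block d j)) y) j

pick≤ : ∀ b y → pick b y ≤ y
pick≤ false y = ⌈n/2⌉≤n y
pick≤ true  y = ⌊n/2⌋≤n y

2*pick≤ : ∀ b y → 2 * pick b y ≤ suc y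
2*pick≤ true  y = begin
  2 * ⌊ y /2⌋         ≡⟨ cong (⌊ y /2⌋ +_) (+-identityʳ _) ⟩
  ⌊ y /2⌋ + ⌊ y /2⌋   ≤⟨ +-monoʳ-≤ ⌊ y /2⌋ (⌊n/2⌋≤⌈n/2⌉ y) ⟩
  ⌊ y /2⌋ + ⌈ y /2⌉   ≡⟨ ⌊n/2⌋+⌈n/2⌉≡n y ⟩
  y                   ≤⟨ n≤1+n y ⟩
  suc y               ∎
  where open ≤-Reasoning
2*pick≤ false y = begin
  2 * ⌈ y /2⌉             ≡⟨ cong (⌈ y /2⌉ +_) (+-identityʳ _) ⟩
  ⌊ suc y /2⌋ + ⌈ y /2⌉   ≤⟨ +-monoʳ-≤ ⌊ suc y /2⌋ (⌈n/2⌉-mono (n≤1+n y)) ⟩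
  ⌊ suc y /2⌋ + ⌈ suc y /2⌉ ≡⟨ ⌊n/2⌋+⌈n/2⌉≡n (suc y) ⟩
  suc y               ∎
  where open ≤-Reasoning

share≤ : ∀ d y j → share d y j ≤ y
share≤ zero    y j = ≤-refl
share≤ (suc d) y j = ≤-trans (share≤ d _ j) (pick≤ (oddℤ (block d j)) y)

-- A halving rounds up by at most one half, and later halvings shrink that error, so the total error
-- stays below 1/2 + 1/4 + ... = 1.
share-even : ∀ d y j → 2 ^ d * share d y j < y + 2 ^ d
share-even zero    y j = ≤-reflexive (trans (cong suc (+-identityʳ y)) (sym (+-comm y 1)))
share-even (suc d) y j = +-cancelˡ-≤ 1 _ _ (begin
  2 + 2 * q * s   ≡⟨ lemma q s ⟩
  2 * suc (q * s)     ≤⟨ *-monoʳ-≤ 2 (share-even d y′ j) ⟩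
  2 * (y′ + q)        ≡⟨ *-distribˡ-+ 2 y′ q ⟩
  2 * y′ + 2 * q      ≤⟨ +-monoˡ-≤ (2 * q) (2*pick≤ (oddℤ (block d j)) y) ⟩
  suc y + 2 * q       ∎)
  where
  open ≤-Reasoning
  q y′ s : ℕ
  q = 2 ^ d
  y′ = pick (oddℤ (block d j)) y
  s = share d y′ j
  lemma : ∀ q s → 2 + 2 * q * s ≡ 2 * suc (q * s)
  lemma = solve-∀

ΣL-share : ∀ d y i → ΣL d i (share d y) ≡ y
ΣL-share zero    y i = refl
ΣL-share (suc d) y i = begin
  ΣL d (lo i) (share (suc d) y) + ΣL d (hi i) (share (suc d) y)
    ≡⟨ cong₂ _+_
        (ΣL-cong d (lo i) (λ j e → cong (λ b → share d (pick b y) j) (trans (cong oddℤ e) (odd-lo i))))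
        (ΣL-cong d (hi i) (λ j e → cong (λ b → share d (pick b y) j) (trans (cong oddℤ e) (odd-hi i)))) ⟩
  ΣL d (lo i) (share d ⌈ y /2⌉) + ΣL d (hi i) (share d ⌊ y /2⌋)
    ≡⟨ cong₂ _+_ (ΣL-share d ⌈ y /2⌉ (lo i)) (ΣL-share d ⌊ y /2⌋ (hi i)) ⟩
  ⌈ y /2⌉ + ⌊ y /2⌋
    ≡⟨ +-comm ⌈ y /2⌉ ⌊ y /2⌋ ⟩
  ⌊ y /2⌋ + ⌈ y /2⌉
    ≡⟨ ⌊n/2⌋+⌈n/2⌉≡n y ⟩
  y ∎
  where open ≡-Reasoning

⌈/2⌉-cases : ∀ y → ⌈ y /2⌉ ≡ ⌊ y /2⌋ ⊎ ⌈ y /2⌉ ≡ suc ⌊ y /2⌋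
⌈/2⌉-cases zero          = inj₁ refl
⌈/2⌉-cases (suc zero)    = inj₂ refl
⌈/2⌉-cases (suc (suc y)) with ⌈/2⌉-cases y
... | inj₁ eq = inj₁ (cong suc eq)
... | inj₂ eq = inj₂ (cong suc eq)

-- An additional unit goes to the left half if `y` is even and to the right half if it is odd, while
-- the other half keeps its amount. So one unit of load changes the share of a single interval of a
-- level.
share-suc : ∀ d y i → ∃ λ j* → block d j* ≡ i ×
  (share d (suc y) j* ≡ suc (share d y j*)) ×
  (∀ j → block d j ≡ i → j ≢ j* → share d (suc y) j ≡ share d y j)
share-suc zero    y i = i , refl , refl , λ j e j≢ → contradiction e j≢
share-suc (suc d) y i with ⌈/2⌉-cases y
... | inj₁ even with share-suc d ⌈ y /2⌉ (lo i)
...   | j* , e* , up , same = j* , ∈lo {d} e* , left , other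
  where
  at-lo : ∀ {j} z → block d j ≡ lo i → share (suc d) z j ≡ share d ⌈ z /2⌉ j
  at-lo {j} z e = cong (λ b → share d (pick b z) j) (trans (cong oddℤ e) (odd-lo i))
  at-hi : ∀ {j} z → block d j ≡ hi i → share (suc d) z j ≡ share d ⌊ z /2⌋ j
  at-hi {j} z e = cong (λ b → share d (pick b z) j) (trans (cong oddℤ e) (odd-hi i))
  left : share (suc d) (suc y) j* ≡ suc (share (suc d) y j*)
  left = trans (at-lo (suc y) e*) (trans (cong (λ z → share d (suc z) j*) (sym even))
           (trans up (cong suc (sym (at-lo y e*)))))
  other : ∀ j → block (suc d) j ≡ i → j ≢ j* → share (suc d) (suc y) j ≡ share (suc d) y j
  other j e j≢ with ∈⇒lo⊎hi {d} e
  ... | inj₁ l = trans (at-lo (suc y) l) (trans (cong (λ z → share d (suc z) j) (sym even))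
                   (trans (same j l j≢) (sym (at-lo y l))))
  ... | inj₂ r = trans (at-hi (suc y) r) (trans (cong (λ z → share d z j) even) (sym (at-hi y r)))
share-suc (suc d) y i | inj₂ odd′ with share-suc d ⌊ y /2⌋ (hi i)
...   | j* , e* , up , same = j* , ∈hi {d} e* , right , other
  where
  at-lo : ∀ {j} z → block d j ≡ lo i → share (suc d) z j ≡ share d ⌈ z /2⌉ j
  at-lo {j} z e = cong (λ b → share d (pick b z) j) (trans (cong oddℤ e) (odd-lo i))
  at-hi : ∀ {j} z → block d j ≡ hi i → share (suc d) z j ≡ share d ⌊ z /2⌋ j
  at-hi {j} z e = cong (λ b → share d (pick b z) j) (trans (cong oddℤ e) (odd-hi i))
  right : share (suc d) (suc y) j* ≡ suc (share (suc d) y j*)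
  right = trans (at-hi (suc y) e*) (trans (cong (λ z → share d z j*) odd′)
           (trans up (cong suc (sym (at-hi y e*)))))
  other : ∀ j → block (suc d) j ≡ i → j ≢ j* → share (suc d) (suc y) j ≡ share (suc d) y j
  other j e j≢ with ∈⇒lo⊎hi {d} e
  ... | inj₁ l = trans (at-lo (suc y) l) (trans (cong (λ z → share d z j) (sym odd′)) (sym (at-lo y l)))
  ... | inj₂ r = trans (at-hi (suc y) r) (trans (cong (λ z → share d z j) odd′)
                   (trans (same j r j≢) (sym (at-hi y r))))

-- The part of the load of the window of exponent e + suc d that falls to its subinterval j of exponent e.
sh : Config → ℕ → ℕ → ℤ → ℕ
sh y e d j = share (suc d) (y (e + suc d) (block (suc d) j)) j

-- Slots of interval j that are spoken for by windows of exponent at most e + d.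
claimed : Config → ℕ → ℕ → ℤ → ℕ
claimed y e zero    j = subtotal y e j
claimed y e (suc d) j = claimed y e d j + suc (sh y e d j)

-- Shorter windows are served first; each window asks for one slot plus its share of the load.
quota : Config → ℕ → ℕ → ℤ → ℕ
quota y e d j = suc (sh y e d j) ⊓ (2 ^ e ∸ claimed y e d j)

claimed-cong : ∀ {y y′} → (∀ k i → y k i ≡ y′ k i) → ∀ e d j → claimed y e d j ≡ claimed y′ e d j
claimed-cong h e zero    j = subtotal-cong h e j
claimed-cong h e (suc d) j = cong₂ (λ a b → a + suc (share (suc d) b j)) (claimed-cong h e d j) (h _ _)

quota-cong : ∀ {y y′} → (∀ k i → y k i ≡ y′ k i) → ∀ e d j → quota y e d j ≡ quota y′ e d j
quota-cong h e d j = cong₂ (λ a b → suc (share (suc d) b j) ⊓ (2 ^ e ∸ a)) (claimed-cong h e d j) (h _ _)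

claimed-mono : ∀ y e j {c d} → c ≤ d → claimed y e c j ≤ claimed y e d j
claimed-mono y e j {c} {d} c≤d = go (≤⇒≤′ c≤d)
  where
  go : ∀ {d} → c ≤′ d → claimed y e c j ≤ claimed y e d j
  go ≤′-refl = ≤-refl
  go (≤′-step p) = ≤-trans (go p) (m≤m+n _ _)

-- Each share is crudely replaced by the whole load of its window. This is good enough where
-- intervals are long compared with all loads together, as in `no-crossing`.
claimed≤subtotal : ∀ y e d j → claimed y e d j ≤ d + subtotal y (e + d) (block d j)
claimed≤subtotal y e zero    j rewrite +-identityʳ e = ≤-refl
claimed≤subtotal y e (suc d) j = begin
  claimed y e d j + suc s                          ≤⟨ +-monoˡ-≤ (suc s) (claimed≤subtotal y e d j) ⟩
  d + subtotal y (e + d) (block d j) + suc s        ≡⟨ lemma d (subtotal y (e + d) (block d j)) s ⟩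
  suc d + (s + subtotal y (e + d) (block d j))      ≤⟨ +-monoʳ-≤ (suc d) (+-mono-≤ (share≤ (suc d) _ j) child) ⟩
  suc d + (y (e + suc d) w + (subtotal y (e + d) (lo w) + subtotal y (e + d) (hi w)))
    ≡⟨ cong (suc d +_) (fold (+-suc e d)) ⟩
  suc d + subtotal y (e + suc d) w                  ∎
  where
  open ≤-Reasoning
  w : ℤ
  w = block (suc d) j
  s : ℕ
  s = sh y e d j
  lemma : ∀ a b c → a + b + suc c ≡ suc a + (c + b)
  lemma = solve-∀
  child : subtotal y (e + d) (block d j) ≤ subtotal y (e + d) (lo w) + subtotal y (e + d) (hi w)
  child with lo⊎hi (block d j)
  ... | inj₁ eq = ≤-trans (≤-reflexive (cong (subtotal y (e + d)) eq)) (m≤m+n _ _)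
  ... | inj₂ eq = ≤-trans (≤-reflexive (cong (subtotal y (e + d)) eq)) (m≤n+m _ _)
  fold : ∀ {k} → k ≡ suc (e + d) → y k w + (subtotal y (e + d) (lo w) + subtotal y (e + d) (hi w)) ≡ subtotal y k w
  fold refl = refl

-- The shares of a window add up to its load, so over a whole window the claims are the loads inside
-- it plus `d` slots per interval. Through this identity density limits the number of full
-- intervals.
ΣL-claimed : ∀ y e d i → ΣL d i (claimed y e d) ≡ 2 ^ d * d + subtotal y (e + d) i
ΣL-claimed y e zero    i rewrite +-identityʳ e = refl
ΣL-claimed y e (suc d) i = begin
  ΣL (suc d) i (λ j → claimed y e d j + suc (sh y e d j))
    ≡⟨ ΣL-+ (suc d) i (claimed y e d) (λ j → suc (sh y e d j)) ⟩
  (ΣL d (lo i) (claimed y e d) + ΣL d (hi i) (claimed y e d)) + ΣL (suc d) i (λ j → 1 + sh y e d j)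
    ≡⟨ cong₂ _+_ (cong₂ _+_ (ΣL-claimed y e d (lo i)) (ΣL-claimed y e d (hi i)))
        (trans (ΣL-+ (suc d) i (λ _ → 1) (sh y e d)) (cong₂ _+_ (ΣL-const (suc d) i 1)
          (trans (ΣL-cong (suc d) i (λ j eq → cong (λ z → share (suc d) (y (e + suc d) z) j) eq))
                 (ΣL-share (suc d) (y (e + suc d) i) i)))) ⟩
  ((2 ^ d * d + subtotal y (e + d) (lo i)) + (2 ^ d * d + subtotal y (e + d) (hi i))) + (2 * 2 ^ d * 1 + y (e + suc d) i)
    ≡⟨ lemma (2 ^ d) d (subtotal y (e + d) (lo i)) (subtotal y (e + d) (hi i)) (y (e + suc d) i) ⟩
  2 * 2 ^ d * suc d + (y (e + suc d) i + (subtotal y (e + d) (lo i) + subtotal y (e + d) (hi i)))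
    ≡⟨ cong (2 ^ suc d * suc d +_) (fold (+-suc e d)) ⟩
  2 ^ suc d * suc d + subtotal y (e + suc d) i ∎
  where
  open ≡-Reasoning
  lemma : ∀ q d a b c → ((q * d + a) + (q * d + b)) + (2 * q * 1 + c) ≡ 2 * q * suc d + (c + (a + b))
  lemma = solve-∀
  fold : ∀ {k} → k ≡ suc (e + d) → y k i + (subtotal y (e + d) (lo i) + subtotal y (e + d) (hi i)) ≡ subtotal y k i
  fold refl = refl

d≤claimed : ∀ y e d j → d ≤ claimed y e d j
d≤claimed y e zero    j = z≤n
d≤claimed y e (suc d) j = ≤-trans (≤-reflexive (+-comm 1 d)) (+-mono-≤ (d≤claimed y e d j) (s≤s z≤n))

-- Density and the sum of the quotas of a window

Dense : Config → Set
Dense y = ∀ k i → 4 * subtotal y k i ≤ 2 ^ k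

-- An interval refusing a reservation carries loads of at least 3/4 of its length, so density
-- leaves few such intervals; the inequality is the sum of `local` over all intervals of the window.
Σquota-large : ∀ y e h d i → Dense y → 4 * h ≤ 2 ^ e → d < h →
           2 ^ suc d + 2 * y (e + suc d) i ≤ 3 * ΣL (suc d) i (quota y e d)
Σquota-large y e h d i dense 4h≤ d<h = +-cancelˡ-≤ (2 * q + w) _ _ (begin
  2 * q + w + (q + 2 * w)   ≡⟨ arith₃ q w ⟩
  3 * (q + w)               ≤⟨ *-cancelˡ-≤ (M * q) {{Mq≢0}} total ⟩
  3 * SF + B                ≡⟨ arith₄ q w SF ⟩
  2 * q + w + 3 * SF        ∎)
  where
  open ≤-Reasoning
  M q w B D SF : ℕ
  M = 2 ^ e
  q = 2 ^ suc d
  w = y (e + suc d) i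
  -- `B / q` bounds the request `r j` of every interval: the share is less than `w / q + 1`, and one
  -- more slot is asked for.
  B = w + 2 * q
  D = suc d
  SF = ΣL (suc d) i (quota y e d)
  Mq≢0 : NonZero (M * q)
  Mq≢0 = m*n≢0 M q {{m^n≢0 2 e}} {{m^n≢0 2 (suc d)}}
  arith₃ : ∀ q w → 2 * q + w + (q + 2 * w) ≡ 3 * (q + w)
  arith₃ = solve-∀
  arith₄ : ∀ q w s → 3 * s + (w + 2 * q) ≡ 2 * q + w + 3 * s
  arith₄ = solve-∀

  r : ℤ → ℕ
  r j = suc (share (suc d) w j)
  qr≤B : ∀ j → q * r j ≤ B
  qr≤B j = begin
    q * suc s        ≡⟨ *-suc q s ⟩
    q + q * s        ≤⟨ +-monoʳ-≤ q (<⇒≤ (share-even (suc d) w j)) ⟩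
    q + (w + q)      ≡⟨ lem q w ⟩
    B                ∎
    where
    s : ℕ
    s = share (suc d) w j
    lem : ∀ q w → q + (w + q) ≡ w + 2 * q
    lem = solve-∀

  -- Every claim beyond the guaranteed `D` pays `4 * B`. An interval that does not grant the full
  -- request has at least `M ∸ D` of them, hence three quarters of `M`, which pays `3 * M * B`, and
  -- this covers the lost request weighted by `3 * M * q`.
  local : ∀ j → block (suc d) j ≡ i →
          3 * M * q * r j + 4 * D * B ≤ 3 * M * q * quota y e d j + 4 * B * claimed y e (suc d) j
  local j refl with r j ≤? M ∸ claimed y e d j
  ... | yes fits = +-mono-≤ (*-monoʳ-≤ (3 * M * q) (≤-reflexive (sym (m≤n⇒m⊓n≡m fits))))
        (begin 4 * D * B ≡⟨ lem D B ⟩ 4 * B * D ≤⟨ *-monoʳ-≤ (4 * B) (d≤claimed y e (suc d) j) ⟩ 4 * B * claimed y e (suc d) j ∎)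
    where
    lem : ∀ a b → 4 * a * b ≡ 4 * b * a
    lem = solve-∀
  ... | no ¬fits = begin
    3 * M * q * r j + 4 * D * B          ≡⟨ lem₁ M q (r j) D B ⟩
    3 * M * (q * r j) + 4 * D * B        ≤⟨ +-mono-≤ (*-monoʳ-≤ (3 * M) (qr≤B j)) (*-monoˡ-≤ B 4D≤M) ⟩
    3 * M * B + M * B                    ≡⟨ lem₂ M B ⟩
    4 * B * M                            ≤⟨ *-monoʳ-≤ (4 * B) M≤U ⟩
    4 * B * claimed y e (suc d) j              ≤⟨ m≤n+m _ _ ⟩
    3 * M * q * quota y e d j + 4 * B * claimed y e (suc d) j ∎
    where
    lem₁ : ∀ M q r D B → 3 * M * q * r + 4 * D * B ≡ 3 * M * (q * r) + 4 * D * B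
    lem₁ = solve-∀
    lem₂ : ∀ M B → 3 * M * B + M * B ≡ 4 * B * M
    lem₂ = solve-∀
    4D≤M : 4 * D ≤ M
    4D≤M = ≤-trans (*-monoʳ-≤ 4 d<h) 4h≤
    M≤U : M ≤ claimed y e (suc d) j
    M≤U = ≤-trans (m≤n+m∸n M (claimed y e d j)) (+-monoʳ-≤ (claimed y e d j) (<⇒≤ (≰⇒> ¬fits)))

  Σr : ΣL (suc d) i r ≡ q + w
  Σr = trans (ΣL-+ (suc d) i (λ _ → 1) (share (suc d) w))
         (cong₂ _+_ (trans (ΣL-const (suc d) i 1) (*-identityʳ q)) (ΣL-share (suc d) w i))

  summed : 3 * M * q * (q + w) + q * (4 * D * B) ≤ 3 * M * q * SF + 4 * B * (q * D + subtotal y (e + suc d) i)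
  summed = begin
    3 * M * q * (q + w) + q * (4 * D * B)
      ≡⟨ cong₂ _+_ (trans (cong (3 * M * q *_) (sym Σr)) (sym (ΣL-* (suc d) i (3 * M * q) r)))
                   (sym (ΣL-const (suc d) i (4 * D * B))) ⟩
    ΣL (suc d) i (λ j → 3 * M * q * r j) + ΣL (suc d) i (λ _ → 4 * D * B)
      ≡⟨ sym (ΣL-+ (suc d) i (λ j → 3 * M * q * r j) (λ _ → 4 * D * B)) ⟩
    ΣL (suc d) i (λ j → 3 * M * q * r j + 4 * D * B)
      ≤⟨ ΣL-mono (suc d) i local ⟩
    ΣL (suc d) i (λ j → 3 * M * q * quota y e d j + 4 * B * claimed y e (suc d) j)
      ≡⟨ ΣL-+ (suc d) i (λ j → 3 * M * q * quota y e d j) (λ j → 4 * B * claimed y e (suc d) j) ⟩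
    ΣL (suc d) i (λ j → 3 * M * q * quota y e d j) + ΣL (suc d) i (λ j → 4 * B * claimed y e (suc d) j)
      ≡⟨ cong₂ _+_ (ΣL-* (suc d) i (3 * M * q) (quota y e d))
           (trans (ΣL-* (suc d) i (4 * B) (claimed y e (suc d))) (cong (4 * B *_) (ΣL-claimed y e (suc d) i))) ⟩
    3 * M * q * SF + 4 * B * (q * D + subtotal y (e + suc d) i) ∎

  -- The terms with `D` cancel against the `D` slots per interval in `ΣL-claimed`; density bounds
  -- what remains of the claims.
  total : M * q * (3 * (q + w)) ≤ M * q * (3 * SF + B)
  total = +-cancelˡ-≤ (q * (4 * D * B)) _ _ (begin
    q * (4 * D * B) + M * q * (3 * (q + w))     ≡⟨ lem₁ q D B M (q + w) ⟩
    3 * M * q * (q + w) + q * (4 * D * B)       ≤⟨ summed ⟩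
    3 * M * q * SF + 4 * B * (q * D + Yw)       ≡⟨ lem₂ M q SF B D Yw ⟩
    q * (4 * D * B) + (3 * M * q * SF + B * (4 * Yw))
      ≤⟨ +-monoʳ-≤ (q * (4 * D * B)) (+-monoʳ-≤ (3 * M * q * SF) (*-monoʳ-≤ B 4Y≤)) ⟩
    q * (4 * D * B) + (3 * M * q * SF + B * (M * q)) ≡⟨ cong (q * (4 * D * B) +_) (lem₃ M q SF B) ⟩
    q * (4 * D * B) + M * q * (3 * SF + B) ∎)
    where
    Yw : ℕ
    Yw = subtotal y (e + suc d) i
    4Y≤ : 4 * Yw ≤ M * q
    4Y≤ = ≤-trans (dense (e + suc d) i) (≤-reflexive (^-distribˡ-+-* 2 e (suc d)))
    lem₁ : ∀ q D B M v → q * (4 * D * B) + M * q * (3 * v) ≡ 3 * M * q * v + q * (4 * D * B)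
    lem₁ = solve-∀
    lem₂ : ∀ M q S B D Z → 3 * M * q * S + 4 * B * (q * D + Z) ≡ q * (4 * D * B) + (3 * M * q * S + B * (4 * Z))
    lem₂ = solve-∀
    lem₃ : ∀ M q S B → 3 * M * q * S + B * (M * q) ≡ M * q * (3 * S + B)
    lem₃ = solve-∀

-- Here the two units of load per job are needed: the quotas sum to at least a third of
-- `2 ^ suc d + 2 * y`, hence of `2 ^ suc d + 4 * x`, which is more than `x`. One unit per job would
-- give only `2 * x` in place of `4 * x`.
jobs<Σquota : ∀ y e h d i {x} → Dense y → 4 * h ≤ 2 ^ e → d < h →
       2 * x ≤ y (e + suc d) i → x < ΣL (suc d) i (quota y e d)
jobs<Σquota y e h d i {x} dense 4h≤ d<h 2x≤ = *-cancelˡ-< 3 _ _ (begin-strict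
  3 * x                              <⟨ m<n+m (3 * x) {2 ^ suc d + x} (≤-trans (m^n>0 2 (suc d)) (m≤m+n _ x)) ⟩
  2 ^ suc d + x + 3 * x              ≡⟨ lem (2 ^ suc d) x ⟩
  2 ^ suc d + 2 * (2 * x)            ≤⟨ +-monoʳ-≤ (2 ^ suc d) (*-monoʳ-≤ 2 2x≤) ⟩
  2 ^ suc d + 2 * y (e + suc d) i    ≤⟨ Σquota-large y e h d i dense 4h≤ d<h ⟩
  3 * ΣL (suc d) i (quota y e d)         ∎)
  where
  open ≤-Reasoning
  lem : ∀ q x → q + x + 3 * x ≡ q + 2 * (2 * x)
  lem = solve-∀

-- Quotas fill the interval without overrunning it: this is the induction step of `occ-bound` and
-- `occ-strict`.
quota-fill : ∀ y e d j → claimed y e d j ⊓ 2 ^ e + quota y e d j ≤ claimed y e (suc d) j ⊓ 2 ^ e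
quota-fill y e d j = ⊓-glb
  (+-mono-≤ (m⊓n≤m (claimed y e d j) (2 ^ e)) (m⊓n≤m (suc (sh y e d j)) (2 ^ e ∸ claimed y e d j)))
  (≤-trans (+-monoʳ-≤ (claimed y e d j ⊓ 2 ^ e) (m⊓n≤n (suc (sh y e d j)) (2 ^ e ∸ claimed y e d j)))
     (≤-reflexive lem))
  where
  lem : claimed y e d j ⊓ 2 ^ e + (2 ^ e ∸ claimed y e d j) ≡ 2 ^ e
  lem with ≤-total (claimed y e d j) (2 ^ e)
  ... | inj₁ u≤ = trans (cong (_+ (2 ^ e ∸ claimed y e d j)) (m≤n⇒m⊓n≡m u≤)) (m+[n∸m]≡n u≤)
  ... | inj₂ u≥ = trans (cong₂ _+_ (m≥n⇒m⊓n≡n u≥) (m≤n⇒m∸n≡0 u≥)) (+-identityʳ (2 ^ e))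

-- One unit of load added at the window (k , i)

Inc : Config → Config → ℕ → ℤ → Set
Inc y y′ k i = ∀ k′ i′ → y′ k′ i′ ≡ y k′ i′ + at k i k′ i′

-- How the queue of an interval reacts to a unit of load. All change at one level happens in a
-- single interval `j*`: there the window owning the unit is `grown`, windows behind it are
-- `shifted`, windows before it stay the `same`.
data Change (y y′ : Config) (k e : ℕ) (j* : ℤ) (d : ℕ) (j : ℤ) : Set where
  same    : claimed y′ e d j ≡ claimed y e d j → sh y′ e d j ≡ sh y e d j → Change y y′ k e j* d j
  shifted : j ≡ j* → claimed y′ e d j ≡ suc (claimed y e d j) → sh y′ e d j ≡ sh y e d j → Change y y′ k e j* d j
  grown   : j ≡ j* → k ≡ e + suc d → claimed y′ e d j ≡ claimed y e d j → sh y′ e d j ≡ suc (sh y e d j) →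
            Change y y′ k e j* d j

Inc-same : ∀ {y y′ k i} → Inc y y′ k i → ∀ {k′ i′} → ¬ (k′ ≡ k × i′ ≡ i) → y′ k′ i′ ≡ y k′ i′
Inc-same {y} {k = k} {i} inc {k′} {i′} ne =
  trans (inc k′ i′) (trans (cong (y k′ i′ +_) (⟦⟧-no ((k′ ≟ k) ×-dec (i′ ℤ.≟ i)) ne)) (+-identityʳ _))

Inc-suc : ∀ {y y′ k i} → Inc y y′ k i → y′ k i ≡ suc (y k i)
Inc-suc {y} {k = k} {i} inc =
  trans (inc k i) (trans (cong (y k i +_) (⟦⟧-yes ((k ≟ k) ×-dec (i ℤ.≟ i)) (refl , refl))) (+-comm _ 1))

Inc-subtotal : ∀ {y y′ k i} → Inc y y′ k i → ∀ k′ i′ → subtotal y′ k′ i′ ≡ subtotal y k′ i′ + ⟦ within? k i k′ i′ ⟧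
Inc-subtotal {y} {k = k} {i} inc k′ i′ =
  trans (subtotal-cong inc k′ i′) (trans (subtotal-+ y (at k i) k′ i′) (cong (subtotal y k′ i′ +_) (subtotal-at k i k′ i′)))

-- A window of exponent at most `e` lies inside one interval, whose whole queue is shifted; for a
-- longer window `share-suc` singles out the interval that receives the unit.
change : ∀ {y y′ k i} → Inc y y′ k i → ∀ e → ∃ λ j* → ∀ d j → Change y y′ k e j* d j
change {y} {y′} {k} {i} inc e with k ≤? e
... | yes k≤e = block (e ∸ k) i , go
  where
  sh≡ : ∀ d j → sh y′ e d j ≡ sh y e d j
  sh≡ d j = cong (λ z → share (suc d) z j) (Inc-same inc λ { (eq , _) →
    <⇒≢ (≤-<-trans k≤e (m<m+n e z<s)) (sym eq) })
  U≡ : ∀ d j → claimed y′ e d j ≡ claimed y e d j + ⟦ within? k i e j ⟧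
  U≡ zero    j = Inc-subtotal inc e j
  U≡ (suc d) j = trans (cong₂ (λ a b → a + suc b) (U≡ d j) (sh≡ d j)) (lem (claimed y e d j) _ _)
    where
    lem : ∀ a b c → a + b + suc c ≡ a + suc c + b
    lem = solve-∀
  go : ∀ d j → Change y y′ k e (block (e ∸ k) i) d j
  go d j with j ℤ.≟ block (e ∸ k) i
  ... | yes eq = shifted eq (trans (U≡ d j) (trans (cong (claimed y e d j +_)
                   (⟦⟧-yes (within? k i e j) (k≤e , sym eq))) (+-comm _ 1))) (sh≡ d j)
  ... | no ne = same (trans (U≡ d j) (trans (cong (claimed y e d j +_)
                   (⟦⟧-no (within? k i e j) (ne ∘ sym ∘ proj₂))) (+-identityʳ _))) (sh≡ d j)
... | no k≰e with m<n⇒∃ (≰⇒> k≰e)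
  where
  m<n⇒∃ : ∀ {m n} → m < n → ∃ λ d → n ≡ m + suc d
  m<n⇒∃ {m} {n} m<n = n ∸ suc m , trans (sym (m+[n∸m]≡n m<n)) (sym (+-suc m _))
... | d₀ , refl with share-suc (suc d₀) (y k i) i
...   | j* , e* , up , keep = j* , go
  where
  Y≡ : ∀ j → subtotal y′ e j ≡ subtotal y e j
  Y≡ j = trans (Inc-subtotal inc e j) (trans (cong (subtotal y e j +_) (⟦⟧-no (within? k i e j) (k≰e ∘ proj₁))) (+-identityʳ _))
  sh-other : ∀ d j → d ≢ d₀ → sh y′ e d j ≡ sh y e d j
  sh-other d j ne = cong (λ z → share (suc d) z j) (Inc-same inc λ { (eq , _) →
    ne (suc-injective (+-cancelˡ-≡ e _ _ eq)) })
  sh-off : ∀ d j → j ≢ j* → sh y′ e d j ≡ sh y e d j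
  sh-off d j ne with d ≟ d₀
  ... | no d≢ = sh-other d j d≢
  ... | yes refl with block (suc d) j ℤ.≟ i
  ...   | no b≢ = cong (λ z → share (suc d) z j) (Inc-same inc (b≢ ∘ proj₂))
  ...   | yes refl = trans (cong (λ z → share (suc d) z j) (Inc-suc inc)) (keep j refl ne)
  U-off : ∀ d j → j ≢ j* → claimed y′ e d j ≡ claimed y e d j
  U-off zero    j ne = Y≡ j
  U-off (suc d) j ne = cong₂ (λ a b → a + suc b) (U-off d j ne) (sh-off d j ne)
  sh-grown : sh y′ e d₀ j* ≡ suc (sh y e d₀ j*)
  sh-grown = trans (cong (λ z → share (suc d₀) (y′ k z) j*) e*)
    (trans (cong (λ z → share (suc d₀) z j*) (Inc-suc inc))
      (trans up (cong (λ z → suc (share (suc d₀) (y k z) j*)) (sym e*))))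
  U-below : ∀ d → d ≤ d₀ → claimed y′ e d j* ≡ claimed y e d j*
  U-below zero    _ = Y≡ j*
  U-below (suc d) d<d₀ = cong₂ (λ a b → a + suc b) (U-below d (<⇒≤ d<d₀)) (sh-other d j* (<⇒≢ d<d₀))
  U-above : ∀ d → d₀ < d → claimed y′ e d j* ≡ suc (claimed y e d j*)
  U-above (suc d) (s≤s d₀≤d) with d₀ ≟ d
  ... | yes refl = trans (cong₂ (λ a b → a + suc b) (U-below d ≤-refl) sh-grown) (+-suc (claimed y e d j*) _)
  ... | no ne = cong₂ (λ a b → a + suc b) (U-above d (≤∧≢⇒< d₀≤d ne)) (sh-other d j* (ne ∘ sym))
  go : ∀ d j → Change y y′ k e j* d j
  go d j with j ℤ.≟ j*
  ... | no ne = same (U-off d j ne) (sh-off d j ne)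
  ... | yes refl with <-cmp d d₀
  ...   | tri< lt ne _ = same (U-below d (<⇒≤ lt)) (sh-other d j ne)
  ...   | tri≈ _ refl _ = grown refl refl (U-below d ≤-refl) sh-grown
  ...   | tri> _ ne gt = shifted refl (U-above d gt) (sh-other d j ne)

-- The window at which the claims reach the end of the interval, the only one that a shift can hurt.
-- Reaching the end exactly is included, since then a shift by one already costs a slot.
Crossing : Config → ℕ → ℤ → ℕ → Set
Crossing y e j d = claimed y e d j < 2 ^ e × 2 ^ e ≤ claimed y e (suc d) j

Crossing-unique : ∀ y e j {c d} → Crossing y e j c → Crossing y e j d → c ≡ d
Crossing-unique y e j {c} {d} (c< , ≤c) (d< , ≤d) with <-cmp c d
... | tri< c<d _ _ = contradiction (≤-trans ≤c (claimed-mono y e j c<d)) (<⇒≱ d<)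
... | tri≈ _ eq _ = eq
... | tri> _ _ d<c = contradiction (≤-trans ≤d (claimed-mono y e j d<c)) (<⇒≱ c<)

quota-inc : ∀ {y y′ k e j* d j} → Change y y′ k e j* d j →
  quota y e d j ≤ quota y′ e d j ⊎ (j ≡ j* × Crossing y e j d × quota y e d j ≤ suc (quota y′ e d j))
quota-inc {y} {y′} {e = e} {d = d} {j} (same u s) = inj₁ (≤-reflexive (cong₂ (λ a b → suc b ⊓ (2 ^ e ∸ a)) (sym u) (sym s)))
quota-inc {y} {y′} {e = e} {d = d} {j} (grown _ _ u s) = inj₁
  (≤-trans (⊓-monoˡ-≤ (2 ^ e ∸ claimed y e d j) (n≤1+n (suc (sh y e d j))))
    (≤-reflexive (cong₂ (λ a b → suc b ⊓ (2 ^ e ∸ a)) (sym u) (sym s))))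
quota-inc {y} {y′} {e = e} {d = d} {j} (shifted eq u s) with claimed y e d j <? 2 ^ e | 2 ^ e ≤? claimed y e (suc d) j
... | no full | _ = inj₁ (≤-trans (m⊓n≤n (suc (sh y e d j)) _) (≤-trans (≤-reflexive (m≤n⇒m∸n≡0 (≮⇒≥ full))) z≤n))
... | yes room | yes cross = inj₂ (eq , (room , cross) , (begin
    r ⊓ (2 ^ e ∸ u₀)            ≡⟨ cong (r ⊓_) (+-∸-assoc 1 room) ⟩
    r ⊓ suc (2 ^ e ∸ suc u₀)    ≤⟨ ⊓-monoˡ-≤ (suc (2 ^ e ∸ suc u₀)) (n≤1+n r) ⟩
    suc (r ⊓ (2 ^ e ∸ suc u₀))  ≡⟨ cong₂ (λ a b → suc (suc b ⊓ (2 ^ e ∸ a))) (sym u) (sym s) ⟩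
    suc (quota y′ e d j)            ∎))
  where
  open ≤-Reasoning
  r u₀ : ℕ
  r = suc (sh y e d j)
  u₀ = claimed y e d j
... | yes room | no ¬cross = inj₁ (begin
    r ⊓ (2 ^ e ∸ u₀)        ≤⟨ m⊓n≤m r _ ⟩
    r                       ≡⟨ sym (m≤n⇒m⊓n≡m (m+n≤o⇒m≤o∸n r (≤-trans (≤-reflexive (trans (+-suc r u₀) (cong suc (+-comm r u₀)))) (≰⇒> ¬cross)))) ⟩
    r ⊓ (2 ^ e ∸ suc u₀)    ≡⟨ cong₂ (λ a b → suc b ⊓ (2 ^ e ∸ a)) (sym u) (sym s) ⟩
    quota y′ e d j              ∎)
  where
  open ≤-Reasoning
  r u₀ : ℕ
  r = suc (sh y e d j)
  u₀ = claimed y e d j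

-- To be read from `y′` back to `y`, as a loss of load. Claims that move forward in the queue only
-- gain room, so a quota can drop for the window losing the unit and for no other; therefore a
-- deletion affects a single level.
quota-dec : ∀ {y y′ k e j* d j} → Change y y′ k e j* d j →
  quota y′ e d j ≤ quota y e d j ⊎ (j ≡ j* × k ≡ e + suc d × quota y′ e d j ≤ suc (quota y e d j))
quota-dec {e = e} (same u s) = inj₁ (≤-reflexive (cong₂ (λ a b → suc b ⊓ (2 ^ e ∸ a)) u s))
quota-dec {y} {y′} {e = e} {d = d} {j} (shifted _ u s) = inj₁
  (≤-trans (≤-reflexive (cong₂ (λ a b → suc b ⊓ (2 ^ e ∸ a)) u s))
    (⊓-monoʳ-≤ (suc (sh y e d j)) (∸-monoʳ-≤ (2 ^ e) (n≤1+n (claimed y e d j)))))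
quota-dec {y} {y′} {e = e} {d = d} {j} (grown eq k≡ u s) = inj₂ (eq , k≡ ,
  ≤-trans (≤-reflexive (cong₂ (λ a b → suc b ⊓ (2 ^ e ∸ a)) u s))
    (⊓-monoʳ-≤ (suc (suc (sh y e d j))) (n≤1+n _)))

-- Positions and moves

-- A machine and a timeslot; `nothing` stands for a job that is not scheduled yet.
Pos : Set
Pos = Maybe (ℕ × ℤ)

_≟ₚ_ : (p q : Pos) → Dec (p ≡ q)
_≟ₚ_ = Maybeₚ.≡-dec (×ₚ.≡-dec _≟_ ℤ._≟_)

-- A job not scheduled yet counts as being on every machine. It then contributes to the jobs of the
-- machine chosen for it, and placing it is an ordinary swap of `nothing` with a slot. It is
-- `Inside` no interval, so it uses up no quota.
On : ℕ → Pos → Set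
On μ nothing        = ⊤
On μ (just (ν , s)) = ν ≡ μ

On? : ∀ μ p → Dec (On μ p)
On? μ nothing        = yes tt
On? μ (just (ν , s)) = ν ≟ μ

Inside : ℕ → ℕ → ℤ → Pos → Set
Inside μ e j nothing        = ⊥
Inside μ e j (just (ν , s)) = ν ≡ μ × block e s ≡ j

Inside? : ∀ μ e j p → Dec (Inside μ e j p)
Inside? μ e j nothing        = no id
Inside? μ e j (just (ν , s)) = (ν ≟ μ) ×-dec (block e s ℤ.≟ j)

Inside⇒On : ∀ {μ e j} p → Inside μ e j p → On μ p
Inside⇒On (just _) (eq , _) = eq

swapBy : ∀ {p q x : Pos} → Dec (x ≡ p) → Dec (x ≡ q) → Pos
swapBy {q = q} (yes _) _       = q
swapBy {p = p} (no _)  (yes _) = p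
swapBy {x = x} (no _)  (no _)  = x

swapₚ : Pos → Pos → Pos → Pos
swapₚ p q x = swapBy (x ≟ₚ p) (x ≟ₚ q)

data Swap (p q x : Pos) : Set where
  first  : x ≡ p → swapₚ p q x ≡ q → Swap p q x
  second : x ≢ p → x ≡ q → swapₚ p q x ≡ p → Swap p q x
  fixed  : x ≢ p → x ≢ q → swapₚ p q x ≡ x → Swap p q x

swap-view : ∀ p q x → Swap p q x
swap-view p q x = view (x ≟ₚ p) (x ≟ₚ q) refl
  where
  view : (d : Dec (x ≡ p)) (d′ : Dec (x ≡ q)) → swapₚ p q x ≡ swapBy d d′ → Swap p q x
  view (yes e) _        eq = first e eq
  view (no ne) (yes e)  eq = second ne e eq
  view (no ne) (no ne′) eq = fixed ne ne′ eq

swap-first : ∀ p q → swapₚ p q p ≡ q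
swap-first p q with swap-view p q p
... | first _ e     = e
... | second ne _ _ = contradiction refl ne
... | fixed ne _ _  = contradiction refl ne

swap-second : ∀ p q → swapₚ p q q ≡ p
swap-second p q with swap-view p q q
... | first e e′   = trans e′ e
... | second _ _ e = e
... | fixed _ ne _ = contradiction refl ne

swap-fixed : ∀ p q x → x ≢ p → x ≢ q → swapₚ p q x ≡ x
swap-fixed p q x x≢p x≢q with swap-view p q x
... | first e _    = contradiction e x≢p
... | second _ e _ = contradiction e x≢q
... | fixed _ _ e  = e

swap-injective : ∀ p q {x y} → swapₚ p q x ≡ swapₚ p q y → x ≡ y
swap-injective p q {x} {y} eq with swap-view p q x | swap-view p q y
... | first a b    | first c d    = trans a (sym c)
... | first a b    | second c d f = trans a (trans (sym f) (trans (sym eq) (trans b (sym d))))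
... | first a b    | fixed c d f  = contradiction (trans (sym f) (trans (sym eq) b)) d
... | second a b c | first d f    = trans b (trans (sym f) (trans (sym eq) (trans c (sym d))))
... | second a b c | second d f g = trans b (sym f)
... | second a b c | fixed d f g  = contradiction (trans (sym g) (trans (sym eq) c)) d
... | fixed a b c  | first d f    = contradiction (trans (sym c) (trans eq f)) b
... | fixed a b c  | second d f g = contradiction (trans (sym c) (trans eq g)) a
... | fixed a b c  | fixed d f g  = trans (sym c) (trans eq g)

-- Rescheduling acts on positions and is composed with the map from jobs to positions: injectivity
-- keeps the slots distinct, and since distinct jobs have distinct positions, `support` bounds the
-- number of jobs that move.
record Move (μ n : ℕ) : Set where
  field
    τ       : Pos → Pos
    support : List Pos
    size    : length support ≤ n
    outside : ∀ x → x ∉ support → τ x ≡ x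
    inj     : ∀ {x y} → τ x ≡ τ y → x ≡ y
    on      : ∀ x → On μ x → On μ (τ x)
    off     : ∀ x → ¬ On μ x → τ x ≡ x
open Move public

idMove : ∀ {μ n} → Move μ n
idMove = record { τ = id ; support = [] ; size = z≤n ; outside = λ _ _ → refl ; inj = id
                ; on = λ _ → id ; off = λ _ _ → refl }

resize : ∀ {μ m n} → m ≤ n → Move μ m → Move μ n
resize le P = record { Move P hiding (size) ; size = ≤-trans (size P) le }

_then_ : ∀ {μ m n} → Move μ m → Move μ n → Move μ (m + n)
P then Q = record
  { τ       = τ Q ∘ τ P
  ; support = support P ++ support Q
  ; size    = ≤-trans (≤-reflexive (length-++ (support P))) (+-mono-≤ (size P) (size Q))
  ; outside = λ x x∉ → trans (cong (τ Q) (outside P x (x∉ ∘ ∈-++⁺ˡ))) (outside Q x (x∉ ∘ ∈-++⁺ʳ (support P)))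
  ; inj     = inj P ∘ inj Q
  ; on      = λ x → on Q _ ∘ on P x
  ; off     = λ x ¬on → trans (cong (τ Q) (off P x ¬on)) (off Q x ¬on)
  }

swapMove : ∀ {μ} p q → On μ p → On μ q → Move μ 2
swapMove {μ} p q onp onq = record
  { τ = swapₚ p q ; support = p ∷ q ∷ [] ; size = ≤-refl ; outside = out
  ; inj = swap-injective p q ; on = on′ ; off = off′ }
  where
  out : ∀ x → x ∉ p ∷ q ∷ [] → swapₚ p q x ≡ x
  out x x∉ = swap-fixed p q x (x∉ ∘ here) (x∉ ∘ there ∘ here)
  on′ : ∀ x → On μ x → On μ (swapₚ p q x)
  on′ x o with swap-view p q x
  ... | first _ e    = subst (On μ) (sym e) onq
  ... | second _ _ e = subst (On μ) (sym e) onp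
  ... | fixed _ _ e  = subst (On μ) (sym e) o
  off′ : ∀ x → ¬ On μ x → swapₚ p q x ≡ x
  off′ x ¬o = out x λ { (here refl) → ¬o onp ; (there (here refl)) → ¬o onq }

on⁻ : ∀ {μ n} (P : Move μ n) x → On μ (τ P x) → On μ x
on⁻ {μ} P x o with On? μ x
... | yes on-x = on-x
... | no ¬on-x = subst (On μ) (off P x ¬on-x) o

-- Placements

intervalΣ : ∀ {Q : Set} μ e d i (q : Dec Q) p →
  ΣL d i (λ j → ⟦ q ×-dec Inside? μ e j p ⟧) ≤ ⟦ q ×-dec Inside? μ (d + e) i p ⟧
intervalΣ {Q} μ e d i q p with q
... | no ¬q = ≤-reflexive (trans (ΣL-const d i 0) (*-zeroʳ (2 ^ d)))
... | yes x with p
...   | nothing = ≤-reflexive (trans (ΣL-const d i 0) (*-zeroʳ (2 ^ d)))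
...   | just (ν , s) with ν ≟ μ
...     | no ν≢ = ≤-reflexive (trans (ΣL-const d i 0) (*-zeroʳ (2 ^ d)))
...     | yes refl = begin
  ΣL d i (λ j → ⟦ yes x ×-dec (yes refl ×-dec (block e s ℤ.≟ j)) ⟧)
    ≤⟨ ΣL-mono d i (λ j _ → ⟦⟧-mono (yes x ×-dec (yes refl ×-dec (block e s ℤ.≟ j))) (block e s ℤ.≟ j) (proj₂ ∘ proj₂)) ⟩
  ΣL d i (λ j → ⟦ block e s ℤ.≟ j ⟧)
    ≡⟨ ΣL-δ d i (block e s) ⟩
  ⟦ block d (block e s) ℤ.≟ i ⟧
    ≤⟨ ⟦⟧-mono (block d (block e s) ℤ.≟ i) (yes x ×-dec (yes refl ×-dec (block (d + e) s ℤ.≟ i)))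
         (λ eq → x , refl , trans (block-+ d e s) eq) ⟩
  ⟦ yes x ×-dec (yes refl ×-dec (block (d + e) s ℤ.≟ i)) ⟧ ∎
  where open ≤-Reasoning

Uniq : ∀ {A B : Set} → (A → B) → List A → Set
Uniq f = AllPairs (λ a b → f a ≢ f b)

module _ {A B : Set} {f : A → B} where
  Uniq-injective : ∀ {xs} → Uniq f xs → ∀ {a b} → a ∈ xs → b ∈ xs → f a ≡ f b → a ≡ b
  Uniq-injective (p ∷ u) (here refl) (here refl) eq = refl
  Uniq-injective (p ∷ u) (here refl) (there m)   eq = contradiction eq (All.lookup p m)
  Uniq-injective (p ∷ u) (there m)   (here refl) eq = contradiction (sym eq) (All.lookup p m)
  Uniq-injective (p ∷ u) (there m)   (there n)   eq = Uniq-injective u m n eq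

  record Split (xs : List A) (a : A) : Set where
    field
      rest   : List A
      ∑-rest : ∀ g → ∑ xs g ≡ g a + ∑ rest g
      sub    : ∀ b → b ∈ rest → b ∈ xs × f b ≢ f a
      cover  : ∀ b → b ∈ xs → b ≡ a ⊎ b ∈ rest
      len    : length xs ≡ suc (length rest)
      uniqʳ  : Uniq f rest

  split : ∀ {xs} → Uniq f xs → ∀ {a} → a ∈ xs → Split xs a
  split {x ∷ xs} (p ∷ u) (here refl) = record
    { rest = xs ; ∑-rest = λ g → refl
    ; sub = λ b m → there m , λ eq → All.lookup p m (sym eq)
    ; cover = λ { b (here eq) → inj₁ eq ; b (there m) → inj₂ m } ; len = refl ; uniqʳ = u }
  split {x ∷ xs} (p ∷ u) {a} (there m) = record
    { rest = x ∷ rest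
    ; ∑-rest = λ g → trans (cong (g x +_) (∑-rest g)) (lem (g x) (g a) (∑ rest g))
    ; sub = λ { b (here refl) → here refl , All.lookup p m ; b (there n) → there (proj₁ (sub b n)) , proj₂ (sub b n) }
    ; cover = λ { b (here refl) → inj₂ (here refl)
                ; b (there n) → [ inj₁ , inj₂ ∘ there ]′ (cover b n) }
    ; len = cong suc len
    ; uniqʳ = All.tabulate (λ {b} n → All.lookup p (proj₁ (sub b n))) ∷ uniqʳ }
    where
    open Split (split u m)
    lem : ∀ a b c → a + (b + c) ≡ b + (a + c)
    lem = solve-∀
open Split public

module Placement {A : Set} (ex : A → ℕ) (ix : A → ℤ) where

  load : List A → (A → ℕ) → Config
  load xs c k i = ∑ xs (λ a → c a * at (ex a) (ix a) k i)

  subtotal-load : ∀ xs c k i → subtotal (load xs c) k i ≡ ∑ xs (λ a → c a * ⟦ within? (ex a) (ix a) k i ⟧)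
  subtotal-load []       c k i = subtotal-0 k i
    where
    subtotal-0 : ∀ k i → subtotal (λ _ _ → 0) k i ≡ 0
    subtotal-0 zero    i = refl
    subtotal-0 (suc k) i = cong₂ _+_ (subtotal-0 k (lo i)) (subtotal-0 k (hi i))
  subtotal-load (a ∷ xs) c k i =
    trans (subtotal-+ (λ k i → c a * at (ex a) (ix a) k i) (load xs c) k i)
      (cong₂ _+_ (trans (subtotal-* (c a) (at (ex a) (ix a)) k i) (cong (c a *_) (subtotal-at (ex a) (ix a) k i)))
                 (subtotal-load xs c k i))

  jobsOn : ℕ → (A → Pos) → List A → Config
  jobsOn μ loc xs = load xs (λ a → ⟦ On? μ (loc a) ⟧)

  -- No index of a window is required: interval `j` lies in just one window of exponent `e + suc d`,
  -- and under `Fits` the jobs counted have that window.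
  count : ℕ → (A → Pos) → List A → ℕ → ℕ → ℤ → ℕ
  count μ loc xs e d j = ∑ xs (λ a → ⟦ (ex a ≟ e + suc d) ×-dec Inside? μ e j (loc a) ⟧)

  Fits : (A → Pos) → List A → Set
  Fits loc xs = ∀ a → a ∈ xs → ∀ ν s → loc a ≡ just (ν , s) → block (ex a) s ≡ ix a

  -- Only an inequality, because the loads run ahead of the jobs: a job accounts for two units, and
  -- the quotas adapt unit by unit before a job is added or after it is removed.
  Dom : ℕ → Config → (A → Pos) → List A → Set
  Dom μ y loc xs = ∀ k i → 2 * jobsOn μ loc xs k i ≤ y k i

  Ok : ℕ → Config → ℕ → ℕ → (A → Pos) → List A → Set
  Ok μ y e h loc xs = ∀ d j → d < h → count μ loc xs e d j ≤ quota y e d j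

  Uniq-move : ∀ {μ n} {loc : A → Pos} {xs} (P : Move μ n) → Uniq loc xs → Uniq (τ P ∘ loc) xs
  Uniq-move P = AllPairs.map (λ ne → ne ∘ inj P)

  jobsOn-move : ∀ {μ n} (P : Move μ n) loc xs k i → jobsOn μ (τ P ∘ loc) xs k i ≡ jobsOn μ loc xs k i
  jobsOn-move {μ} P loc xs k i = ∑-cong xs (λ a _ → cong (_* at (ex a) (ix a) k i)
    (⟦⟧-cong (On? μ (τ P (loc a))) (On? μ (loc a)) (on⁻ P (loc a)) (on P (loc a))))

  Dom-move : ∀ {μ n y loc xs} (P : Move μ n) → Dom μ y loc xs → Dom μ y (τ P ∘ loc) xs
  Dom-move {loc = loc} {xs} P dom k i = ≤-trans (≤-reflexive (cong (2 *_) (jobsOn-move P loc xs k i))) (dom k i)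

  count-mono : ∀ {μ loc loc′ xs e d j} →
    (∀ a → a ∈ xs → ex a ≡ e + suc d → Inside μ e j (loc′ a) → Inside μ e j (loc a)) →
    count μ loc′ xs e d j ≤ count μ loc xs e d j
  count-mono {μ} {loc} {loc′} {xs} {e} {d} {j} f = ∑-mono xs (λ a m →
    ⟦⟧-mono ((ex a ≟ e + suc d) ×-dec Inside? μ e j (loc′ a)) ((ex a ≟ e + suc d) ×-dec Inside? μ e j (loc a))
      (λ (eq , i) → eq , f a m eq i))

  count-other : ∀ {μ n ν} (P : Move μ n) → ν ≢ μ → ∀ (loc : A → Pos) xs e d j →
    count ν (τ P ∘ loc) xs e d j ≤ count ν loc xs e d j
  count-other {μ} {ν = ν} P ν≢μ loc xs e d j = count-mono {loc = loc} {xs = xs} {d = d} (λ a _ _ → lem (loc a))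
    where
    clash : ∀ p → On μ p → ¬ Inside ν e j p
    clash (just _) refl (eq , _) = ν≢μ (sym eq)
    lem : ∀ p → Inside ν e j (τ P p) → Inside ν e j p
    lem p i with On? μ p
    ... | no ¬o = subst (Inside ν e j) (off P p ¬o) i
    ... | yes o = contradiction i (clash (τ P p) (on P p o))

  vacant : ∀ {Q : A → Set} (Q? : ∀ a → Dec (Q a)) μ (loc : A → Pos) xs e j →
    ∑ xs (λ a → ⟦ Q? a ×-dec Inside? μ e j (loc a) ⟧) < 2 ^ e →
    ∃ λ s → block e s ≡ j × (∀ a → a ∈ xs → Q a → loc a ≢ just (μ , s))
  vacant {Q} Q? μ loc xs e j lt = s , s∈ , empty
    where
    open ≤-Reasoning
    at-slot : ℤ → A → ℕ
    at-slot s a = ⟦ Q? a ×-dec Inside? μ 0 s (loc a) ⟧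
    few : ΣL e j (λ s → ∑ xs (at-slot s)) < ΣL e j (λ _ → 1)
    few = begin-strict
      ΣL e j (λ s → ∑ xs (at-slot s))                        ≡⟨ ΣL-∑ e j xs (λ a s → at-slot s a) ⟩
      ∑ xs (λ a → ΣL e j (λ s → at-slot s a))                ≤⟨ ∑-mono xs (λ a _ → intervalΣ μ 0 e j (Q? a) (loc a)) ⟩
      ∑ xs (λ a → ⟦ Q? a ×-dec Inside? μ (e + 0) j (loc a) ⟧)   ≡⟨ cong (λ z → ∑ xs (λ a → ⟦ Q? a ×-dec Inside? μ z j (loc a) ⟧)) (+-identityʳ e) ⟩
      ∑ xs (λ a → ⟦ Q? a ×-dec Inside? μ e j (loc a) ⟧)         <⟨ lt ⟩
      2 ^ e                                                  ≡⟨ sym (*-identityʳ (2 ^ e)) ⟩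
      2 ^ e * 1                                              ≡⟨ sym (ΣL-const e j 1) ⟩
      ΣL e j (λ _ → 1)                                       ∎
    found : ∃ λ s → block e s ≡ j × ∑ xs (at-slot s) < 1
    found = ΣL-find e j _ _ few
    s : ℤ
    s = proj₁ found
    s∈ : block e s ≡ j
    s∈ = proj₁ (proj₂ found)
    empty : ∀ a → a ∈ xs → Q a → loc a ≢ just (μ , s)
    empty a m q eq = <⇒≱ (proj₂ (proj₂ found)) (≤-trans
      (≤-reflexive (sym (⟦⟧-yes (Q? a ×-dec Inside? μ 0 s (loc a)) (q , subst (Inside μ 0 s) (sym eq) (refl , refl)))))
      (∑-∈ (at-slot s) m))

  module _ {μ y e h loc xs} (valid : Fits loc xs) (dom : Dom μ y loc xs) (dense : Dense y)
           (ok : Ok μ y e h loc xs) where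

    occ : ℤ → ℕ → ℕ
    occ j d = ∑ xs (λ a → ⟦ (ex a ≤? e + d) ×-dec Inside? μ e j (loc a) ⟧)

    -- A job whose window is no longer than the interval has its whole window inside, so it is part
    -- of the load set aside for lower levels.
    occ-zero : ∀ j → occ j 0 ≤ subtotal y e j
    occ-zero j = begin
      occ j 0
        ≤⟨ ∑-mono xs pointwise ⟩
      ∑ xs (λ a → ⟦ On? μ (loc a) ⟧ * ⟦ within? (ex a) (ix a) e j ⟧)
        ≡⟨ sym (subtotal-load xs (λ a → ⟦ On? μ (loc a) ⟧) e j) ⟩
      subtotal (jobsOn μ loc xs) e j
        ≤⟨ subtotal-mono (λ k i → ≤-trans (m≤m+n _ _) (dom k i)) e j ⟩
      subtotal y e j ∎
      where
      open ≤-Reasoning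
      inside : ∀ a → a ∈ xs → ex a ≤ e → ∀ p → loc a ≡ p → Inside μ e j p → block (e ∸ ex a) (ix a) ≡ j
      inside a m le (just (ν , s)) eq (_ , b) =
        trans (cong (block (e ∸ ex a)) (sym (valid a m ν s eq))) (trans (sym (block-∸ le s)) b)
      pointwise : ∀ a → a ∈ xs → ⟦ (ex a ≤? e + 0) ×-dec Inside? μ e j (loc a) ⟧ ≤
                    ⟦ On? μ (loc a) ⟧ * ⟦ within? (ex a) (ix a) e j ⟧
      pointwise a m with (ex a ≤? e + 0) ×-dec Inside? μ e j (loc a)
      ... | no _ = z≤n
      ... | yes (le , i) = ≤-reflexive (sym (cong₂ _*_ (⟦⟧-yes (On? μ (loc a)) (Inside⇒On (loc a) i))
              (⟦⟧-yes (within? (ex a) (ix a) e j) (le′ , inside a m le′ (loc a) refl i))))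
        where
        le′ : ex a ≤ e
        le′ = subst (ex a ≤_) (+-identityʳ e) le

    occ-suc : ∀ j d → occ j (suc d) ≤ occ j d + count μ loc xs e d j
    occ-suc j d = ≤-trans (∑-mono xs (λ a _ → pointwise a)) (≤-reflexive (∑-+ xs _ _))
      where
      pointwise : ∀ a → ⟦ (ex a ≤? e + suc d) ×-dec Inside? μ e j (loc a) ⟧ ≤
        ⟦ (ex a ≤? e + d) ×-dec Inside? μ e j (loc a) ⟧ + ⟦ (ex a ≟ e + suc d) ×-dec Inside? μ e j (loc a) ⟧
      pointwise a with ex a ≟ e + suc d
      ... | yes eq = ≤-trans (⟦⟧-mono ((ex a ≤? e + suc d) ×-dec Inside? μ e j (loc a)) (yes eq ×-dec Inside? μ e j (loc a)) (λ (_ , i) → eq , i))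
                       (m≤n+m _ _)
      ... | no ne = ≤-trans (⟦⟧-mono ((ex a ≤? e + suc d) ×-dec Inside? μ e j (loc a)) ((ex a ≤? e + d) ×-dec Inside? μ e j (loc a))
                       (λ (le , i) → s≤s⁻¹ (subst (suc (ex a) ≤_) (+-suc e d) (≤∧≢⇒< le ne)) , i))
                       (m≤m+n _ _)

    occ-bound : ∀ j d → d ≤ h → occ j d ≤ claimed y e d j ⊓ 2 ^ e
    occ-bound j zero    _   = ⊓-glb (occ-zero j)
      (≤-trans (occ-zero j) (≤-trans (m≤m+n (subtotal y e j) _) (dense e j)))
    occ-bound j (suc d) d<h = begin
      occ j (suc d)                          ≤⟨ occ-suc j d ⟩
      occ j d + count μ loc xs e d j           ≤⟨ +-mono-≤ (occ-bound j d (<⇒≤ d<h)) (ok d j d<h) ⟩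
      claimed y e d j ⊓ 2 ^ e + quota y e d j          ≤⟨ quota-fill y e d j ⟩
      claimed y e (suc d) j ⊓ 2 ^ e                ∎
      where open ≤-Reasoning

    -- Slack at one window survives to the end of the queue, as no later window exceeds its quota.
    -- The result is a slot without jobs of this level or lower ones.
    occ-strict : ∀ j {c d} → count μ loc xs e c j < quota y e c j → suc c ≤′ d → d ≤ h →
                 occ j d < claimed y e d j ⊓ 2 ^ e
    occ-strict j {c} lt ≤′-refl d≤h = begin-strict
      occ j (suc c)                          ≤⟨ occ-suc j c ⟩
      occ j c + count μ loc xs e c j           <⟨ +-mono-≤-< (occ-bound j c (<⇒≤ d≤h)) lt ⟩
      claimed y e c j ⊓ 2 ^ e + quota y e c j          ≤⟨ quota-fill y e c j ⟩
      claimed y e (suc c) j ⊓ 2 ^ e                ∎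
      where open ≤-Reasoning
    occ-strict j {c} {suc d} lt (≤′-step p) d<h = begin-strict
      occ j (suc d)                          ≤⟨ occ-suc j d ⟩
      occ j d + count μ loc xs e d j           <⟨ +-mono-<-≤ (occ-strict j lt p (<⇒≤ d<h)) (ok d j d<h) ⟩
      claimed y e d j ⊓ 2 ^ e + quota y e d j          ≤⟨ quota-fill y e d j ⟩
      claimed y e (suc d) j ⊓ 2 ^ e                ∎
      where open ≤-Reasoning

    Σcount≤ : ∀ d i → ΣL (suc d) i (count μ loc xs e d) ≤ jobsOn μ loc xs (e + suc d) i
    Σcount≤ d i = begin
      ΣL (suc d) i (count μ loc xs e d)
        ≡⟨ ΣL-∑ (suc d) i xs (λ a j → ⟦ (ex a ≟ e + suc d) ×-dec Inside? μ e j (loc a) ⟧) ⟩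
      ∑ xs (λ a → ΣL (suc d) i (λ j → ⟦ (ex a ≟ e + suc d) ×-dec Inside? μ e j (loc a) ⟧))
        ≤⟨ ∑-mono xs (λ a m → ≤-trans (intervalΣ μ e (suc d) i (ex a ≟ e + suc d) (loc a)) (pointwise a m)) ⟩
      jobsOn μ loc xs (e + suc d) i ∎
      where
      open ≤-Reasoning
      inside : ∀ a → a ∈ xs → ex a ≡ e + suc d → ∀ p → loc a ≡ p → Inside μ (suc d + e) i p → i ≡ ix a
      inside a m eqx (just (ν , s)) eq (_ , b) =
        trans (sym b) (trans (cong (λ z → block z s) (trans (+-comm (suc d) e) (sym eqx))) (valid a m ν s eq))
      pointwise : ∀ a → a ∈ xs → ⟦ (ex a ≟ e + suc d) ×-dec Inside? μ (suc d + e) i (loc a) ⟧ ≤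
                    ⟦ On? μ (loc a) ⟧ * at (ex a) (ix a) (e + suc d) i
      pointwise a m with (ex a ≟ e + suc d) ×-dec Inside? μ (suc d + e) i (loc a)
      ... | no _ = z≤n
      ... | yes (eq , b) = ≤-reflexive (sym (cong₂ _*_ (⟦⟧-yes (On? μ (loc a)) (Inside⇒On (loc a) b))
              (⟦⟧-yes ((e + suc d ≟ ex a) ×-dec (i ℤ.≟ ix a)) (sym eq , inside a m eq (loc a) refl b))))

    roomy : 4 * h ≤ 2 ^ e → ∀ d i → d < h →
      ∃ λ j → block (suc d) j ≡ i × count μ loc xs e d j < quota y e d j
    roomy 4h≤ d i d<h = ΣL-find (suc d) i (count μ loc xs e d) (quota y e d)
      (≤-<-trans (Σcount≤ d i) (jobs<Σquota y e h d i dense 4h≤ d<h (dom (e + suc d) i)))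

    -- An interval with more slots than there are jobs has an entirely empty slot, which is
    -- preferred. This stops the chain of evictions at a level that depends on the number of jobs
    -- alone.
    slotIn : ∀ d j → d < h → count μ loc xs e d j < quota y e d j → ∃ λ s → block e s ≡ j ×
      (∀ a → a ∈ xs → ex a ≤ e + h → loc a ≢ just (μ , s)) ×
      (length xs < 2 ^ e → ∀ a → a ∈ xs → loc a ≢ just (μ , s))
    slotIn d j d<h lt = choose (length xs <? 2 ^ e)
      where
      choose : Dec (length xs < 2 ^ e) → _
      choose (yes short) =
        let s , s∈ , free = vacant {Q = λ _ → ⊤} (λ _ → yes tt) μ loc xs e j
              (≤-<-trans (∑≤length xs (λ a → ⟦⟧≤1 (yes tt ×-dec Inside? μ e j (loc a)))) short)
        in s , s∈ , (λ a m _ → free a m tt) , (λ _ a m → free a m tt)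
      choose (no long) =
        let s , s∈ , free = vacant (λ a → ex a ≤? e + h) μ loc xs e j
              (<-≤-trans (occ-strict j lt (≤⇒≤′ d<h) ≤-refl) (m⊓n≤n (claimed y e h j) (2 ^ e)))
        in s , s∈ , free , (λ short → contradiction short long)

    findSlot : 4 * h ≤ 2 ^ e → ∀ d i → d < h → ∃ λ s → block (e + suc d) s ≡ i ×
      count μ loc xs e d (block e s) < quota y e d (block e s) ×
      (∀ a → a ∈ xs → ex a ≤ e + h → loc a ≢ just (μ , s)) ×
      (length xs < 2 ^ e → ∀ a → a ∈ xs → loc a ≢ just (μ , s))
    findSlot 4h≤ d i d<h =
      let j , j∈ , lt        = roomy 4h≤ d i d<h
          s , s∈ , none , free = slotIn d j d<h lt
      in s , trans (cong (λ z → block z s) (+-comm e (suc d)))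
               (trans (block-+ (suc d) e s) (trans (cong (block (suc d)) s∈) j∈))
           , subst (λ z → count μ loc xs e d z < quota y e d z) (sym s∈) lt , none , free

-- Settling one job and repairing one level

module Rescheduling {A : Set} (ex : A → ℕ) (ix : A → ℤ) where
  open Placement ex ix

  Apart : ℕ → ℕ → ℕ → ℕ → Set
  Apart e h e₂ h₂ = e₂ + h₂ ≤ e ⊎ e + h ≤ e₂

  record Settled (μ : ℕ) (y : Config) (e h : ℕ) (loc : A → Pos) (xs : List A) (a : A) : Set where
    field
      slot     : ℤ
      move     : Move μ 2
      move-τ   : τ move ≡ swapₚ (loc a) (just (μ , slot))
      valid′   : Fits (τ move ∘ loc) xs
      ok′      : Ok μ y e h (τ move ∘ loc) xs
      others   : ∀ e₂ h₂ → Apart e h e₂ h₂ → ∀ d j → d < h₂ →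
                 count μ (τ move ∘ loc) xs e₂ d j ≤ count μ loc xs e₂ d j
      -- The slot is sought among the other jobs only, so `a` may turn out to hold it already.
      occupant : ∀ b → b ∈ xs → loc b ≡ just (μ , slot) → b ≡ a ⊎ e + h < ex b
      free     : length xs ≤ 2 ^ e → ∀ b → b ∈ xs → loc b ≡ just (μ , slot) → b ≡ a

  -- The job a takes a slot holding at most a job with a larger window, and the two trade places.
  -- That window contains the whole window of a, hence also the former slot of a.
  settleAt : ∀ {μ y e h loc xs a d} → Fits loc xs → Uniq loc xs → a ∈ xs → (S : Split {f = loc} xs a) →
    ex a ≡ e + suc d → d < h → On μ (loc a) → Ok μ y e h loc (rest S) →
    ∀ s → block (ex a) s ≡ ix a → count μ loc (rest S) e d (block e s) < quota y e d (block e s) →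
    (∀ b → b ∈ rest S → ex b ≤ e + h → loc b ≢ just (μ , s)) →
    (length (rest S) < 2 ^ e → ∀ b → b ∈ rest S → loc b ≢ just (μ , s)) →
    Settled μ y e h loc xs a
  settleAt {μ} {y} {e} {h} {loc} {xs} {a} {d} valid u a∈ S ex≡ d<h on-a ok s s∈ room no-small no-one = record
    { slot = s ; move = P ; move-τ = refl ; valid′ = valid′ ; ok′ = ok′ ; others = others
    ; occupant = occupant ; free = free }
    where
    ys : List A
    ys = rest S
    P : Move μ 2
    P = swapMove (loc a) (just (μ , s)) on-a refl

    ex-a≤ : ex a ≤ e + h
    ex-a≤ = subst (_≤ e + h) (sym ex≡) (+-monoʳ-≤ e d<h)

    occupant : ∀ b → b ∈ xs → loc b ≡ just (μ , s) → b ≡ a ⊎ e + h < ex b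
    occupant b m eq with cover S b m
    ... | inj₁ b≡a = inj₁ b≡a
    ... | inj₂ m′  = inj₂ (≰⇒> (λ le → no-small b m′ le eq))

    free : length xs ≤ 2 ^ e → ∀ b → b ∈ xs → loc b ≡ just (μ , s) → b ≡ a
    free short b m eq with cover S b m
    ... | inj₁ b≡a = b≡a
    ... | inj₂ m′  = contradiction eq (no-one (≤-trans (≤-reflexive (sym (len S))) short) b m′)

    old : ∀ p → loc a ≡ p → ∀ ν t → p ≡ just (ν , t) → ∀ k → ex a ≤ k → ν ≡ μ × block k t ≡ block k s
    old .(just (ν , t)) eq ν t refl k le = subst (On μ) eq on-a ,
      trans (block-∸ le t) (trans (cong (block (k ∸ ex a)) (trans (valid a a∈ ν t eq) (sym s∈)))
        (sym (block-∸ le s)))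

    valid′ : Fits (τ P ∘ loc) xs
    valid′ b m ν t eq with swap-view (loc a) (just (μ , s)) (loc b)
    ... | fixed _ _ e′ = valid b m ν t (trans (sym e′) eq)
    ... | first e₁ e₂ with Uniq-injective u m a∈ e₁ | trans (sym eq) e₂
    ...   | refl | refl = s∈
    valid′ b m ν t eq | second ne e₁ e₂ with occupant b m e₁
    ...   | inj₁ refl = contradiction refl ne
    ...   | inj₂ big = trans (proj₂ (old (loc a) refl ν t (trans (sym e₂) eq) (ex b) (≤-trans ex-a≤ (<⇒≤ big))))
                         (valid b m μ s e₁)

    rest-fixed : ∀ b → b ∈ ys → ex b ≤ e + h → τ P (loc b) ≡ loc b
    rest-fixed b m le with swap-view (loc a) (just (μ , s)) (loc b)
    ... | first e₁ _    = contradiction e₁ (proj₂ (sub S b m))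
    ... | second _ e₁ _ = contradiction e₁ (no-small b m le)
    ... | fixed _ _ e₁  = e₁

    term : ∀ c e₂ d₂ j → ℕ
    term c e₂ d₂ j = ⟦ (ex c ≟ e₂ + suc d₂) ×-dec Inside? μ e₂ j (τ P (loc c)) ⟧

    cnt-rest : ∀ e₂ d₂ j → e₂ + suc d₂ ≤ e + h → count μ (τ P ∘ loc) ys e₂ d₂ j ≤ count μ loc ys e₂ d₂ j
    cnt-rest e₂ d₂ j le = count-mono {loc = loc} {loc′ = τ P ∘ loc} {xs = ys} {d = d₂} (λ b m eq →
      subst (Inside μ e₂ j) (rest-fixed b m (≤-trans (≤-reflexive eq) le)))

    τ-a : τ P (loc a) ≡ just (μ , s)
    τ-a = swap-first (loc a) (just (μ , s))

    ok′ : Ok μ y e h (τ P ∘ loc) xs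
    ok′ d₂ j d₂<h = ≤-trans (≤-reflexive (∑-rest S _)) bound
      where
      below : count μ (τ P ∘ loc) ys e d₂ j ≤ count μ loc ys e d₂ j
      below = cnt-rest e d₂ j (+-monoʳ-≤ e d₂<h)
      bound : term a e d₂ j + count μ (τ P ∘ loc) ys e d₂ j ≤ quota y e d₂ j
      bound with (ex a ≟ e + suc d₂) ×-dec Inside? μ e j (τ P (loc a))
      ... | no _ = ≤-trans below (ok d₂ j d₂<h)
      ... | yes (eq , inn) with suc-injective (+-cancelˡ-≡ e _ _ (trans (sym ex≡) eq))
                              | proj₂ (subst (Inside μ e j) τ-a inn)
      ...   | refl | refl = ≤-trans (s≤s below) room

    others : ∀ e₂ h₂ → Apart e h e₂ h₂ → ∀ d j → d < h₂ →
             count μ (τ P ∘ loc) xs e₂ d j ≤ count μ loc xs e₂ d j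
    -- Neither of the two jobs trading places belongs to a lower level.
    others e₂ h₂ (inj₁ low) d₂ j d₂<h₂ = begin
      count μ (τ P ∘ loc) xs e₂ d₂ j                      ≡⟨ ∑-rest S _ ⟩
      term a e₂ d₂ j + count μ (τ P ∘ loc) ys e₂ d₂ j     ≤⟨ +-mono-≤ (≤-reflexive (⟦⟧-no (_×-dec_ (ex a ≟ e₂ + suc d₂) (Inside? μ e₂ j (τ P (loc a)))) ex≢))
                                                             (cnt-rest e₂ d₂ j (≤-trans le (m≤m+n e h))) ⟩
      count μ loc ys e₂ d₂ j                              ≤⟨ m≤n+m _ _ ⟩
      _                                                 ≡⟨ sym (∑-rest S _) ⟩
      count μ loc xs e₂ d₂ j                              ∎
      where
      open ≤-Reasoning
      le : e₂ + suc d₂ ≤ e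
      le = ≤-trans (+-monoʳ-≤ e₂ d₂<h₂) low
      ex≢ : ¬ (ex a ≡ e₂ + suc d₂ × Inside μ e₂ j (τ P (loc a)))
      ex≢ (eq , _) = <⇒≱ (m<m+n e z<s) (≤-trans (≤-reflexive (trans (sym ex≡) eq)) le)
    -- Both slots lie in the window of `a`, hence in the same interval of every higher level: the
    -- evicted job stays in its interval, or becomes unplaced if `a` was.
    others e₂ h₂ (inj₂ high) d₂ j d₂<h₂ = count-mono {loc = loc} {loc′ = τ P ∘ loc} {xs = xs} {d = d₂} keep
      where
      big : ∀ b → ex b ≡ e₂ + suc d₂ → e + h < ex b
      big b eq = ≤-trans (s≤s high) (≤-trans (m<m+n e₂ z<s) (≤-reflexive (sym eq)))
      back : ∀ p → loc a ≡ p → Inside μ e₂ j p → block e₂ s ≡ j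
      back (just (ν , t)) eq (_ , b) =
        trans (sym (proj₂ (old _ eq ν t refl e₂ (≤-trans ex-a≤ high)))) b
      keep : ∀ b → b ∈ xs → ex b ≡ e₂ + suc d₂ → Inside μ e₂ j (τ P (loc b)) → Inside μ e₂ j (loc b)
      keep b m eq inn with swap-view (loc a) (just (μ , s)) (loc b)
      ... | fixed _ _ e₁ = subst (Inside μ e₂ j) e₁ inn
      ... | first e₁ _ with Uniq-injective u m a∈ e₁
      ...   | refl = contradiction ex-a≤ (<⇒≱ (big b eq))
      keep b m eq inn | second _ e₁ e₂′ =
        subst (Inside μ e₂ j) (sym e₁) (refl , back (loc a) refl (subst (Inside μ e₂ j) e₂′ inn))

  -- The quotas need to be respected by the other jobs only, which covers both uses: `a` is not
  -- placed yet, or `a` is the job over quota.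
  settle : ∀ {μ y e h loc xs a d} → Fits loc xs → (u : Uniq loc xs) → Dom μ y loc xs → Dense y →
    4 * h ≤ 2 ^ e → (m : a ∈ xs) → ex a ≡ e + suc d → d < h → On μ (loc a) →
    Ok μ y e h loc (rest (split u m)) → Settled μ y e h loc xs a
  settle {μ} {y} {loc = loc} {xs} {a} {d} valid u dom dense 4h≤ m ex≡ d<h on-a ok =
    let s , s∈ , room , none , free = findSlot (λ b n → valid b (proj₁ (sub S b n)))
          dom-rest dense ok 4h≤ d (ix a) d<h
    in settleAt valid u m S ex≡ d<h on-a ok s (trans (cong (λ z → block z s) ex≡) s∈) room none free
    where
    S : Split {f = loc} xs a
    S = split u m
    fewer : ∀ k i → jobsOn μ loc (rest S) k i ≤ jobsOn μ loc xs k i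
    fewer k i = ≤-trans (m≤n+m _ _) (≤-reflexive (sym (∑-rest S _)))
    dom-rest : Dom μ y loc (rest S)
    dom-rest k i = ≤-trans (*-monoʳ-≤ 2 (fewer k i)) (dom k i)

  Placed : (A → Pos) → List A → Set
  Placed loc xs = ∀ a → a ∈ xs → loc a ≢ nothing

  record Repaired (μ : ℕ) (y : Config) (e h : ℕ) (loc : A → Pos) (xs : List A) : Set where
    field
      move    : Move μ 2
      valid′  : Fits (τ move ∘ loc) xs
      ok′     : Ok μ y e h (τ move ∘ loc) xs
      others  : ∀ e₂ h₂ → Apart e h e₂ h₂ → ∀ d j → d < h₂ →
                count μ (τ move ∘ loc) xs e₂ d j ≤ count μ loc xs e₂ d j
      placed′ : Placed (τ move ∘ loc) xs

  -- `Bad` is the crossing window when load grows, and the window losing the unit when load shrinks.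
  -- Both are unique, so at each level moving one job is enough.
  Excess : ℕ → Config → ℕ → ℕ → (A → Pos) → List A → (ℕ → Set) → ℤ → Set
  Excess μ y e h loc xs Bad j* = ∀ d j → d < h → count μ loc xs e d j ≤ quota y e d j ⊎
    (j ≡ j* × Bad d × count μ loc xs e d j ≤ suc (quota y e d j))

  module _ {μ y e h loc xs} (valid : Fits loc xs) (u : Uniq loc xs) (dom : Dom μ y loc xs) (dense : Dense y)
           (4h≤ : 4 * h ≤ 2 ^ e) (placed : Placed loc xs)
           {Bad : ℕ → Set} (unique : ∀ {c d} → Bad c → Bad d → c ≡ d) {j* : ℤ}
           (excess : Excess μ y e h loc xs Bad j*) where

    relocate : ∀ d → d < h → quota y e d j* < count μ loc xs e d j* →
      ∀ a → a ∈ xs → ex a ≡ e + suc d → Inside μ e j* (loc a) → Repaired μ y e h loc xs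
    relocate d d<h over a a∈ ex≡ inn = record
      { move = move ; valid′ = valid′ ; ok′ = ok′ ; others = others ; placed′ = placed′ }
      where
      S : Split {f = loc} xs a
      S = split u a∈
      cnt-split : ∀ c j → count μ loc xs e c j ≡
        ⟦ (ex a ≟ e + suc c) ×-dec Inside? μ e j (loc a) ⟧ + count μ loc (rest S) e c j
      cnt-split c j = ∑-rest S _
      bad-d : count μ loc xs e d j* ≤ quota y e d j* ⊎ (j* ≡ j* × Bad d × count μ loc xs e d j* ≤ suc (quota y e d j*)) → Bad d
      bad-d (inj₁ le) = contradiction over (≤⇒≯ le)
      bad-d (inj₂ (_ , bad , _)) = bad
      there-rest : ∀ c → c ≡ d → count μ loc xs e c j* ≤ suc (quota y e c j*) → count μ loc (rest S) e c j* ≤ quota y e c j*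
      there-rest c refl le = s≤s⁻¹ (≤-trans (≤-reflexive (sym (trans (cnt-split d j*)
        (cong (_+ count μ loc (rest S) e d j*) (⟦⟧-yes ((ex a ≟ e + suc d) ×-dec Inside? μ e j* (loc a)) (ex≡ , inn)))))) le)
      ok-rest : ∀ c j → count μ loc xs e c j ≤ quota y e c j ⊎ (j ≡ j* × Bad c × count μ loc xs e c j ≤ suc (quota y e c j)) →
        count μ loc (rest S) e c j ≤ quota y e c j
      ok-rest c j (inj₁ le) = ≤-trans (m≤n+m _ _) (≤-trans (≤-reflexive (sym (cnt-split c j))) le)
      ok-rest c j (inj₂ (refl , bad , le)) = there-rest c (unique bad (bad-d (excess d j* d<h))) le
      open Settled (settle valid u dom dense 4h≤ a∈ ex≡ d<h (Inside⇒On (loc a) inn) (λ c j c<h → ok-rest c j (excess c j c<h)))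
      placed′ : Placed (τ move ∘ loc) xs
      placed′ b m eq = lem (swap-view (loc a) (just (μ , slot)) (loc b))
                           (trans (sym (cong (λ f → f (loc b)) move-τ)) eq)
        where
        lem : Swap (loc a) (just (μ , slot)) (loc b) → swapₚ (loc a) (just (μ , slot)) (loc b) ≢ nothing
        lem (first _ e₁)    t = case trans (sym e₁) t of λ ()
        lem (second _ _ e₁) t = placed a a∈ (trans (sym e₁) t)
        lem (fixed _ _ e₁)  t = placed b m (trans (sym e₁) t)

    repair : Repaired μ y e h loc xs
    repair = decide (anyUpTo? (λ d → quota y e d j* <? count μ loc xs e d j*) h)
      where
      decide : Dec (∃ λ d → d < h × quota y e d j* < count μ loc xs e d j*) → Repaired μ y e h loc xs
      decide (no none) = record
        { move = idMove ; valid′ = valid ; others = λ _ _ _ _ _ _ → ≤-refl ; placed′ = placed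
        ; ok′ = λ d j d<h → [ id , (λ { (refl , _) → ≮⇒≥ (λ lt → none (d , d<h , lt)) }) ]′ (excess d j d<h) }
      decide (yes (d , d<h , over)) =
        let here? = λ a → (ex a ≟ e + suc d) ×-dec Inside? μ e j* (loc a)
            a , a∈ , hit = ∑-pos xs (λ a → ⟦ here? a ⟧) (≤-<-trans z≤n over)
            ex≡ , inn = ⟦⟧-pos (here? a) hit
        in relocate d d<h over a a∈ ex≡ inn

-- Levels

-- The values are 0, 1, 3, 11, 2059, ...; the summand `g ℓ` makes the exponent ranges of successive
-- levels adjacent.
g : ℕ → ℕ
g zero    = 0
g (suc ℓ) = g ℓ + 2 ^ g ℓ

g-mono : ∀ {ℓ ℓ′} → ℓ ≤ ℓ′ → g ℓ ≤ g ℓ′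
g-mono {ℓ} le = go (≤⇒≤′ le)
  where
  go : ∀ {ℓ′} → ℓ ≤′ ℓ′ → g ℓ ≤ g ℓ′
  go ≤′-refl     = ≤-refl
  go (≤′-step p) = ≤-trans (go p) (m≤m+n _ _)

-- Level ℓ consists of the exponents in (eˡ ℓ , eˡ ℓ + hˡ ℓ] = (eˡ ℓ , eˡ (suc ℓ)] and uses intervals of length
-- 2 ^ eˡ ℓ = 4 * hˡ ℓ, so one slot for each window of the level around an interval fills only a quarter of it.
abstract
  eˡ hˡ : ℕ → ℕ
  eˡ ℓ = 2 + g ℓ
  hˡ ℓ = 2 ^ g ℓ

  eˡ≡ : ∀ ℓ → eˡ ℓ ≡ 2 + g ℓ
  eˡ≡ ℓ = refl

  4h≤2^e : ∀ ℓ → 4 * hˡ ℓ ≤ 2 ^ eˡ ℓ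
  4h≤2^e ℓ = ≤-reflexive (lem (hˡ ℓ))
    where
    lem : ∀ x → 4 * x ≡ 2 * (2 * x)
    lem = solve-∀

  e-mono : ∀ {ℓ ℓ′} → ℓ ≤ ℓ′ → eˡ ℓ ≤ eˡ ℓ′
  e-mono le = s≤s (s≤s (g-mono le))

  e+h≤e : ∀ {ℓ ℓ′} → ℓ < ℓ′ → eˡ ℓ + hˡ ℓ ≤ eˡ ℓ′
  e+h≤e lt = e-mono lt

  e+h-mono : ∀ {ℓ ℓ′} → ℓ ≤ ℓ′ → eˡ ℓ + hˡ ℓ ≤ eˡ ℓ′ + hˡ ℓ′
  e+h-mono le = e-mono (s≤s le)

  level : ∀ k → 3 ≤ k → ∃ λ ℓ → ∃ λ d → k ≡ eˡ ℓ + suc d × d < hˡ ℓ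
  level k 3≤k = go (≤⇒≤′ 3≤k)
    where
    go : ∀ {k} → 3 ≤′ k → ∃ λ ℓ → ∃ λ d → k ≡ eˡ ℓ + suc d × d < hˡ ℓ
    go ≤′-refl = 0 , 0 , refl , s≤s z≤n
    go (≤′-step p) with go p
    ... | ℓ , d , refl , d<h with suc d <? hˡ ℓ
    ...   | yes lt = ℓ , suc d , sym (+-suc (eˡ ℓ) (suc d)) , lt
    ...   | no ¬lt = suc ℓ , 0 , trans (cong (λ z → suc (eˡ ℓ + z)) (≤-antisym d<h (≮⇒≥ ¬lt))) (+-comm 1 _)
                   , m^n>0 2 (g (suc ℓ))

apart : ∀ {ℓ ℓ′} → ℓ ≢ ℓ′ → eˡ ℓ′ + hˡ ℓ′ ≤ eˡ ℓ ⊎ eˡ ℓ + hˡ ℓ ≤ eˡ ℓ′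
apart {ℓ} {ℓ′} ne with <-cmp ℓ ℓ′
... | tri< lt _ _ = inj₂ (e+h≤e lt)
... | tri≈ _ eq _ = contradiction eq ne
... | tri> _ _ gt = inj₁ (e+h≤e gt)

-- One slot for each window of the level around an interval makes a quarter of its length, and all
-- loads together at most another quarter, so the claims never reach the end.
no-crossing : ∀ y b → (∀ k i → 4 * subtotal y k i ≤ 2 ^ b) →
  ∀ ℓ d j → b ≤ eˡ ℓ → d < hˡ ℓ → ¬ Crossing y (eˡ ℓ) j d
no-crossing y b small ℓ d j b≤e d<h (_ , full) = <⇒≱ (m<m+n (2 * M) {2 * M} (≤-trans (m^n>0 2 (eˡ ℓ)) (m≤m+n M _))) (begin
  2 * M + 2 * M                                 ≡⟨ lem₁ M ⟩
  4 * M                                         ≤⟨ *-monoʳ-≤ 4 full ⟩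
  4 * claimed y (eˡ ℓ) (suc d) j                      ≤⟨ *-monoʳ-≤ 4 (claimed≤subtotal y (eˡ ℓ) (suc d) j) ⟩
  4 * (suc d + subtotal y (eˡ ℓ + suc d) w)            ≡⟨ *-distribˡ-+ 4 (suc d) _ ⟩
  4 * suc d + 4 * subtotal y (eˡ ℓ + suc d) w          ≤⟨ +-mono-≤ (≤-trans (*-monoʳ-≤ 4 d<h) (4h≤2^e ℓ))
                                                     (≤-trans (small (eˡ ℓ + suc d) w) (^-monoʳ-≤ 2 b≤e)) ⟩
  M + M                                         ≡⟨ cong (M +_) (sym (+-identityʳ M)) ⟩
  2 * M                                         ∎)
  where
  open ≤-Reasoning
  M : ℕ
  M = 2 ^ eˡ ℓ
  w : ℤ
  w = block (suc d) j
  lem₁ : ∀ m → 2 * m + 2 * m ≡ 4 * m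
  lem₁ = solve-∀

module Levels {A : Set} (ex : A → ℕ) (ix : A → ℤ) where
  open Placement ex ix public
  open Rescheduling ex ix public

  OkAll : ℕ → Config → (A → Pos) → List A → Set
  OkAll μ y loc xs = ∀ ℓ → Ok μ y (eˡ ℓ) (hˡ ℓ) loc xs

  -- From level t on nothing can go wrong: intervals there are longer than all loads together, or
  -- there are no jobs.
  Top : ℕ → Config → List A → Set
  Top t y xs = ((∀ k i → 4 * subtotal y k i ≤ 2 ^ eˡ t) × length xs ≤ 2 ^ eˡ t) ⊎ (∀ a → a ∈ xs → ex a ≤ eˡ t)

  record Adapted (μ n : ℕ) (y : Config) (loc : A → Pos) (xs : List A) : Set where
    field
      move    : Move μ n
      valid′  : Fits (τ move ∘ loc) xs
      okAll′  : OkAll μ y (τ move ∘ loc) xs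
      placed′ : Placed (τ move ∘ loc) xs

  module _ {μ : ℕ} {y y′ : Config} {k : ℕ} {i : ℤ} (inc : Inc y y′ k i) where

    module _ {loc xs} (valid : Fits loc xs) (u : Uniq loc xs) (placed : Placed loc xs)
             (dom : Dom μ y′ loc xs) (dense : Dense y′) (ok : OkAll μ y loc xs) where

      -- Levels below `s` obey the quotas of `y′`, the others still those of `y`. The halfway state
      -- is sound because repairing one level raises no count at another.
      record Upto (s : ℕ) : Set where
        field
          move    : Move μ (s * 2)
          valid′  : Fits (τ move ∘ loc) xs
          placed′ : Placed (τ move ∘ loc) xs
          low     : ∀ ℓ → ℓ < s → Ok μ y′ (eˡ ℓ) (hˡ ℓ) (τ move ∘ loc) xs
          high    : ∀ ℓ → s ≤ ℓ → Ok μ y (eˡ ℓ) (hˡ ℓ) (τ move ∘ loc) xs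

      adaptLevel : ∀ s (V : Upto s) → Repaired μ y′ (eˡ s) (hˡ s) (τ (Upto.move V) ∘ loc) xs
      adaptLevel s V = repair valid′ (Uniq-move move u) (Dom-move {loc = loc} {xs = xs} move dom) dense (4h≤2^e s) placed′
          (Crossing-unique y (eˡ s) (proj₁ (change inc (eˡ s))))
          (λ d j d<h → almost d j d<h (quota-inc (proj₂ (change inc (eˡ s)) d j)))
        where
        open Upto V
        almost : ∀ {j*} d j → d < hˡ s →
          quota y (eˡ s) d j ≤ quota y′ (eˡ s) d j ⊎ (j ≡ j* × Crossing y (eˡ s) j d × quota y (eˡ s) d j ≤ suc (quota y′ (eˡ s) d j)) →
          count μ (τ move ∘ loc) xs (eˡ s) d j ≤ quota y′ (eˡ s) d j ⊎
            (j ≡ j* × Crossing y (eˡ s) j* d × count μ (τ move ∘ loc) xs (eˡ s) d j ≤ suc (quota y′ (eˡ s) d j))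
        almost d j d<h (inj₁ le) = inj₁ (≤-trans (high s ≤-refl d j d<h) le)
        almost d j d<h (inj₂ (refl , cross , le)) = inj₂ (refl , cross , ≤-trans (high s ≤-refl d j d<h) le)

      nextLevel : ∀ s → Upto s → Upto (suc s)
      nextLevel s V = record { move = Q ; valid′ = R.valid′ ; placed′ = R.placed′ ; low = low′ ; high = high′ }
        where
        open Upto V
        module R = Repaired (adaptLevel s V)
        Q : Move μ (suc s * 2)
        Q = resize (≤-reflexive (+-comm (s * 2) 2)) (move then R.move)
        low′ : ∀ ℓ → ℓ < suc s → Ok μ y′ (eˡ ℓ) (hˡ ℓ) (τ Q ∘ loc) xs
        low′ ℓ ℓ<1+s d j d<h = lem (ℓ ≟ s)
          where
          lem : Dec (ℓ ≡ s) → count μ (τ Q ∘ loc) xs (eˡ ℓ) d j ≤ quota y′ (eˡ ℓ) d j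
          lem (yes refl) = R.ok′ d j d<h
          lem (no ne) = ≤-trans (R.others (eˡ ℓ) (hˡ ℓ) (apart (ne ∘ sym)) d j d<h)
                          (low ℓ (≤∧≢⇒< (s≤s⁻¹ ℓ<1+s) ne) d j d<h)
        high′ : ∀ ℓ → suc s ≤ ℓ → Ok μ y (eˡ ℓ) (hˡ ℓ) (τ Q ∘ loc) xs
        high′ ℓ s<ℓ d j d<h = ≤-trans (R.others (eˡ ℓ) (hˡ ℓ) (apart (<⇒≢ s<ℓ)) d j d<h)
                                (high ℓ (<⇒≤ s<ℓ) d j d<h)

      throughLevel : ∀ s → Upto s
      throughLevel zero    = record { move = idMove ; valid′ = valid ; placed′ = placed ; low = λ _ () ; high = λ ℓ _ → ok ℓ }
      throughLevel (suc s) = nextLevel s (throughLevel s)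

      increase : ∀ t → Top t y xs → Adapted μ (t * 2) y′ loc xs
      increase t top = finish (throughLevel t)
        where
        finish : Upto t → Adapted μ (t * 2) y′ loc xs
        finish V = record { move = move ; valid′ = valid′ ; placed′ = placed′ ; okAll′ = okAll′ }
          where
          open Upto V
          beyond : Top t y xs → ∀ ℓ → t ≤ ℓ → Ok μ y′ (eˡ ℓ) (hˡ ℓ) (τ move ∘ loc) xs
          beyond (inj₁ (small , _)) ℓ t≤ℓ d j d<h =
            [ ≤-trans (high ℓ t≤ℓ d j d<h)
            , (λ (_ , cross , _) → contradiction cross (no-crossing y (eˡ t) small ℓ d j (e-mono t≤ℓ) d<h))
            ]′ (quota-inc (proj₂ (change inc (eˡ ℓ)) d j))
          beyond (inj₂ none) ℓ t≤ℓ d j d<h = ≤-trans (≤-reflexive (trans (∑-cong xs (λ a m →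
              ⟦⟧-no ((ex a ≟ eˡ ℓ + suc d) ×-dec Inside? μ (eˡ ℓ) j (τ move (loc a))) λ (eq , _) →
                <⇒≱ (m<m+n (eˡ ℓ) z<s) (≤-trans (≤-reflexive (sym eq)) (≤-trans (none a m) (e-mono t≤ℓ)))))
              (∑-0 xs))) z≤n
          okAll′ : OkAll μ y′ (τ move ∘ loc) xs
          okAll′ ℓ = lem (ℓ <? t)
            where
            lem : Dec (ℓ < t) → Ok μ y′ (eˡ ℓ) (hˡ ℓ) (τ move ∘ loc) xs
            lem (yes lt) = low ℓ lt
            lem (no ¬lt) = beyond top ℓ (≮⇒≥ ¬lt)

    decrease : ∀ {loc xs} → 3 ≤ k → Fits loc xs → Uniq loc xs → Placed loc xs → Dom μ y loc xs → Dense y →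
      OkAll μ y′ loc xs → Adapted μ 2 y loc xs
    decrease {loc} {xs} 3≤k valid u placed dom dense ok =
      let ℓ , d , k≡ , d<h = level k 3≤k in adapt ℓ d k≡ d<h
      where
      adapt : ∀ ℓ₀ d₀ → k ≡ eˡ ℓ₀ + suc d₀ → d₀ < hˡ ℓ₀ → Adapted μ 2 y loc xs
      adapt ℓ₀ d₀ k≡ d₀<h = record { move = R.move ; valid′ = R.valid′ ; placed′ = R.placed′ ; okAll′ = okAll′ }
        where
        e h : ℕ
        e = eˡ ℓ₀
        h = hˡ ℓ₀
        almost : ∀ {j*} d j → d < h →
          quota y′ e d j ≤ quota y e d j ⊎ (j ≡ j* × k ≡ e + suc d × quota y′ e d j ≤ suc (quota y e d j)) →
          count μ loc xs e d j ≤ quota y e d j ⊎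
            (j ≡ j* × k ≡ e + suc d × count μ loc xs e d j ≤ suc (quota y e d j))
        almost d j d<h (inj₁ le) = inj₁ (≤-trans (ok ℓ₀ d j d<h) le)
        almost d j d<h (inj₂ (eq , k≡ , le)) = inj₂ (eq , k≡ , ≤-trans (ok ℓ₀ d j d<h) le)
        repaired : Repaired μ y e h loc xs
        repaired = repair valid u dom dense (4h≤2^e ℓ₀) placed
          {Bad = λ d → k ≡ e + suc d} (λ p q → suc-injective (+-cancelˡ-≡ e _ _ (trans (sym p) q)))
          (λ d j d<h → almost d j d<h (quota-dec (proj₂ (change inc e) d j)))
        module R = Repaired repaired
        elsewhere : ∀ ℓ → ℓ ≢ ℓ₀ → ∀ d → d < hˡ ℓ → k ≢ eˡ ℓ + suc d
        elsewhere ℓ ne d d<hℓ eq =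
          [ (λ le → <⇒≱ (m<m+n (eˡ ℓ) z<s) (≤-trans (≤-reflexive (trans (sym eq) k≡)) (≤-trans (+-monoʳ-≤ e d₀<h) le)))
          , (λ le → <⇒≱ (m<m+n e z<s) (≤-trans (≤-reflexive (trans (sym k≡) eq)) (≤-trans (+-monoʳ-≤ (eˡ ℓ) d<hℓ) le)))
          ]′ (apart ne)
        okAll′ : OkAll μ y (τ R.move ∘ loc) xs
        okAll′ ℓ d j d<hℓ = lem (ℓ ≟ ℓ₀)
          where
          lem : Dec (ℓ ≡ ℓ₀) → count μ (τ R.move ∘ loc) xs (eˡ ℓ) d j ≤ quota y (eˡ ℓ) d j
          lem (yes refl) = R.ok′ d j d<hℓ
          lem (no ne) = ≤-trans (R.others (eˡ ℓ) (hˡ ℓ) (apart (ne ∘ sym)) d j d<hℓ) (≤-trans (ok ℓ d j d<hℓ)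
            ([ id , (λ (_ , eq , _) → contradiction eq (elsewhere ℓ ne d d<hℓ)) ]′ (quota-dec (proj₂ (change inc (eˡ ℓ)) d j))))

  -- `n` bounds the evictions still to come: each leads to a higher level, and from level `t` on
  -- there are none.
  PlaceFrom : ℕ → Set
  PlaceFrom n = ∀ {μ y loc xs a} t ℓ d → t ≤ ℓ + n → Fits loc xs → Uniq loc xs → Dom μ y loc xs → Dense y →
    (∀ b → b ∈ xs → 3 ≤ ex b) → Top t y xs → OkAll μ y loc xs →
    a ∈ xs → loc a ≡ nothing → ex a ≡ eˡ ℓ + suc d → d < hˡ ℓ → Adapted μ (suc n * 2) y loc xs

  -- The unplaced job evicts at most one job, which belongs to a higher level and is placed next.
  placeStep : ∀ n → (∀ n′ → n ≡ suc n′ → PlaceFrom n′) → PlaceFrom n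
  placeStep n rec {μ} {y} {loc} {xs} {a} t ℓ d t≤ valid u dom dense big top ok a∈ unplaced ex≡ d<h =
    proceed (settle valid u dom dense (4h≤2^e ℓ) a∈ ex≡ d<h (subst (On μ) (sym unplaced) tt) ok-rest)
    where
    ok-rest : Ok μ y (eˡ ℓ) (hˡ ℓ) loc (rest (split u a∈))
    ok-rest c j c<h = ≤-trans (m≤n+m _ _) (≤-trans (≤-reflexive (sym (∑-rest (split u a∈) _))) (ok ℓ c j c<h))
    proceed : Settled μ y (eˡ ℓ) (hˡ ℓ) loc xs a → Adapted μ (suc n * 2) y loc xs
    proceed settled = decide (any? (λ b → loc b ≟ₚ just (μ , slot)) xs)
      where
      open Settled settled
      loc′ : A → Pos
      loc′ = τ move ∘ loc
      okAll′ : OkAll μ y loc′ xs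
      okAll′ ℓ′ c j c<h = lem (ℓ′ ≟ ℓ)
        where
        lem : Dec (ℓ′ ≡ ℓ) → count μ loc′ xs (eˡ ℓ′) c j ≤ quota y (eˡ ℓ′) c j
        lem (yes refl) = ok′ c j c<h
        lem (no ne) = ≤-trans (others (eˡ ℓ′) (hˡ ℓ′) (apart (ne ∘ sym)) c j c<h) (ok ℓ′ c j c<h)
      τ≡ : ∀ x → τ move x ≡ swapₚ nothing (just (μ , slot)) x
      τ≡ x = trans (cong (λ f → f x) move-τ) (cong (λ p → swapₚ p (just (μ , slot)) x) unplaced)
      b≢a : ∀ {b} → loc b ≡ just (μ , slot) → b ≢ a
      b≢a eq refl = case trans (sym unplaced) eq of λ ()

      evict : ∀ b → b ∈ xs → loc b ≡ just (μ , slot) → eˡ ℓ + hˡ ℓ < ex b → Adapted μ (suc n * 2) y loc xs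
      evict b m eq larger = continue n refl (level (ex b) (big b m))
        where
        unplaced′ : loc′ b ≡ nothing
        unplaced′ = trans (τ≡ (loc b)) (lem (swap-view nothing (just (μ , slot)) (loc b)))
          where
          lem : Swap nothing (just (μ , slot)) (loc b) → swapₚ nothing (just (μ , slot)) (loc b) ≡ nothing
          lem (first e₁ _)    = case trans (sym e₁) eq of λ ()
          lem (second _ _ e₁) = e₁
          lem (fixed _ ne _)  = contradiction eq ne
        continue : ∀ n₀ → n ≡ n₀ → (∃ λ ℓ′ → ∃ λ d′ → ex b ≡ eˡ ℓ′ + suc d′ × d′ < hˡ ℓ′) →
                   Adapted μ (suc n₀ * 2) y loc xs
        -- Now `t ≤ ℓ`. Either intervals are at least as long as the list of jobs, and the slot was
        -- chosen empty, or no job, not even `a`, has a window this large.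
        continue zero n≡ _ = contradiction top λ
          { (inj₁ (_ , short)) → b≢a eq (free (≤-trans short (^-monoʳ-≤ 2 (e-mono t≤ℓ))) b m eq)
          ; (inj₂ none) → <⇒≱ (m<m+n (eˡ ℓ) z<s) (≤-trans (≤-reflexive (sym ex≡)) (≤-trans (none a a∈) (e-mono t≤ℓ))) }
          where
          t≤ℓ : t ≤ ℓ
          t≤ℓ = ≤-trans t≤ (≤-reflexive (trans (cong (ℓ +_) n≡) (+-identityʳ ℓ)))
        continue (suc n′) n≡ (ℓ′ , d′ , ex≡′ , d′<h) = record
          { move = move then Next.move ; valid′ = Next.valid′ ; okAll′ = Next.okAll′ ; placed′ = Next.placed′ }
          where
          ℓ<ℓ′ : ℓ < ℓ′
          ℓ<ℓ′ = ≰⇒> λ le → <⇒≱ larger (≤-trans (≤-reflexive ex≡′)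
                   (≤-trans (+-monoʳ-≤ (eˡ ℓ′) d′<h) (e+h-mono le)))
          next : Adapted μ (suc n′ * 2) y loc′ xs
          next = rec n′ n≡ t ℓ′ d′
            (≤-trans t≤ (≤-trans (≤-reflexive (trans (cong (ℓ +_) n≡) (+-suc ℓ n′))) (+-monoˡ-≤ n′ ℓ<ℓ′)))
            valid′ (Uniq-move move u) (Dom-move {loc = loc} {xs = xs} move dom) dense big top okAll′ m unplaced′ ex≡′ d′<h
          module Next = Adapted next

      decide : Dec (Any.Any (λ b → loc b ≡ just (μ , slot)) xs) → Adapted μ (suc n * 2) y loc xs
      decide (no vacant) = record
        { move = resize (m≤m+n 2 (n * 2)) move ; valid′ = valid′ ; okAll′ = okAll′ ; placed′ = placed′ }
        where
        placed′ : Placed loc′ xs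
        placed′ b m eq = lem (swap-view nothing (just (μ , slot)) (loc b)) (trans (sym (τ≡ (loc b))) eq)
          where
          lem : Swap nothing (just (μ , slot)) (loc b) → swapₚ nothing (just (μ , slot)) (loc b) ≢ nothing
          lem (first _ e₁)    eq = case trans (sym e₁) eq of λ ()
          lem (second _ e₁ _) eq = vacant (lose m e₁)
          lem (fixed ne _ e₁) eq = ne (trans (sym e₁) eq)
      decide (yes taken) =
        let b , m , eq = find taken
        in [ (λ b≡a → contradiction b≡a (b≢a eq)) , evict b m eq ]′ (occupant b m eq)

  place : ∀ n → PlaceFrom n
  place zero    = placeStep zero (λ _ ())
  place (suc n) = placeStep (suc n) (λ { _ refl → place n })

-- Dyadic intervals and the order of ℤ

half-mono : ∀ {i j} → i ℤ.≤ j → half i ℤ.≤ half j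
half-mono (ℤ.-≤- n≤m) = ℤ.-≤- (⌊n/2⌋-mono n≤m)
half-mono ℤ.-≤+       = ℤ.-≤+
half-mono (ℤ.+≤+ m≤n) = ℤ.+≤+ (⌊n/2⌋-mono m≤n)

half-suc² : ∀ i → half (ℤ.suc (ℤ.suc i)) ≡ ℤ.suc (half i)
half-suc² (pos n)              = refl
half-suc² -[1+ zero ]          = refl
half-suc² -[1+ suc zero ]      = refl
half-suc² -[1+ suc (suc n) ]   = refl

block-mono : ∀ k {s t} → s ℤ.≤ t → block k s ℤ.≤ block k t
block-mono zero    le = le
block-mono (suc k) le = half-mono (block-mono k le)

block-+2^ : ∀ k t → block k (t ℤ.+ pos (2 ^ k)) ≡ ℤ.suc (block k t)
block-+2^ zero    t = ℤₚ.+-comm t (pos 1)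
block-+2^ (suc k) t = begin
  half (block k (t ℤ.+ pos (2 ^ k + (2 ^ k + 0))))
    ≡⟨ cong (λ z → half (block k (t ℤ.+ pos (2 ^ k + z)))) (+-identityʳ (2 ^ k)) ⟩
  half (block k (t ℤ.+ pos (2 ^ k + 2 ^ k)))
    ≡⟨ cong (half ∘ block k) (sym (ℤₚ.+-assoc t (pos (2 ^ k)) (pos (2 ^ k)))) ⟩
  half (block k (t ℤ.+ pos (2 ^ k) ℤ.+ pos (2 ^ k)))
    ≡⟨ cong half (trans (block-+2^ k (t ℤ.+ pos (2 ^ k))) (cong ℤ.suc (block-+2^ k t))) ⟩
  half (ℤ.suc (ℤ.suc (block k t)))
    ≡⟨ half-suc² (block k t) ⟩
  ℤ.suc (half (block k t)) ∎
  where open ≡-Reasoning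

block-suc≤ : ∀ k t → block k (ℤ.suc t) ℤ.≤ ℤ.suc (block k t)
block-suc≤ k t = ℤₚ.≤-trans
  (block-mono k (ℤₚ.≤-trans (ℤₚ.≤-reflexive (ℤₚ.+-comm (pos 1) t)) (ℤₚ.+-monoʳ-≤ t (ℤ.+≤+ (m^n>0 2 k)))))
  (ℤₚ.≤-reflexive (block-+2^ k t))

-- Aligned windows

lg : ℕ → ℕ
lg zero    = 0
lg (suc s) with 2 ^ suc (lg s) ≤? suc s
... | yes _ = suc (lg s)
... | no _  = lg s

lg-bounds : ∀ s → 2 ^ lg s ≤ suc s × s < 2 ^ suc (lg s) × (1 ≤ s → 2 ^ lg s ≤ s)
lg-bounds zero    = ≤-refl , s≤s z≤n , λ ()
lg-bounds (suc s) with 2 ^ suc (lg s) ≤? suc s | lg-bounds s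
... | yes le | _ , up , _ = m≤n⇒m≤1+n le
      , ≤-trans (s≤s up) (≤-trans (≤-reflexive (+-comm 1 _)) (+-monoʳ-≤ (2 ^ suc (lg s)) (≤-trans (m^n>0 2 (suc (lg s))) (m≤m+n _ 0))))
      , λ _ → le
... | no ¬le | low , up , _ = m≤n⇒m≤1+n low , ≰⇒> ¬le , λ _ → low

-- Half the largest power of two not exceeding the span, so that some aligned interval of this length fits.
ex : Job → ℕ
ex j = lg (span j) ∸ 1

-- The first aligned interval of length 2 ^ ex j that starts at arr j or later.
ix : Job → ℤ
ix j = ℤ.suc (block (ex j) (ℤ.pred (arr j)))

Wide : Job → Set
Wide j = arr j ℤ.< dl j × 7 ≤ ex j

module _ {j : Job} (wide : Wide j) where
  private
    k : ℕ
    k = ex j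
    t₀ : ℤ
    t₀ = ℤ.pred (arr j)

  lg≡ : lg (span j) ≡ suc k
  lg≡ = sym (m+[n∸m]≡n {1} (1≤ (lg (span j)) (proj₂ wide)))
    where
    1≤ : ∀ n → 7 ≤ n ∸ 1 → 1 ≤ n
    1≤ (suc n) _ = s≤s z≤n

  span≥1 : 1 ≤ span j
  span≥1 = n≢0⇒n>0 λ eq → case subst (λ s → 7 ≤ lg s ∸ 1) eq (proj₂ wide) of λ ()

  span≥ : 2 ^ suc k ≤ span j
  span≥ = subst (λ l → 2 ^ l ≤ span j) lg≡ (proj₂ (proj₂ (lg-bounds (span j))) span≥1)

  span< : span j < 2 ^ suc (suc k)
  span< = subst (λ l → span j < 2 ^ suc l) lg≡ (proj₁ (proj₂ (lg-bounds (span j))))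

  dl≡ : dl j ≡ arr j ℤ.+ pos (span j)
  dl≡ = begin
    dl j                             ≡⟨ lem (arr j) (dl j) ⟩
    arr j ℤ.+ (dl j ℤ.- arr j)       ≡⟨ cong (λ z → arr j ℤ.+ z) (sym (ℤₚ.0≤i⇒+∣i∣≡i (ℤₚ.i≤j⇒0≤j-i (ℤₚ.<⇒≤ (proj₁ wide))))) ⟩
    arr j ℤ.+ pos (span j)           ∎
    where
    open ≡-Reasoning
    lem : ∀ a d → d ≡ a ℤ.+ (d ℤ.- a)
    lem = ℤSolver.solve-∀

  -- The aligned window starts less than 2ᵏ after `arr j`, so it ends within 2ᵏ⁺¹ of it, and the
  -- span is no shorter.
  slot-inside : ∀ t → block k t ≡ ix j → arr j ℤ.≤ t × t ℤ.+ pos 1 ℤ.≤ dl j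
  slot-inside t eq = ℤₚ.≮⇒≥ early , subst (ℤ._≤ dl j) (ℤₚ.+-comm (pos 1) t) (ℤₚ.i<j⇒suc[i]≤j (ℤₚ.≰⇒> late))
    where
    early : ¬ (t ℤ.< arr j)
    early lt = ℤₚ.<⇒≱ (ℤₚ.suc[i]≤j⇒i<j (ℤₚ.≤-reflexive (sym eq))) (block-mono k (ℤₚ.i<j⇒i≤pred[j] lt))
    late : ¬ (dl j ℤ.≤ t)
    late le = ℤₚ.<⇒≱ (ℤₚ.suc[i]≤j⇒i<j ℤₚ.≤-refl) (begin
      ℤ.suc (ix j)                                     ≡⟨ cong ℤ.suc (sym (block-+2^ k t₀)) ⟩
      ℤ.suc (block k (t₀ ℤ.+ pos (2 ^ k)))             ≡⟨ sym (block-+2^ k _) ⟩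
      block k (t₀ ℤ.+ pos (2 ^ k) ℤ.+ pos (2 ^ k))     ≤⟨ block-mono k far ⟩
      block k t                                        ≡⟨ eq ⟩
      ix j                                             ∎)
      where
      open ℤₚ.≤-Reasoning
      far : t₀ ℤ.+ pos (2 ^ k) ℤ.+ pos (2 ^ k) ℤ.≤ t
      far = begin
        t₀ ℤ.+ pos (2 ^ k) ℤ.+ pos (2 ^ k)      ≡⟨ ℤₚ.+-assoc t₀ (pos (2 ^ k)) (pos (2 ^ k)) ⟩
        t₀ ℤ.+ pos (2 ^ k + 2 ^ k)              ≤⟨ ℤₚ.+-mono-≤ (ℤₚ.i≤j⇒pred[i]≤j (ℤₚ.≤-refl {arr j}))
                                                     (ℤ.+≤+ (≤-trans (≤-reflexive (cong (2 ^ k +_) (sym (+-identityʳ (2 ^ k))))) span≥)) ⟩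
        arr j ℤ.+ pos (span j)                  ≡⟨ sym dl≡ ⟩
        dl j                                    ≤⟨ le ⟩
        t                                       ∎

  -- The span is less than four times 2ᵏ, so in blocks of length 2ᵏ the job reaches at most one
  -- before its aligned window and three behind it. Passing to longer blocks does not increase these
  -- distances.
  slot-near : ∀ {K i t} → k ≤ K → block (K ∸ k) (ix j) ≡ i → arr j ℤ.≤ t → t ℤ.≤ dl j →
    i ℤ.≤ ℤ.suc (block K t) × block K t ℤ.≤ ℤ.suc (ℤ.suc (ℤ.suc i))
  slot-near {K} {i} {t} k≤K refl lo≤ ≤hi = left , right
    where
    open ℤₚ.≤-Reasoning
    D : ℕ
    D = K ∸ k
    left : block D (ix j) ℤ.≤ ℤ.suc (block K t)
    left = begin
      block D (ix j)                     ≤⟨ block-mono D (ℤₚ.suc-mono (block-mono k (ℤₚ.i≤j⇒pred[i]≤j lo≤))) ⟩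
      block D (ℤ.suc (block k t))        ≤⟨ block-suc≤ D (block k t) ⟩
      ℤ.suc (block D (block k t))        ≡⟨ cong ℤ.suc (sym (block-∸ k≤K t)) ⟩
      ℤ.suc (block K t)                  ∎
    q : ℤ
    q = pos (2 ^ k)
    reach : t ℤ.≤ t₀ ℤ.+ q ℤ.+ q ℤ.+ q ℤ.+ q
    reach = begin
      t                                         ≤⟨ ≤hi ⟩
      dl j                                      ≡⟨ dl≡ ⟩
      arr j ℤ.+ pos (span j)                    ≡⟨ cong (λ z → z ℤ.+ pos (span j)) (sym (ℤₚ.suc-pred (arr j))) ⟩
      pos 1 ℤ.+ t₀ ℤ.+ pos (span j)             ≡⟨ shift (pos 1) t₀ (pos (span j)) ⟩
      t₀ ℤ.+ pos (suc (span j))                 ≤⟨ ℤₚ.+-monoʳ-≤ t₀ (ℤ.+≤+ span<) ⟩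
      t₀ ℤ.+ pos (2 ^ suc (suc k))              ≡⟨ cong (λ z → t₀ ℤ.+ pos z) (four (2 ^ k)) ⟩
      t₀ ℤ.+ (q ℤ.+ q ℤ.+ q ℤ.+ q)              ≡⟨ unroll t₀ q ⟩
      t₀ ℤ.+ q ℤ.+ q ℤ.+ q ℤ.+ q                ∎
      where
      shift : ∀ a b c → a ℤ.+ b ℤ.+ c ≡ b ℤ.+ (a ℤ.+ c)
      shift = ℤSolver.solve-∀
      four : ∀ n → 2 * (2 * n) ≡ n + n + n + n
      four = solve-∀
      unroll : ∀ a b → a ℤ.+ (b ℤ.+ b ℤ.+ b ℤ.+ b) ≡ a ℤ.+ b ℤ.+ b ℤ.+ b ℤ.+ b
      unroll = ℤSolver.solve-∀
    right : block K t ℤ.≤ ℤ.suc (ℤ.suc (ℤ.suc (block D (ix j))))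
    right = begin
      block K t                                       ≡⟨ block-∸ k≤K t ⟩
      block D (block k t)                             ≤⟨ block-mono D (block-mono k reach) ⟩
      block D (block k (t₀ ℤ.+ q ℤ.+ q ℤ.+ q ℤ.+ q))
        ≡⟨ cong (block D) (trans (block-+2^ k (t₀ ℤ.+ q ℤ.+ q ℤ.+ q)) (cong ℤ.suc
             (trans (block-+2^ k (t₀ ℤ.+ q ℤ.+ q)) (cong ℤ.suc (trans (block-+2^ k (t₀ ℤ.+ q)) (cong ℤ.suc (block-+2^ k t₀))))))) ⟩
      block D (ℤ.suc (ℤ.suc (ℤ.suc (ix j))))          ≤⟨ block-suc≤ D _ ⟩
      ℤ.suc (block D (ℤ.suc (ℤ.suc (ix j))))          ≤⟨ ℤₚ.suc-mono (block-suc≤ D _) ⟩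
      ℤ.suc (ℤ.suc (block D (ℤ.suc (ix j))))          ≤⟨ ℤₚ.suc-mono (ℤₚ.suc-mono (block-suc≤ D _)) ⟩
      ℤ.suc (ℤ.suc (ℤ.suc (block D (ix j))))          ∎

-- Density of underallocated job sets

∈-remove : ∀ {B : Set} {x y : B} us {vs} → y ∈ us ++ x ∷ vs → y ≢ x → y ∈ us ++ vs
∈-remove []       (here eq) ne = contradiction eq ne
∈-remove []       (there m) ne = m
∈-remove (u ∷ us) (here eq) ne = here eq
∈-remove (u ∷ us) (there m) ne = there (∈-remove us m ne)

Uniq⇒length≤ : ∀ {A B : Set} {f : A → B} xs (L : List B) → Uniq f xs → (∀ a → a ∈ xs → f a ∈ L) → length xs ≤ length L
Uniq⇒length≤ []       L u sub = z≤n
Uniq⇒length≤ {f = f} (x ∷ xs) L (p ∷ u) sub with ∈-∃++ (sub x (here refl))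
... | us , vs , refl = ≤-trans (s≤s (Uniq⇒length≤ xs (us ++ vs) u
        (λ a m → ∈-remove us (sub a (there m)) (λ eq → All.lookup p m (sym eq)))))
      (≤-reflexive (trans (cong suc (length-++ us)) (trans (sym (+-suc (length us) (length vs))) (sym (length-++ us)))))

slots : ℕ → ℤ → List ℤ
slots zero    i = i ∷ []
slots (suc d) i = slots d (lo i) ++ slots d (hi i)

length-slots : ∀ d i → length (slots d i) ≡ 2 ^ d
length-slots zero    i = refl
length-slots (suc d) i = trans (length-++ (slots d (lo i)))
  (cong₂ _+_ (length-slots d (lo i)) (trans (length-slots d (hi i)) (sym (+-identityʳ (2 ^ d)))))

∈-slots : ∀ d i t → block d t ≡ i → t ∈ slots d i
∈-slots zero    i t eq = here eq
∈-slots (suc d) i t eq =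
  [ (λ l → ∈-++⁺ˡ (∈-slots d (lo i) t l)) , (λ r → ∈-++⁺ʳ (slots d (lo i)) (∈-slots d (hi i) t r)) ]′ (∈⇒lo⊎hi {d} eq)

allSlots : ℕ → List ℤ → List ℤ
allSlots d []       = []
allSlots d (c ∷ cs) = slots d c ++ allSlots d cs

length-allSlots : ∀ d cs → length (allSlots d cs) ≡ length cs * 2 ^ d
length-allSlots d []       = refl
length-allSlots d (c ∷ cs) = trans (length-++ (slots d c)) (cong₂ _+_ (length-slots d c) (length-allSlots d cs))

∈-allSlots : ∀ d {cs} t → block d t ∈ cs → t ∈ allSlots d cs
∈-allSlots d {c ∷ _} t (here eq) = ∈-++⁺ˡ (∈-slots d c t eq)
∈-allSlots d {c ∷ _} t (there m) = ∈-++⁺ʳ (slots d c) (∈-allSlots d t m)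

length-× : ∀ {A B : Set} (xs : List A) (ys : List B) → length (cartesianProduct xs ys) ≡ length xs * length ys
length-× []       ys = refl
length-× (x ∷ xs) ys = trans (length-++ (map (x ,_) ys)) (cong₂ _+_ (length-map (x ,_) ys) (length-× xs ys))

near : ℤ → List ℤ
near i = ℤ.pred i ∷ i ∷ ℤ.suc i ∷ ℤ.suc (ℤ.suc i) ∷ ℤ.suc (ℤ.suc (ℤ.suc i)) ∷ []

∈-near : ∀ {i c} → i ℤ.≤ ℤ.suc c → c ℤ.≤ ℤ.suc (ℤ.suc (ℤ.suc i)) → c ∈ near i
∈-near {i} {c} l r with c ℤ.≟ ℤ.suc (ℤ.suc (ℤ.suc i)) | c ℤ.≟ ℤ.suc (ℤ.suc i) | c ℤ.≟ ℤ.suc i | c ℤ.≟ i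
... | yes p | _ | _ | _ = there (there (there (there (here p))))
... | no _ | yes p | _ | _ = there (there (there (here p)))
... | no _ | no _ | yes p | _ = there (there (here p))
... | no _ | no _ | no _ | yes p = there (here p)
... | no a | no b | no d | no e = here (ℤₚ.≤-antisym
  (ℤₚ.i<j⇒i≤pred[j] (ℤₚ.≤∧≢⇒< (down d (down b (down a r))) e))
  (ℤₚ.≤-trans (ℤₚ.pred-mono l) (ℤₚ.≤-reflexive (ℤₚ.pred-suc c))))
  where
  down : ∀ {z} → c ≢ ℤ.suc z → c ℤ.≤ ℤ.suc z → c ℤ.≤ z
  down {z} ne le = ℤₚ.≤-trans (ℤₚ.i<j⇒i≤pred[j] (ℤₚ.≤∧≢⇒< le ne)) (ℤₚ.≤-reflexive (ℤₚ.pred-suc z))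

length-filter-∑ : ∀ {A : Set} {P : A → Set} (P? : ∀ a → Dec (P a)) xs → ∑ xs (λ a → ⟦ P? a ⟧) ≡ length (filter P? xs)
length-filter-∑ P? [] = refl
length-filter-∑ P? (x ∷ xs) with P? x
... | yes _ = cong suc (length-filter-∑ P? xs)
... | no _  = length-filter-∑ P? xs

jobsWithin : List Job → Config
jobsWithin js k i = ∑ js (λ j → ⟦ within? (ex j) (ix j) k i ⟧)

-- The window of a job aligned inside a dyadic interval of length 2ᴷ meets at most five dyadic intervals of that
-- length, hence 5 · 2ᴷ⁻⁷ cells of length 2⁷ ≥ 16 · 5; with γ ≥ 2⁷ a machine starts at most one job per cell, and
-- γ ≥ 2⁸ makes all aligned windows at least 2⁷ long.
γ : ℕ
γ = 256

module _ {m js} (names : Uniq name js) (under : Underallocated γ m js) where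
  private
    σ : ℕ → ℕ × ℤ
    σ = proj₁ under
    begins : Job → ℤ
    begins j = proj₂ (σ (name j))

  under-start : ∀ j → j ∈ js → arr j ℤ.≤ begins j × begins j ℤ.+ pos γ ℤ.≤ dl j
  under-start j j∈ = proj₂ (proj₁ (proj₂ under) j j∈)

  under-wide : ∀ j → j ∈ js → Wide j
  under-wide j m = arr<dl , ≮⇒≥ (λ lt → <⇒≱ (proj₁ (proj₂ (lg-bounds (span j)))) (begin
      2 ^ suc (lg (span j))   ≤⟨ ^-monoʳ-≤ 2 (s≤s (bound (lg (span j)) lt)) ⟩
      2 ^ 8                   ≤⟨ γ≤span ⟩
      span j                  ∎))
    where
    open ≤-Reasoning
    bound : ∀ n → n ∸ 1 < 7 → n ≤ 7
    bound zero    _  = z≤n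
    bound (suc n) lt = lt
    arr+γ≤dl : arr j ℤ.+ pos γ ℤ.≤ dl j
    arr+γ≤dl = ℤₚ.≤-trans (ℤₚ.+-monoˡ-≤ (pos γ) (proj₁ (under-start j m))) (proj₂ (under-start j m))
    arr<dl : arr j ℤ.< dl j
    arr<dl = ℤₚ.suc[i]≤j⇒i<j (ℤₚ.≤-trans (ℤₚ.≤-trans (ℤₚ.≤-reflexive (ℤₚ.+-comm (pos 1) (arr j)))
      (ℤₚ.+-monoʳ-≤ (arr j) (ℤ.+≤+ (s≤s z≤n)))) arr+γ≤dl)
    γ≤span : γ ≤ span j
    γ≤span = ℤₚ.drop‿+≤+ (begin-ℤ)
      where
      begin-ℤ : pos γ ℤ.≤ pos (span j)
      begin-ℤ = ℤₚ.≤-trans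
        (ℤₚ.≤-trans (ℤₚ.≤-reflexive (lem (arr j) (pos γ))) (ℤₚ.+-monoˡ-≤ (ℤ.- arr j) arr+γ≤dl))
        (ℤₚ.≤-reflexive (sym (ℤₚ.0≤i⇒+∣i∣≡i (ℤₚ.i≤j⇒0≤j-i (ℤₚ.<⇒≤ arr<dl)))))
        where
        lem : ∀ a g → g ≡ a ℤ.+ g ℤ.- a
        lem = ℤSolver.solve-∀

  under-dense : ∀ K i → 16 * jobsWithin js K i ≤ m * 2 ^ K
  under-dense K i = bound (length ys ≟ 0)
    where
    open ≤-Reasoning
    ys : List Job
    ys = filter (λ j → within? (ex j) (ix j) K i) js
    cell : Job → ℕ × ℤ
    cell j = proj₁ (σ (name j)) , block 7 (begins j)
    L : List (ℕ × ℤ)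
    L = cartesianProduct (upTo m) (allSlots (K ∸ 7) (near i))
    apart-cells : ∀ s t → s ℤ.+ pos γ ℤ.≤ t → block 7 s ≢ block 7 t
    apart-cells s t le eq = ℤₚ.<⇒≱ (ℤₚ.suc[i]≤j⇒i<j (ℤₚ.≤-reflexive (sym (block-+2^ 7 s))))
      (ℤₚ.≤-trans (block-mono 7 (ℤₚ.≤-trans (ℤₚ.+-monoʳ-≤ s (ℤ.+≤+ (m≤m+n 128 128))) le)) (ℤₚ.≤-reflexive (sym eq)))
    different : ∀ a b → a ∈ js → b ∈ js → name a ≢ name b → cell a ≢ cell b
    different a b a∈ b∈ ne eq =
      [ (λ le → apart-cells _ _ le (cong proj₂ eq)) , (λ le → apart-cells _ _ le (sym (cong proj₂ eq))) ]′
        (proj₂ (proj₂ under) a b a∈ b∈ ne (cong proj₁ eq))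
    uniq-cells : ∀ {zs} → (∀ a → a ∈ zs → a ∈ js) → Uniq name zs → Uniq cell zs
    uniq-cells sub []      = []
    uniq-cells sub (p ∷ u) = All.tabulate (λ {b} b∈ → different _ b (sub _ (here refl)) (sub b (there b∈)) (All.lookup p b∈))
                             ∷ uniq-cells (λ a m → sub a (there m)) u
    in-js : ∀ a → a ∈ ys → a ∈ js
    in-js a a∈ = proj₁ (∈-filter⁻ (λ j → within? (ex j) (ix j) K i) a∈)
    inside : ∀ a → a ∈ ys → ex a ≤ K × block (K ∸ ex a) (ix a) ≡ i
    inside a a∈ = proj₂ (∈-filter⁻ (λ j → within? (ex j) (ix j) K i) {xs = js} a∈)
    7≤K : ∀ a → a ∈ ys → 7 ≤ K
    7≤K a a∈ = ≤-trans (proj₂ (under-wide a (in-js a a∈))) (proj₁ (inside a a∈))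
    covered : ∀ a → a ∈ ys → cell a ∈ L
    covered a a∈ = ∈-cartesianProduct⁺ (∈-upTo⁺ (proj₁ (proj₁ (proj₂ under) a (in-js a a∈))))
      (∈-allSlots (K ∸ 7) (block 7 (begins a)) (subst (_∈ near i) (block-∸ (7≤K a a∈) (begins a))
        (let l , r = slot-near {j = a} (under-wide a (in-js a a∈)) (proj₁ (inside a a∈)) (proj₂ (inside a a∈))
               (proj₁ s) (ℤₚ.≤-trans (ℤₚ.i≤i+j (begins a) (pos γ)) (proj₂ s))
         in ∈-near {i} {block K (begins a)} l r)))
      where
      s : arr a ℤ.≤ begins a × begins a ℤ.+ pos γ ℤ.≤ dl a
      s = under-start a (in-js a a∈)
    few : length ys ≤ m * (5 * 2 ^ (K ∸ 7))
    few = ≤-trans (Uniq⇒length≤ ys L (uniq-cells in-js (AllPairsₚ.filter⁺ (λ j → within? (ex j) (ix j) K i) names)) covered)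
      (≤-reflexive (trans (length-× (upTo m) _) (cong₂ _*_ (length-upTo m) (length-allSlots (K ∸ 7) (near i)))))
    -- `K ∸ 7` is a true difference as soon as some job lies within, for then 7 ≤ `ex a` ≤ `K`;
    -- without jobs the bound is trivial.
    bound : Dec (length ys ≡ 0) → 16 * jobsWithin js K i ≤ m * 2 ^ K
    bound (yes none) = ≤-trans (≤-reflexive (trans (cong (16 *_) (trans (length-filter-∑ _ js) none)) refl)) z≤n
    bound (no some) = begin
      16 * jobsWithin js K i                      ≡⟨ cong (16 *_) (length-filter-∑ (λ j → within? (ex j) (ix j) K i) js) ⟩
      16 * length ys                     ≤⟨ *-monoʳ-≤ 16 few ⟩
      16 * (m * (5 * 2 ^ (K ∸ 7)))       ≡⟨ lem m (2 ^ (K ∸ 7)) ⟩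
      m * (80 * 2 ^ (K ∸ 7))             ≤⟨ *-monoʳ-≤ m (*-monoˡ-≤ (2 ^ (K ∸ 7)) (m≤m+n 80 48)) ⟩
      m * (2 ^ 7 * 2 ^ (K ∸ 7))          ≡⟨ cong (m *_) (sym (^-distribˡ-+-* 2 7 (K ∸ 7))) ⟩
      m * 2 ^ (7 + (K ∸ 7))              ≡⟨ cong (λ z → m * 2 ^ z) (m+[n∸m]≡n (large ys some (λ a a∈ → 7≤K a a∈))) ⟩
      m * 2 ^ K                          ∎
      where
      lem : ∀ m q → 16 * (m * (5 * q)) ≡ m * (80 * q)
      lem = solve-∀
      large : ∀ (zs : List Job) → length zs ≢ 0 → (∀ a → a ∈ zs → 7 ≤ K) → 7 ≤ K
      large []       ne _ = contradiction refl ne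
      large (a ∷ zs) _  h = h a (here refl)

-- A decidable consequence of underallocation

open Levels ex ix public

n<2^n : ∀ n → n < 2 ^ n
n<2^n zero    = s≤s z≤n
n<2^n (suc n) = begin
  suc (suc n)        ≤⟨ s≤s (n<2^n n) ⟩
  1 + 2 ^ n          ≤⟨ +-monoˡ-≤ (2 ^ n) (m^n>0 2 n) ⟩
  2 ^ n + 2 ^ n      ≡⟨ cong (2 ^ n +_) (sym (+-identityʳ (2 ^ n))) ⟩
  2 ^ suc n          ∎
  where open ≤-Reasoning

-- Decidable, as the scheduler has to test it: only dyadic intervals around the window of some job, with exponent
-- below 16 · length js, can hold too many jobs.
Sparse : ℕ → List Job → Set
Sparse m js = All Wide js ×
  All (λ a → ∀ {k} → k < 16 * length js → 16 * jobsWithin js k (block (k ∸ ex a) (ix a)) ≤ m * 2 ^ k) js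

Sparse? : ∀ m js → Dec (Sparse m js)
Sparse? m js = all? (λ j → (arr j ℤ.<? dl j) ×-dec (7 ≤? ex j)) js
  ×-dec all? (λ a → allUpTo? (λ k → 16 * jobsWithin js k (block (k ∸ ex a) (ix a)) ≤? m * 2 ^ k) (16 * length js)) js

under⇒Sparse : ∀ {m js} → Uniq name js → Underallocated γ m js → Sparse m js
under⇒Sparse names under =
  All.tabulate (λ {j} → under-wide names under j) , All.tabulate (λ _ {k} _ → under-dense names under k _)

Sparse⇒jobsWithin≤ : ∀ {m js} → 1 ≤ m → Sparse m js → ∀ k i → 16 * jobsWithin js k i ≤ m * 2 ^ k
Sparse⇒jobsWithin≤ {m} {js} 1≤m (_ , local) k i = decide (jobsWithin js k i ≟ 0)
  where
  open ≤-Reasoning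
  nonempty : ∀ a → a ∈ js → block (k ∸ ex a) (ix a) ≡ i → 16 * jobsWithin js k i ≤ m * 2 ^ k
  nonempty a a∈ refl = near-or-far (k <? 16 * length js)
    where
    near-or-far : Dec (k < 16 * length js) → _
    near-or-far (yes lt) = All.lookup local a∈ lt
    near-or-far (no ¬lt) = begin
      16 * jobsWithin js k i       ≤⟨ *-monoʳ-≤ 16 (∑≤length js (λ j → ⟦⟧≤1 (within? (ex j) (ix j) k i))) ⟩
      16 * length js      ≤⟨ ≮⇒≥ ¬lt ⟩
      k                   ≤⟨ <⇒≤ (n<2^n k) ⟩
      2 ^ k               ≤⟨ m≤n*m (2 ^ k) m {{>-nonZero 1≤m}} ⟩
      m * 2 ^ k           ∎
  decide : Dec (jobsWithin js k i ≡ 0) → 16 * jobsWithin js k i ≤ m * 2 ^ k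
  decide (yes eq) = ≤-trans (≤-reflexive (cong (16 *_) eq)) z≤n
  decide (no ne) =
    let a , a∈ , hit = ∑-pos js (λ j → ⟦ within? (ex j) (ix j) k i ⟧) (n≢0⇒n>0 ne)
    in nonempty a a∈ (proj₂ (⟦⟧-pos (within? (ex a) (ix a) k i) hit))

-- Balanced distribution over the machines

sumN : ℕ → (ℕ → ℕ) → ℕ
sumN zero    f = 0
sumN (suc m) f = f m + sumN m f

sumN-+ : ∀ m f f′ → sumN m (λ ν → f ν + f′ ν) ≡ sumN m f + sumN m f′
sumN-+ zero    f f′ = refl
sumN-+ (suc m) f f′ = trans (cong (f m + f′ m +_) (sumN-+ m f f′)) (interchange (f m) (f′ m) _ _)

sumN-lower : ∀ m {c f} → (∀ ν → ν < m → c ≤ suc (f ν)) → m * c ≤ m + sumN m f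
sumN-lower zero    h = z≤n
sumN-lower (suc m) {c} {f} h = ≤-trans (+-mono-≤ (h m ≤-refl) (sumN-lower m (λ ν lt → h ν (m≤n⇒m≤1+n lt))))
  (≤-reflexive (cong suc (lem (f m) m (sumN m f))))
  where
  lem : ∀ a b c → a + (b + c) ≡ b + (a + c)
  lem = solve-∀

sumN-δ : ∀ m μ w → sumN m (λ ν → ⟦ μ ≟ ν ⟧ * w) ≤ w
sumN-δ zero    μ w = z≤n
sumN-δ (suc m) μ w with μ ≟ m
... | no _ = sumN-δ m μ w
... | yes refl = ≤-trans (≤-reflexive (cong₂ _+_ (+-identityʳ w) (none m ≤-refl))) (≤-reflexive (+-identityʳ w))
  where
  none : ∀ n → n ≤ m → sumN n (λ ν → ⟦ m ≟ ν ⟧ * w) ≡ 0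
  none zero    _  = refl
  none (suc n) lt = cong₂ _+_ (cong (_* w) (⟦⟧-no (m ≟ n) (λ eq → <⇒≢ lt (sym eq)))) (none n (<⇒≤ lt))

Balanced : ℕ → (Job → Pos) → List Job → Set
Balanced m loc js = ∀ k i μ ν → μ < m → ν < m → jobsOn μ loc js k i ≤ suc (jobsOn ν loc js k i)

ΣjobsOn≤ : ∀ m (loc : Job → Pos) js → Placed loc js → ∀ k i →
       sumN m (λ ν → jobsOn ν loc js k i) ≤ load js (λ _ → 1) k i
ΣjobsOn≤ m loc [] placed k i = ≤-reflexive (zero-sum m)
  where
  zero-sum : ∀ m → sumN m (λ _ → 0) ≡ 0
  zero-sum zero    = refl
  zero-sum (suc m) = zero-sum m
ΣjobsOn≤ m loc (a ∷ js) placed k i = ≤-trans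
  (≤-reflexive (sumN-+ m (λ ν → ⟦ On? ν (loc a) ⟧ * at (ex a) (ix a) k i) (λ ν → jobsOn ν loc js k i)))
  (+-mono-≤ (≤-trans (one (loc a) (placed a (here refl))) (≤-reflexive (sym (+-identityʳ _))))
            (ΣjobsOn≤ m loc js (λ b b∈ → placed b (there b∈)) k i))
  where
  one : ∀ p → p ≢ nothing → sumN m (λ ν → ⟦ On? ν p ⟧ * at (ex a) (ix a) k i) ≤ at (ex a) (ix a) k i
  one nothing        ne = contradiction refl ne
  one (just (μ , s)) _  = sumN-δ m μ (at (ex a) (ix a) k i)

-- One job in each window of exponent at least 7, the smallest that occurs: the most by which a
-- machine can exceed the average.
seven : Config
seven k i = ⟦ 7 ≤? k ⟧

subtotal-seven< : ∀ k i → k < 7 → subtotal seven k i ≡ 0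
subtotal-seven< zero    i lt = refl
subtotal-seven< (suc k) i lt = cong₂ _+_ (⟦⟧-no (7 ≤? suc k) (<⇒≱ lt))
  (cong₂ _+_ (subtotal-seven< k (lo i) (<⇒≤ lt)) (subtotal-seven< k (hi i) (<⇒≤ lt)))

-- The exact number of these windows is 2ᵏ⁻⁶ - 1; with the `suc` the induction closes.
subtotal-seven≥ : ∀ k i → 7 ≤′ k → 64 * suc (subtotal seven k i) ≤ 2 ^ k
subtotal-seven≥ .7 i ≤′-refl = ≤-reflexive (cong (λ z → 64 * suc z) (cong suc (cong₂ _+_ (subtotal-seven< 6 (lo i) ≤-refl) (subtotal-seven< 6 (hi i) ≤-refl))))
subtotal-seven≥ (suc k) i (≤′-step p) = begin
  64 * suc (seven (suc k) i + (a + b))    ≤⟨ *-monoʳ-≤ 64 (s≤s (+-monoˡ-≤ (a + b) (⟦⟧≤1 (7 ≤? suc k)))) ⟩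
  64 * suc (1 + (a + b))                  ≡⟨ lem a b ⟩
  64 * suc a + 64 * suc b                 ≤⟨ +-mono-≤ (subtotal-seven≥ k (lo i) p) (subtotal-seven≥ k (hi i) p) ⟩
  2 ^ k + 2 ^ k                           ≡⟨ cong (2 ^ k +_) (sym (+-identityʳ (2 ^ k))) ⟩
  2 ^ suc k                               ∎
  where
  open ≤-Reasoning
  a b : ℕ
  a = subtotal seven k (lo i)
  b = subtotal seven k (hi i)
  lem : ∀ a b → 64 * suc (1 + (a + b)) ≡ 64 * suc a + 64 * suc b
  lem = solve-∀

subtotal-seven : ∀ k i → 64 * subtotal seven k i ≤ 2 ^ k
subtotal-seven k i with 7 ≤? k
... | yes le = ≤-trans (*-monoʳ-≤ 64 (n≤1+n _)) (subtotal-seven≥ k i (≤⇒≤′ le))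
... | no ¬le = ≤-trans (≤-reflexive (cong (64 *_) (subtotal-seven< k i (≰⇒> ¬le)))) z≤n

-- Rounding up costs at most one job per window, and windows of length at least 2⁷ are few.
machine-dense : ∀ {m js loc} → 1 ≤ m → Sparse m js → Placed loc js → Balanced m loc js →
  ∀ μ → μ < m → Dense (λ k i → 2 * jobsOn μ loc js k i)
machine-dense {m} {js} {loc} 1≤m sparse placed bal μ μ<m k i = *-cancelˡ-≤ (2 * m) {{m*n≢0 2 m {{_}} {{m≢0}}}} (begin
  2 * m * (4 * subtotal (λ k i → 2 * x k i) k i)      ≡⟨ cong (λ z → 2 * m * (4 * z)) (subtotal-* 2 x k i) ⟩
  2 * m * (4 * (2 * subtotal x k i))                  ≡⟨ lem₁ m (subtotal x k i) ⟩
  16 * (m * subtotal x k i)                           ≡⟨ cong (16 *_) (sym (subtotal-* m x k i)) ⟩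
  16 * subtotal (λ k i → m * x k i) k i               ≤⟨ *-monoʳ-≤ 16 (subtotal-mono pointwise k i) ⟩
  16 * subtotal (λ k i → m * seven k i + tot k i) k i ≡⟨ cong (16 *_) (trans (subtotal-+ (λ k i → m * seven k i) tot k i)
                                                    (cong₂ _+_ (subtotal-* m seven k i) Ytot)) ⟩
  16 * (m * subtotal seven k i + jobsWithin js k i)            ≡⟨ *-distribˡ-+ 16 (m * subtotal seven k i) (jobsWithin js k i) ⟩
  -- The factor 16 is 4 · 2 · 2: a quarter for `Dense`, two units of load per job, and half of the
  -- space left to rounding.
  16 * (m * subtotal seven k i) + 16 * jobsWithin js k i       ≤⟨ +-mono-≤ windows (Sparse⇒jobsWithin≤ 1≤m sparse k i) ⟩
  m * 2 ^ k + m * 2 ^ k                        ≡⟨ lem₂ m (2 ^ k) ⟩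
  2 * m * 2 ^ k                                ∎)
  where
  open ≤-Reasoning
  m≢0 : NonZero m
  m≢0 = >-nonZero 1≤m
  x tot : Config
  x = jobsOn μ loc js
  tot = load js (λ _ → 1)
  lem₁ : ∀ m y → 2 * m * (4 * (2 * y)) ≡ 16 * (m * y)
  lem₁ = solve-∀
  lem₂ : ∀ m y → m * y + m * y ≡ 2 * m * y
  lem₂ = solve-∀
  Ytot : subtotal tot k i ≡ jobsWithin js k i
  Ytot = trans (subtotal-load js (λ _ → 1) k i) (∑-cong js (λ j _ → +-identityʳ _))
  windows : 16 * (m * subtotal seven k i) ≤ m * 2 ^ k
  windows = begin
    16 * (m * subtotal seven k i)   ≡⟨ lem m (subtotal seven k i) ⟩
    m * (16 * subtotal seven k i)   ≤⟨ *-monoʳ-≤ m (≤-trans (*-monoˡ-≤ (subtotal seven k i) (m≤m+n 16 48)) (subtotal-seven k i)) ⟩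
    m * 2 ^ k                ∎
    where
    lem : ∀ m y → 16 * (m * y) ≡ m * (16 * y)
    lem = solve-∀
  small : ∀ k i → k < 7 → x k i ≡ 0
  small k i lt = trans (∑-cong js (λ a a∈ → trans (cong (⟦ On? μ (loc a) ⟧ *_)
      (⟦⟧-no ((k ≟ ex a) ×-dec (i ℤ.≟ ix a)) (λ { (refl , _) → <⇒≱ lt (proj₂ (All.lookup (proj₁ sparse) a∈)) })))
      (*-zeroʳ ⟦ On? μ (loc a) ⟧))) (∑-0 js)
  pointwise : ∀ k i → m * x k i ≤ m * seven k i + tot k i
  pointwise k i = go (7 ≤? k)
    where
    go : (d : Dec (7 ≤ k)) → m * x k i ≤ m * ⟦ d ⟧ + tot k i
    go (yes _) = ≤-trans (sumN-lower m (λ ν ν<m → bal k i μ ν μ<m ν<m))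
      (+-mono-≤ (≤-reflexive (sym (*-identityʳ m))) (ΣjobsOn≤ m loc js placed k i))
    go (no ¬le) = ≤-trans (≤-reflexive (trans (cong (m *_) (small k i (≰⇒> ¬le))) (*-zeroʳ m))) z≤n

argmin : ∀ m (f : ℕ → ℕ) → 1 ≤ m → ∃ λ μ → μ < m × (∀ ν → ν < m → f μ ≤ f ν)
argmin (suc zero)    f _ = 0 , ≤-refl , λ { zero _ → ≤-refl ; (suc ν) (s≤s ()) }
argmin (suc (suc m)) f _ with argmin (suc m) f (s≤s z≤n)
... | μ , μ<m , min with f (suc m) ≤? f μ
...   | yes le = suc m , ≤-refl , λ ν ν<m → last ν (ν ≟ suc m) ν<m
  where
  last : ∀ ν → Dec (ν ≡ suc m) → ν < suc (suc m) → f (suc m) ≤ f ν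
  last ν (yes refl) _ = ≤-refl
  last ν (no ne)    ν<m = ≤-trans le (min ν (≤∧≢⇒< (s≤s⁻¹ ν<m) ne))
...   | no ¬le = μ , m≤n⇒m≤1+n μ<m , λ ν ν<m → last ν (ν ≟ suc m) ν<m
  where
  last : ∀ ν → Dec (ν ≡ suc m) → ν < suc (suc m) → f μ ≤ f ν
  last ν (yes refl) _ = <⇒≤ (≰⇒> ¬le)
  last ν (no ne)    ν<m = min ν (≤∧≢⇒< (s≤s⁻¹ ν<m) ne)

-- The invariant of the scheduler

position : Schedule → Job → Pos
position σ a = just (σ (name a))

placed : ∀ {σ js} → Placed (position σ) js
placed _ _ ()

record Inv (m : ℕ) (js : List Job) (σ : Schedule) : Set where
  field
    names    : Uniq name js
    sparse   : Sparse m js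
    machines : ∀ j → j ∈ js → machineOf σ (name j) < m
    fits     : Fits (position σ) js
    uniq     : Uniq (position σ) js
    ok       : ∀ μ → OkAll μ (λ k i → 2 * jobsOn μ (position σ) js k i) (position σ) js
    balanced : Balanced m (position σ) js

Inv-[] : ∀ m σ → Inv m [] σ
Inv-[] m σ = record
  { names = [] ; sparse = [] , [] ; machines = λ _ () ; fits = λ _ () ; uniq = []
  ; ok = λ _ _ _ _ _ → z≤n ; balanced = λ _ _ _ _ _ _ → z≤n }

Inv⇒Feasible : ∀ {m js σ} → Inv m js σ → Feasible m js σ
Inv⇒Feasible {m} {js} {σ} inv =
  (λ j j∈ → machines j j∈ , slot-inside {j = j} (All.lookup (proj₁ sparse) j∈) _ (fits j j∈ _ _ refl)) ,
  (λ j k j∈ k∈ ne eq → ne (cong name (Uniq-injective uniq j∈ k∈ (cong just eq))))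
  where open Inv inv

Sparse⇒3≤ex : ∀ m {js} → Sparse m js → ∀ j → j ∈ js → 3 ≤ ex j
Sparse⇒3≤ex m sparse j j∈ = ≤-trans (m≤m+n 3 4) (proj₂ (All.lookup (proj₁ sparse) j∈))

jobsOn-cong : ∀ ν {loc loc′ : Job → Pos} xs → (∀ a → a ∈ xs → loc a ≡ loc′ a) →
          ∀ k i → jobsOn ν loc xs k i ≡ jobsOn ν loc′ xs k i
jobsOn-cong ν xs eq k i = ∑-cong xs (λ a m → cong (λ p → ⟦ On? ν p ⟧ * at (ex a) (ix a) k i) (eq a m))

jobsOn-machine : ∀ ν {σ σ′} xs → (∀ a → a ∈ xs → machineOf σ (name a) ≡ machineOf σ′ (name a)) →
             ∀ k i → jobsOn ν (position σ) xs k i ≡ jobsOn ν (position σ′) xs k i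
jobsOn-machine ν xs eq k i = ∑-cong xs (λ a m → cong (λ μ → ⟦ μ ≟ ν ⟧ * at (ex a) (ix a) k i) (eq a m))

count-cong : ∀ ν {loc loc′ : Job → Pos} xs → (∀ a → a ∈ xs → loc a ≡ loc′ a) →
           ∀ e d j → count ν loc xs e d j ≡ count ν loc′ xs e d j
count-cong ν xs eq e d j = ∑-cong xs (λ a m → cong (λ p → ⟦ (ex a ≟ e + suc d) ×-dec Inside? ν e j p ⟧) (eq a m))

Fits-cong : ∀ {loc loc′ : Job → Pos} {xs} → (∀ a → a ∈ xs → loc a ≡ loc′ a) → Fits loc xs → Fits loc′ xs
Fits-cong eq fits a m ν s e = fits a m ν s (trans (eq a m) e)

Uniq-cong : ∀ {A B : Set} {f f′ : A → B} {xs} → (∀ a → a ∈ xs → f a ≡ f′ a) → Uniq f xs → Uniq f′ xs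
Uniq-cong eq []      = []
Uniq-cong eq (p ∷ u) =
  All.tabulate (λ {b} m e → All.lookup p m (trans (eq _ (here refl)) (trans e (sym (eq b (there m))))))
  ∷ Uniq-cong (λ a m → eq a (there m)) u

OkAll-cong : ∀ {ν y y′} {loc loc′ : Job → Pos} xs → (∀ a → a ∈ xs → loc a ≡ loc′ a) →
             (∀ k i → y k i ≡ y′ k i) → OkAll ν y loc xs → OkAll ν y′ loc′ xs
OkAll-cong {ν} xs eq-loc eq-y ok ℓ d j d<h =
  ≤-trans (≤-reflexive (sym (count-cong ν xs eq-loc (eˡ ℓ) d j)))
    (≤-trans (ok ℓ d j d<h) (≤-reflexive (quota-cong eq-y (eˡ ℓ) d j)))

-- Whenever a schedule is read off, all jobs of the current list are placed, so for them this value
-- is never consulted.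
dflt : ℕ × ℤ
dflt = 0 , pos 0

just-fromMaybe : ∀ (p : Pos) → p ≢ nothing → just (fromMaybe dflt p) ≡ p
just-fromMaybe nothing  ne = contradiction refl ne
just-fromMaybe (just _) ne = refl

override : ∀ {A : Set} → ℕ → A → (ℕ → A) → ℕ → A
override n v f n′ with n′ ≟ n
... | yes _ = v
... | no _  = f n′

override-same : ∀ {A : Set} n (v : A) f → override n v f n ≡ v
override-same n v f with n ≟ n
... | yes _ = refl
... | no ne = contradiction refl ne

override-other : ∀ {A : Set} n (v : A) f {n′} → n′ ≢ n → override n v f n′ ≡ f n′
override-other n v f {n′} ne with n′ ≟ n
... | yes eq = contradiction eq ne
... | no _   = refl

persisting≤ : ∀ {Q : Job → Set} (Q? : ∀ a → Dec (Q a)) before after (f : Job → Pos) L → Uniq f before →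
  (∀ a → a ∈ before → Any (λ k → name k ≡ name a) after → f a ∉ L → ¬ Q a) →
  length (filter Q? (persisting before after)) ≤ length L
persisting≤ Q? before after f L u ¬Q = Uniq⇒length≤ (filter Q? (persisting before after)) L
  (AllPairsₚ.filter⁺ Q? (AllPairsₚ.filter⁺ stays? u)) λ a a∈ →
    let a∈′ , q   = ∈-filter⁻ Q? {xs = persisting before after} a∈
        a∈b , any = ∈-filter⁻ stays? {xs = before} a∈′
    in decidable-stable (any? (λ p → f a ≟ₚ p) L) (λ f∉ → ¬Q a a∈b any f∉ q)
  where
  stays? : ∀ j → Dec (Any (λ k → name k ≡ name j) after)
  stays? j = any? (λ k → name k ≟ name j) after

realloc≤ : ∀ before after σ σ′ (f : Job → Pos) L → Uniq f before →
  (∀ a → a ∈ before → Any (λ k → name k ≡ name a) after → f a ∉ L → σ (name a) ≡ σ′ (name a)) →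
  reallocCost before after σ σ′ ≤ length L
realloc≤ before after σ σ′ f L u kept =
  persisting≤ (λ j → ¬? (×ₚ.≡-dec _≟_ ℤ._≟_ (σ (name j)) (σ′ (name j)))) before after f L u
    (λ a a∈ any f∉ ne → ne (kept a a∈ any f∉))

migration≤ : ∀ before after σ σ′ (f : Job → Pos) L → Uniq f before →
  (∀ a → a ∈ before → Any (λ k → name k ≡ name a) after → f a ∉ L → machineOf σ (name a) ≡ machineOf σ′ (name a)) →
  migrationCost before after σ σ′ ≤ length L
migration≤ before after σ σ′ f L u kept =
  persisting≤ (λ j → ¬? (machineOf σ (name j) ≟ machineOf σ′ (name j))) before after f L u
    (λ a a∈ any f∉ ne → ne (kept a a∈ any f∉))

record Outcome (m n : ℕ) (before after : List Job) (σ : Schedule) : Set where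
  field
    σ′      : Schedule
    inv     : Inv m after σ′
    realloc : reallocCost before after σ σ′ ≤ n
    migrate : migrationCost before after σ σ′ ≤ 1

-- Insertion

module Insertion {m js σ} (1≤m : 1 ≤ m) (inv : Inv m js σ) (j : Job) (fresh : All (λ a → name a ≢ name j) js)
  (sparse⁺ : Sparse m (j ∷ js)) (t : ℕ)
  (bound : 8 * length (j ∷ js) ≤ 2 ^ eˡ t ⊎ (∀ a → a ∈ j ∷ js → ex a ≤ eˡ t)) where
  open Inv inv

  js⁺ : List Job
  js⁺ = j ∷ js
  k : ℕ
  k = ex j
  i : ℤ
  i = ix j
  loc : Job → Pos
  loc = position σ

  choice : ∃ λ μ → μ < m × (∀ ν → ν < m → jobsOn μ loc js k i ≤ jobsOn ν loc js k i)
  choice = argmin m (λ μ → jobsOn μ loc js k i) 1≤m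
  μ : ℕ
  μ = proj₁ choice
  μ<m : μ < m
  μ<m = proj₁ (proj₂ choice)

  -- The new job on machine μ, at a slot that is irrelevant.
  σF : Schedule
  σF = override (name j) (μ , pos 0) σ
  locF : Job → Pos
  locF = position σF

  σF-old : ∀ a → a ∈ js → σF (name a) ≡ σ (name a)
  σF-old a a∈ = override-other (name j) _ σ (All.lookup fresh a∈)

  xwF : ∀ ν k′ i′ → jobsOn ν locF js⁺ k′ i′ ≡ ⟦ μ ≟ ν ⟧ * at k i k′ i′ + jobsOn ν loc js k′ i′
  xwF ν k′ i′ = cong₂ _+_
    (cong (λ p → ⟦ proj₁ p ≟ ν ⟧ * at k i k′ i′) (override-same (name j) (μ , pos 0) σ))
    (jobsOn-cong ν js (λ a a∈ → cong just (σF-old a a∈)) k′ i′)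

  balF : Balanced m locF js⁺
  balF k′ i′ α β α<m β<m = begin
    jobsOn α locF js⁺ k′ i′                             ≡⟨ xwF α k′ i′ ⟩
    ⟦ μ ≟ α ⟧ * at k i k′ i′ + jobsOn α loc js k′ i′    ≤⟨ go (μ ≟ α) ((k′ ≟ k) ×-dec (i′ ℤ.≟ i)) ⟩
    suc (jobsOn β loc js k′ i′)                         ≤⟨ s≤s (m≤n+m _ _) ⟩
    suc (⟦ μ ≟ β ⟧ * at k i k′ i′ + jobsOn β loc js k′ i′) ≡⟨ cong suc (sym (xwF β k′ i′)) ⟩
    suc (jobsOn β locF js⁺ k′ i′)                       ∎
    where
    open ≤-Reasoning
    go : (d : Dec (μ ≡ α)) (w : Dec (k′ ≡ k × i′ ≡ i)) →
         ⟦ d ⟧ * ⟦ w ⟧ + jobsOn α loc js k′ i′ ≤ suc (jobsOn β loc js k′ i′)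
    go (no _)     w       = balanced k′ i′ α β α<m β<m
    go (yes _)    (no _)  = balanced k′ i′ α β α<m β<m
    go (yes refl) (yes (refl , refl)) = s≤s (proj₂ (proj₂ choice) β β<m)

  -- The two units of the new job are added one at a time, since `increase` handles single units;
  -- the job itself is placed only after the quotas have adapted.
  y y₁ y₂ : Config
  y k′ i′ = 2 * jobsOn μ loc js k′ i′
  y₁ k′ i′ = y k′ i′ + at k i k′ i′
  y₂ k′ i′ = 2 * jobsOn μ locF js⁺ k′ i′

  inc₁ : Inc y y₁ k i
  inc₁ _ _ = refl
  inc₂ : Inc y₁ y₂ k i
  inc₂ k′ i′ = trans (cong (2 *_) (trans (xwF μ k′ i′) (cong (λ z → z * at k i k′ i′ + jobsOn μ loc js k′ i′) (⟦⟧-yes (μ ≟ μ) refl))))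
                 (lem (at k i k′ i′) (jobsOn μ loc js k′ i′))
    where
    lem : ∀ a x → 2 * (1 * a + x) ≡ 2 * x + a + a
    lem = solve-∀
  y≤y₁ : ∀ k′ i′ → y k′ i′ ≤ y₁ k′ i′
  y≤y₁ k′ i′ = m≤m+n _ _
  y₁≤y₂ : ∀ k′ i′ → y₁ k′ i′ ≤ y₂ k′ i′
  y₁≤y₂ k′ i′ = ≤-trans (m≤m+n _ _) (≤-reflexive (sym (inc₂ k′ i′)))

  dense₂ : Dense y₂
  dense₂ = machine-dense 1≤m sparse⁺ (placed {σF}) balF μ μ<m
  dense₁ : Dense y₁
  dense₁ k′ i′ = ≤-trans (*-monoʳ-≤ 4 (subtotal-mono y₁≤y₂ k′ i′)) (dense₂ k′ i′)

  top₂ : Top t y₂ js⁺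
  top₂ = [ (λ le → inj₁ ((λ k′ i′ → ≤-trans (small k′ i′) le) , ≤-trans (m≤m+n (length js⁺) _) le)) , inj₂ ]′ bound
    where
    -- The 8 in `bound` is the factor 4 of `Top` times two units of load per job.
    small : ∀ k′ i′ → 4 * subtotal y₂ k′ i′ ≤ 8 * length js⁺
    small k′ i′ = begin
      4 * subtotal y₂ k′ i′                         ≡⟨ cong (4 *_) (subtotal-* 2 (jobsOn μ locF js⁺) k′ i′) ⟩
      4 * (2 * subtotal (jobsOn μ locF js⁺) k′ i′)      ≡⟨ sym (*-assoc 4 2 (subtotal (jobsOn μ locF js⁺) k′ i′)) ⟩
      8 * subtotal (jobsOn μ locF js⁺) k′ i′            ≤⟨ *-monoʳ-≤ 8 (≤-trans (≤-reflexive (subtotal-load js⁺ (λ a → ⟦ On? μ (locF a) ⟧) k′ i′))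
                                                  (∑≤length js⁺ (λ a → *-mono-≤ (⟦⟧≤1 (On? μ (locF a))) (⟦⟧≤1 (within? (ex a) (ix a) k′ i′))))) ⟩
      8 * length js⁺                         ∎
      where open ≤-Reasoning
  top₁ : Top t y₁ js
  top₁ = [ (λ (le , l) → inj₁ ((λ k′ i′ → ≤-trans (*-monoʳ-≤ 4 (subtotal-mono y₁≤y₂ k′ i′)) (le k′ i′)) , ≤-trans (n≤1+n _) l))
         , (λ none → inj₂ (λ a a∈ → none a (there a∈))) ]′ top₂
  top₀ : Top t y js
  top₀ = [ (λ (le , l) → inj₁ ((λ k′ i′ → ≤-trans (*-monoʳ-≤ 4 (subtotal-mono y≤y₁ k′ i′)) (le k′ i′)) , l)) , inj₂ ]′ top₁

  A₁ : Adapted μ (t * 2) y₁ loc js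
  A₁ = increase inc₁ fits uniq (placed {σ}) y≤y₁ dense₁ (ok μ) t top₀
  P₁ : Move μ (t * 2)
  P₁ = Adapted.move A₁
  loc₁ : Job → Pos
  loc₁ = τ P₁ ∘ loc

  A₂ : Adapted μ (t * 2) y₂ loc₁ js
  A₂ = increase inc₂ (Adapted.valid′ A₁) (Uniq-move P₁ uniq) (Adapted.placed′ A₁)
    (Dom-move {loc = loc} {xs = js} P₁ (λ k′ i′ → ≤-trans (y≤y₁ k′ i′) (y₁≤y₂ k′ i′))) dense₂ (Adapted.okAll′ A₁) t top₁

  P₁₂ : Move μ (t * 2 + t * 2)
  P₁₂ = P₁ then Adapted.move A₂

  locN : ℕ → Pos
  locN = override (name j) nothing (λ n → τ P₁₂ (just (σ n)))
  loc⁺ : Job → Pos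
  loc⁺ a = locN (name a)
  loc⁺-new : loc⁺ j ≡ nothing
  loc⁺-new = override-same (name j) nothing _
  loc⁺-old : ∀ a → a ∈ js → loc⁺ a ≡ τ P₁₂ (loc a)
  loc⁺-old a a∈ = override-other (name j) nothing _ (All.lookup fresh a∈)

  fits⁺ : Fits loc⁺ js⁺
  fits⁺ a (here refl) ν s eq = case trans (sym loc⁺-new) eq of λ ()
  fits⁺ a (there a∈)  ν s eq = Adapted.valid′ A₂ a a∈ ν s (trans (sym (loc⁺-old a a∈)) eq)
  uniq⁺ : Uniq loc⁺ js⁺
  uniq⁺ = All.tabulate (λ {b} b∈ eq → Adapted.placed′ A₂ b b∈ (trans (sym (loc⁺-old b b∈)) (trans (sym eq) loc⁺-new)))
          ∷ Uniq-cong (λ a a∈ → sym (loc⁺-old a a∈)) (Uniq-move P₁₂ uniq)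
  dom⁺ : Dom μ y₂ loc⁺ js⁺
  dom⁺ k′ i′ = *-monoʳ-≤ 2 (≤-reflexive (trans (cong₂ _+_ new old) (sym (xwF μ k′ i′))))
    where
    new : ⟦ On? μ (loc⁺ j) ⟧ * at k i k′ i′ ≡ ⟦ μ ≟ μ ⟧ * at k i k′ i′
    new = cong (_* at k i k′ i′) (⟦⟧-cong (On? μ (loc⁺ j)) (μ ≟ μ) (λ _ → refl) (λ _ → subst (On μ) (sym loc⁺-new) tt))
    old : jobsOn μ loc⁺ js k′ i′ ≡ jobsOn μ loc js k′ i′
    old = trans (jobsOn-cong μ js loc⁺-old k′ i′) (jobsOn-move P₁₂ loc js k′ i′)
  cnt⁺ : ∀ ν e d l → count ν loc⁺ js⁺ e d l ≡ count ν (τ P₁₂ ∘ loc) js e d l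
  cnt⁺ ν e d l = cong₂ _+_ (⟦⟧-no ((ex j ≟ e + suc d) ×-dec Inside? ν e l (loc⁺ j)) (λ (_ , inn) → subst (Inside ν e l) loc⁺-new inn))
                   (count-cong ν js loc⁺-old e d l)
  ok⁺ : OkAll μ y₂ loc⁺ js⁺
  ok⁺ ℓ d l d<h = ≤-trans (≤-reflexive (cnt⁺ μ (eˡ ℓ) d l)) (Adapted.okAll′ A₂ ℓ d l d<h)

  A₃ : Adapted μ (suc t * 2) y₂ loc⁺ js⁺
  A₃ = let ℓ , d , ex≡ , d<h = level k (Sparse⇒3≤ex m sparse⁺ j (here refl))
       in place t t ℓ d (m≤n+m t ℓ) fits⁺ uniq⁺ dom⁺ dense₂ (Sparse⇒3≤ex m sparse⁺) top₂ ok⁺ (here refl) loc⁺-new ex≡ d<h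
  P₃ : Move μ (suc t * 2)
  P₃ = Adapted.move A₃
  P : Move μ (t * 2 + t * 2 + suc t * 2)
  P = P₁₂ then P₃

  σ⁺ : Schedule
  σ⁺ n = fromMaybe dflt (τ P₃ (locN n))

  final : ∀ a → a ∈ js⁺ → position σ⁺ a ≡ τ P₃ (loc⁺ a)
  final a a∈ = just-fromMaybe _ (Adapted.placed′ A₃ a a∈)
  final-old : ∀ a → a ∈ js → position σ⁺ a ≡ τ P (loc a)
  final-old a a∈ = trans (final a (there a∈)) (cong (τ P₃) (loc⁺-old a a∈))

  same-machine : ∀ a → a ∈ js → machineOf σ⁺ (name a) ≡ machineOf σ (name a)
  same-machine a a∈ = decide (On? μ (loc a))
    where
    decide : Dec (On μ (loc a)) → machineOf σ⁺ (name a) ≡ machineOf σ (name a)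
    decide (yes o) = trans (subst (On μ) (sym (final-old a a∈)) (on P (loc a) o)) (sym o)
    decide (no ¬o) = cong proj₁ (Maybeₚ.just-injective (trans (final-old a a∈) (off P (loc a) ¬o)))

  machine⁺ : ∀ a → a ∈ js⁺ → machineOf σ⁺ (name a) ≡ machineOf σF (name a)
  machine⁺ a (here refl) = trans (subst (On μ) (sym (final j (here refl))) (on P₃ (loc⁺ j) (subst (On μ) (sym loc⁺-new) tt)))
    (sym (cong proj₁ (override-same (name j) (μ , pos 0) σ)))
  machine⁺ a (there a∈) = trans (same-machine a a∈) (sym (cong proj₁ (σF-old a a∈)))

  xw⁺ : ∀ ν k′ i′ → jobsOn ν locF js⁺ k′ i′ ≡ jobsOn ν (position σ⁺) js⁺ k′ i′
  xw⁺ ν = jobsOn-machine ν {σF} {σ⁺} js⁺ (λ a a∈ → sym (machine⁺ a a∈))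

  inv⁺ : Inv m js⁺ σ⁺
  inv⁺ = record
    { names    = All.map (λ ne eq → ne (sym eq)) fresh ∷ names
    ; sparse   = sparse⁺
    ; machines = λ { a (here refl) → subst (_< m) (sym (trans (machine⁺ j (here refl)) (cong proj₁ (override-same (name j) (μ , pos 0) σ)))) μ<m
                   ; a (there a∈) → subst (_< m) (sym (same-machine a a∈)) (machines a a∈) }
    ; fits     = Fits-cong (λ a a∈ → sym (final a a∈)) (Adapted.valid′ A₃)
    ; uniq     = Uniq-cong (λ a a∈ → sym (final a a∈)) (Uniq-move P₃ uniq⁺)
    ; ok       = λ ν → okay ν (ν ≟ μ)
    ; balanced = λ k′ i′ α β α<m β<m → subst₂ (λ a b → a ≤ suc b) (xw⁺ α k′ i′) (xw⁺ β k′ i′) (balF k′ i′ α β α<m β<m)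
    }
    where
    okay : ∀ ν → Dec (ν ≡ μ) → OkAll ν (λ k i → 2 * jobsOn ν (position σ⁺) js⁺ k i) (position σ⁺) js⁺
    okay ν (yes refl) = OkAll-cong js⁺ (λ a a∈ → sym (final a a∈)) (λ k′ i′ → cong (2 *_) (xw⁺ ν k′ i′)) (Adapted.okAll′ A₃)
    okay ν (no ν≢μ) ℓ d l d<h = begin
      count ν (position σ⁺) js⁺ (eˡ ℓ) d l                              ≡⟨ count-cong ν js⁺ final (eˡ ℓ) d l ⟩
      count ν (τ P₃ ∘ loc⁺) js⁺ (eˡ ℓ) d l                        ≤⟨ count-other P₃ ν≢μ loc⁺ js⁺ (eˡ ℓ) d l ⟩
      count ν loc⁺ js⁺ (eˡ ℓ) d l                                 ≡⟨ cnt⁺ ν (eˡ ℓ) d l ⟩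
      count ν (τ P₁₂ ∘ loc) js (eˡ ℓ) d l                         ≤⟨ count-other P₁₂ ν≢μ loc js (eˡ ℓ) d l ⟩
      count ν loc js (eˡ ℓ) d l                                   ≤⟨ ok ν ℓ d l d<h ⟩
      quota (λ k i → 2 * jobsOn ν loc js k i) (eˡ ℓ) d l                ≡⟨ quota-cong (λ k′ i′ → cong (2 *_) (unchanged k′ i′)) (eˡ ℓ) d l ⟩
      quota (λ k i → 2 * jobsOn ν (position σ⁺) js⁺ k i) (eˡ ℓ) d l           ∎
      where
      open ≤-Reasoning
      unchanged : ∀ k′ i′ → jobsOn ν loc js k′ i′ ≡ jobsOn ν (position σ⁺) js⁺ k′ i′
      unchanged k′ i′ = trans (sym (trans (xwF ν k′ i′) (cong (λ z → z * at k i k′ i′ + jobsOn ν loc js k′ i′)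
        (⟦⟧-no (μ ≟ ν) (λ eq → ν≢μ (sym eq)))))) (xw⁺ ν k′ i′)

  outcome : Outcome m (t * 2 + t * 2 + suc t * 2) js js⁺ σ
  outcome = record
    { σ′ = σ⁺ ; inv = inv⁺
    ; realloc = ≤-trans (realloc≤ js js⁺ σ σ⁺ loc (support P) uniq (λ a a∈ _ ∉ →
        Maybeₚ.just-injective (sym (trans (final-old a a∈) (outside P (loc a) ∉))))) (size P)
    ; migrate = ≤-trans (migration≤ js js⁺ σ σ⁺ loc [] uniq (λ a a∈ _ _ → sym (same-machine a a∈))) z≤n
    }

-- Deletion

∑-swap : ∀ {A B : Set} {f : A → B} {xs} → Uniq f xs → ∀ {a b} → a ∈ xs → b ∈ xs → f a ≢ f b →
  ∀ (u v : A → ℕ) → u a ≡ v b → u b ≡ v a → (∀ c → c ∈ xs → f c ≢ f a → f c ≢ f b → u c ≡ v c) →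
  ∑ xs u ≡ ∑ xs v
∑-swap {A} {f = f} {xs} uq {a} {b} a∈ b∈ ne u v ua ub uc = begin
  ∑ xs u                          ≡⟨ expand u ⟩
  u a + (u b + ∑ (rest S₂) u)     ≡⟨ cong₂ _+_ ua (cong₂ _+_ ub (∑-cong (rest S₂) others)) ⟩
  v b + (v a + ∑ (rest S₂) v)     ≡⟨ lem (v b) (v a) _ ⟩
  v a + (v b + ∑ (rest S₂) v)     ≡⟨ sym (expand v) ⟩
  ∑ xs v                          ∎
  where
  open ≡-Reasoning
  S : Split {f = f} xs a
  S = split uq a∈
  b∈′ : b ∈ rest S
  b∈′ = [ (λ eq → contradiction (cong f (sym eq)) ne) , id ]′ (cover S b b∈)
  S₂ : Split {f = f} (rest S) b
  S₂ = split (uniqʳ S) b∈′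
  expand : ∀ w → ∑ xs w ≡ w a + (w b + ∑ (rest S₂) w)
  expand w = trans (∑-rest S w) (cong (w a +_) (∑-rest S₂ w))
  others : ∀ c → c ∈ rest S₂ → u c ≡ v c
  others c c∈ = let c∈S , c≢b = sub S₂ c c∈ ; c∈xs , c≢a = sub S c c∈S in uc c c∈xs c≢a c≢b
  lem : ∀ x y z → x + (y + z) ≡ y + (x + z)
  lem = solve-∀

swap-just : ∀ p q r → swapₚ (just p) (just q) (just r) ≢ nothing
swap-just p q r eq with swap-view (just p) (just q) (just r)
... | first _ e    = case trans (sym e) eq of λ ()
... | second _ _ e = case trans (sym e) eq of λ ()
... | fixed _ _ e  = case trans (sym e) eq of λ ()

module Exchange {m js σ} (inv : Inv m js σ) {j j′ : Job} (j∈ : j ∈ js) (j′∈ : j′ ∈ js)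
  (ex≡ : ex j ≡ ex j′) (ix≡ : ix j ≡ ix j′) (apart-pos : position σ j ≢ position σ j′) where
  open Inv inv

  swap : Pos → Pos
  swap = swapₚ (position σ j) (position σ j′)

  σ₁ : Schedule
  σ₁ n = fromMaybe dflt (swap (just (σ n)))

  pl₁ : ∀ a → position σ₁ a ≡ swap (position σ a)
  pl₁ a = just-fromMaybe _ (swap-just (σ (name j)) (σ (name j′)) (σ (name a)))
  pl₁-j : position σ₁ j ≡ position σ j′
  pl₁-j = trans (pl₁ j) (swap-first (position σ j) (position σ j′))
  pl₁-j′ : position σ₁ j′ ≡ position σ j
  pl₁-j′ = trans (pl₁ j′) (swap-second (position σ j) (position σ j′))
  pl₁-other : ∀ a → position σ a ≢ position σ j → position σ a ≢ position σ j′ → position σ₁ a ≡ position σ a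
  pl₁-other a ne ne′ = trans (pl₁ a) (swap-fixed (position σ j) (position σ j′) (position σ a) ne ne′)

  cases : ∀ (R : Job → Pos → Set) → (R j (position σ j′)) → (R j′ (position σ j)) → (∀ a → a ∈ js → R a (position σ a)) →
          ∀ a → a ∈ js → R a (position σ₁ a)
  cases R rj rj′ ra a a∈ = go (swap-view (position σ j) (position σ j′) (position σ a))
    where
    go : Swap (position σ j) (position σ j′) (position σ a) → R a (position σ₁ a)
    go (first e e′)    = subst₂ R (sym (Uniq-injective uniq a∈ j∈ e)) (sym (trans (pl₁ a) e′)) rj
    go (second _ e e′) = subst₂ R (sym (Uniq-injective uniq a∈ j′∈ e)) (sym (trans (pl₁ a) e′)) rj′
    go (fixed _ _ e)   = subst (R a) (sym (trans (pl₁ a) e)) (ra a a∈)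

  -- Loads and counts see a job only through its window and position. As `j` and `j′` share their
  -- window, the exchange merely permutes the summands.
  ∑-same : ∀ (w : Job → Pos → ℕ) → (∀ p → w j p ≡ w j′ p) → ∑ js (λ a → w a (position σ₁ a)) ≡ ∑ js (λ a → w a (position σ a))
  ∑-same w w≡ = ∑-swap uniq j∈ j′∈ apart-pos (λ a → w a (position σ₁ a)) (λ a → w a (position σ a))
    (trans (cong (w j) pl₁-j) (w≡ _)) (trans (cong (w j′) pl₁-j′) (sym (w≡ _)))
    (λ c _ ne ne′ → cong (w c) (pl₁-other c ne ne′))

  xw₁ : ∀ ν k i → jobsOn ν (position σ₁) js k i ≡ jobsOn ν (position σ) js k i
  xw₁ ν k i = ∑-same (λ a p → ⟦ On? ν p ⟧ * at (ex a) (ix a) k i)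
    (λ p → cong₂ (λ e x → ⟦ On? ν p ⟧ * at e x k i) ex≡ ix≡)

  cnt₁ : ∀ ν e d l → count ν (position σ₁) js e d l ≡ count ν (position σ) js e d l
  cnt₁ ν e d l = ∑-same (λ a p → ⟦ (ex a ≟ e + suc d) ×-dec Inside? ν e l p ⟧)
    (λ p → cong (λ x → ⟦ (x ≟ e + suc d) ×-dec Inside? ν e l p ⟧) ex≡)

  inv₁ : Inv m js σ₁
  inv₁ = record
    { names    = names
    ; sparse   = sparse
    ; machines = λ a a∈ → cases (λ _ p → ∀ ν s → p ≡ just (ν , s) → ν < m)
        (λ { _ _ refl → machines j′ j′∈ }) (λ { _ _ refl → machines j j∈ }) (λ { a a∈ _ _ refl → machines a a∈ })
        a a∈ _ _ refl
    ; fits     = cases (λ a p → ∀ ν s → p ≡ just (ν , s) → block (ex a) s ≡ ix a)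
        (λ ν s eq → trans (cong (λ e → block e s) ex≡) (trans (fits j′ j′∈ ν s eq) (sym ix≡)))
        (λ ν s eq → trans (cong (λ e → block e s) (sym ex≡)) (trans (fits j j∈ ν s eq) ix≡))
        fits
    ; uniq     = AllPairs.map (λ {a} {b} ne eq → ne (swap-injective (position σ j) (position σ j′) (trans (sym (pl₁ a)) (trans eq (pl₁ b))))) uniq
    ; ok       = λ ν ℓ d l d<h → ≤-trans (≤-reflexive (cnt₁ ν (eˡ ℓ) d l)) (≤-trans (ok ν ℓ d l d<h)
        (≤-reflexive (quota-cong (λ k i → cong (2 *_) (sym (xw₁ ν k i))) (eˡ ℓ) d l)))
    ; balanced = λ k i α β α<m β<m → subst₂ (λ a b → a ≤ suc b) (sym (xw₁ α k i)) (sym (xw₁ β k i)) (balanced k i α β α<m β<m)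
    }

others? : ∀ n (a : Job) → Dec (name a ≢ n)
others? n a = ¬? (name a ≟ n)

∑-remove : ∀ {js} → Uniq name js → ∀ {j} → j ∈ js → ∀ f → ∑ js f ≡ f j + ∑ (filter (others? (name j)) js) f
∑-remove {x ∷ js} (p ∷ u) (here refl) f = cong (λ zs → f x + ∑ zs f) (sym (trans
  (filter-reject (others? (name x)) (λ ne → ne refl))
  (filter-all (others? (name x)) (All.map (λ ne eq → ne (sym eq)) p))))
∑-remove {x ∷ js} (p ∷ u) {j} (there m) f = begin
  f x + ∑ js f                                              ≡⟨ cong (f x +_) (∑-remove u m f) ⟩
  f x + (f j + ∑ (filter (others? (name j)) js) f)          ≡⟨ lem (f x) (f j) _ ⟩
  f j + ∑ (x ∷ filter (others? (name j)) js) f              ≡⟨ cong (λ zs → f j + ∑ zs f) (sym (filter-accept (others? (name j)) (All.lookup p m))) ⟩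
  f j + ∑ (filter (others? (name j)) (x ∷ js)) f            ∎
  where
  open ≡-Reasoning
  lem : ∀ x y z → x + (y + z) ≡ y + (x + z)
  lem = solve-∀

module Deletion {m js σ} (1≤m : 1 ≤ m) (inv : Inv m js σ) {j : Job} (j∈ : j ∈ js)
  (fullest : ∀ ν → ν < m → jobsOn ν (position σ) js (ex j) (ix j) ≤ jobsOn (machineOf σ (name j)) (position σ) js (ex j) (ix j))
  (sparse⁻ : Sparse m (filter (others? (name j)) js)) where
  open Inv inv

  js⁻ : List Job
  js⁻ = filter (others? (name j)) js
  k q : ℕ
  k = ex j
  q = machineOf σ (name j)
  i : ℤ
  i = ix j
  loc : Job → Pos
  loc = position σ

  old : ∀ a → a ∈ js⁻ → a ∈ js
  old a a∈ = proj₁ (∈-filter⁻ (others? (name j)) a∈)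

  xw⁻ : ∀ ν k′ i′ → jobsOn ν loc js k′ i′ ≡ ⟦ q ≟ ν ⟧ * at k i k′ i′ + jobsOn ν loc js⁻ k′ i′
  xw⁻ ν k′ i′ = ∑-remove names j∈ _

  xw⁻≤ : ∀ ν k′ i′ → jobsOn ν loc js⁻ k′ i′ ≤ jobsOn ν loc js k′ i′
  xw⁻≤ ν k′ i′ = ≤-trans (m≤n+m _ _) (≤-reflexive (sym (xw⁻ ν k′ i′)))

  xw⁻-other : ∀ ν k′ i′ → ν ≢ q → jobsOn ν loc js k′ i′ ≡ jobsOn ν loc js⁻ k′ i′
  xw⁻-other ν k′ i′ ne = trans (xw⁻ ν k′ i′) (cong (λ z → z * at k i k′ i′ + jobsOn ν loc js⁻ k′ i′)
    (⟦⟧-no (q ≟ ν) (λ eq → ne (sym eq))))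

  -- Balance survives because the deleted job is on a machine that is fullest for its window;
  -- `delete-migrating` arranges this when it fails.
  bal⁻ : Balanced m loc js⁻
  bal⁻ k′ i′ α β α<m β<m = go (q ≟ β) ((k′ ≟ k) ×-dec (i′ ℤ.≟ i)) (xw⁻ β k′ i′)
    where
    go : (d : Dec (q ≡ β)) (w : Dec (k′ ≡ k × i′ ≡ i)) → jobsOn β loc js k′ i′ ≡ ⟦ d ⟧ * ⟦ w ⟧ + jobsOn β loc js⁻ k′ i′ →
         jobsOn α loc js⁻ k′ i′ ≤ suc (jobsOn β loc js⁻ k′ i′)
    go (no _)     w       eq = ≤-trans (xw⁻≤ α k′ i′) (≤-trans (balanced k′ i′ α β α<m β<m) (≤-reflexive (cong suc eq)))
    go (yes _)    (no _)  eq = ≤-trans (xw⁻≤ α k′ i′) (≤-trans (balanced k′ i′ α β α<m β<m) (≤-reflexive (cong suc eq)))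
    go (yes refl) (yes (refl , refl)) eq = ≤-trans (xw⁻≤ α k′ i′) (≤-trans (fullest α α<m) (≤-reflexive eq))

  y y₁ y⁻ : Config
  y k′ i′ = 2 * jobsOn q loc js k′ i′
  y⁻ k′ i′ = 2 * jobsOn q loc js⁻ k′ i′
  y₁ k′ i′ = y⁻ k′ i′ + at k i k′ i′

  inc₁ : Inc y⁻ y₁ k i
  inc₁ _ _ = refl
  inc₂ : Inc y₁ y k i
  inc₂ k′ i′ = trans (cong (2 *_) (trans (xw⁻ q k′ i′) (cong (λ z → z * at k i k′ i′ + jobsOn q loc js⁻ k′ i′) (⟦⟧-yes (q ≟ q) refl))))
                 (lem (at k i k′ i′) (jobsOn q loc js⁻ k′ i′))
    where
    lem : ∀ a x → 2 * (1 * a + x) ≡ 2 * x + a + a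
    lem = solve-∀

  dense : Dense y
  dense = machine-dense 1≤m sparse (placed {σ}) balanced q (machines j j∈)
  dense₁ : Dense y₁
  dense₁ k′ i′ = ≤-trans (*-monoʳ-≤ 4 (subtotal-mono (λ k″ i″ → ≤-trans (m≤m+n _ _) (≤-reflexive (sym (inc₂ k″ i″)))) k′ i′)) (dense k′ i′)
  dense⁻ : Dense y⁻
  dense⁻ k′ i′ = ≤-trans (*-monoʳ-≤ 4 (subtotal-mono (λ k″ i″ → m≤m+n (y⁻ k″ i″) (at k i k″ i″)) k′ i′)) (dense₁ k′ i′)

  count⁻≤ : ∀ ν e d l → count ν loc js⁻ e d l ≤ count ν loc js e d l
  count⁻≤ ν e d l = ≤-trans (m≤n+m _ _) (≤-reflexive (sym (∑-remove names j∈ _)))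

  uniq⁻ : Uniq loc js⁻
  uniq⁻ = AllPairsₚ.filter⁺ (others? (name j)) uniq
  3≤k : 3 ≤ k
  3≤k = Sparse⇒3≤ex m sparse j j∈

  A₁ : Adapted q 2 y₁ loc js⁻
  A₁ = decrease inc₂ 3≤k (λ a a∈ → fits a (old a a∈)) uniq⁻ (placed {σ})
    (λ k′ i′ → m≤m+n _ _) dense₁ (λ ℓ d l d<h → ≤-trans (count⁻≤ q (eˡ ℓ) d l) (ok q ℓ d l d<h))
  P₁ : Move q 2
  P₁ = Adapted.move A₁
  A₂ : Adapted q 2 y⁻ (τ P₁ ∘ loc) js⁻
  A₂ = decrease inc₁ 3≤k (Adapted.valid′ A₁) (Uniq-move P₁ uniq⁻) (Adapted.placed′ A₁)
    (Dom-move {loc = loc} {xs = js⁻} P₁ (λ k′ i′ → ≤-refl)) dense⁻ (Adapted.okAll′ A₁)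
  P : Move q 4
  P = P₁ then Adapted.move A₂

  σ⁻ : Schedule
  σ⁻ n = fromMaybe dflt (τ P (just (σ n)))

  final : ∀ a → a ∈ js⁻ → position σ⁻ a ≡ τ P (loc a)
  final a a∈ = just-fromMaybe _ (Adapted.placed′ A₂ a a∈)

  same-machine : ∀ a → a ∈ js⁻ → machineOf σ⁻ (name a) ≡ machineOf σ (name a)
  same-machine a a∈ = decide (On? q (loc a))
    where
    decide : Dec (On q (loc a)) → machineOf σ⁻ (name a) ≡ machineOf σ (name a)
    decide (yes o) = trans (subst (On q) (sym (final a a∈)) (on P (loc a) o)) (sym o)
    decide (no ¬o) = cong proj₁ (Maybeₚ.just-injective (trans (final a a∈) (off P (loc a) ¬o)))

  unmoved : ∀ a → a ∈ js⁻ → loc a ∉ support P → σ⁻ (name a) ≡ σ (name a)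
  unmoved a a∈ ∉ = Maybeₚ.just-injective (trans (final a a∈) (outside P (loc a) ∉))

  xw-final : ∀ ν k′ i′ → jobsOn ν loc js⁻ k′ i′ ≡ jobsOn ν (position σ⁻) js⁻ k′ i′
  xw-final ν = jobsOn-machine ν {σ} {σ⁻} js⁻ (λ a a∈ → sym (same-machine a a∈))

  inv⁻ : Inv m js⁻ σ⁻
  inv⁻ = record
    { names    = AllPairsₚ.filter⁺ (others? (name j)) names
    ; sparse   = sparse⁻
    ; machines = λ a a∈ → subst (_< m) (sym (same-machine a a∈)) (machines a (old a a∈))
    ; fits     = Fits-cong (λ a a∈ → sym (final a a∈)) (Adapted.valid′ A₂)
    ; uniq     = Uniq-cong (λ a a∈ → sym (final a a∈)) (Uniq-move P uniq⁻)
    ; ok       = λ ν → okay ν (ν ≟ q)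
    ; balanced = λ k′ i′ α β α<m β<m → subst₂ (λ a b → a ≤ suc b) (xw-final α k′ i′) (xw-final β k′ i′) (bal⁻ k′ i′ α β α<m β<m)
    }
    where
    okay : ∀ ν → Dec (ν ≡ q) → OkAll ν (λ k i → 2 * jobsOn ν (position σ⁻) js⁻ k i) (position σ⁻) js⁻
    okay ν (yes refl) = OkAll-cong js⁻ (λ a a∈ → sym (final a a∈)) (λ k′ i′ → cong (2 *_) (xw-final ν k′ i′)) (Adapted.okAll′ A₂)
    okay ν (no ν≢q) ℓ d l d<h = begin
      count ν (position σ⁻) js⁻ (eˡ ℓ) d l                              ≡⟨ count-cong ν js⁻ final (eˡ ℓ) d l ⟩
      count ν (τ P ∘ loc) js⁻ (eˡ ℓ) d l                          ≤⟨ count-other P ν≢q loc js⁻ (eˡ ℓ) d l ⟩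
      count ν loc js⁻ (eˡ ℓ) d l                                  ≤⟨ count⁻≤ ν (eˡ ℓ) d l ⟩
      count ν loc js (eˡ ℓ) d l                                   ≤⟨ ok ν ℓ d l d<h ⟩
      quota (λ k i → 2 * jobsOn ν loc js k i) (eˡ ℓ) d l                ≡⟨ quota-cong (λ k′ i′ → cong (2 *_) (trans (xw⁻-other ν k′ i′ ν≢q) (xw-final ν k′ i′))) (eˡ ℓ) d l ⟩
      quota (λ k i → 2 * jobsOn ν (position σ⁻) js⁻ k i) (eˡ ℓ) d l           ∎
      where open ≤-Reasoning

module _ {m js σ} (1≤m : 1 ≤ m) (inv : Inv m js σ) {j : Job} (j∈ : j ∈ js)
  (sparse⁻ : Sparse m (filter (others? (name j)) js)) where
  open Inv inv

  private
    js⁻ : List Job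
    js⁻ = filter (others? (name j)) js
    load-at : ℕ → ℕ
    load-at ν = jobsOn ν (position σ) js (ex j) (ix j)
    p : ℕ
    p = machineOf σ (name j)
    kept : ∀ a → a ∈ js → Any (λ b → name b ≡ name a) js⁻ → a ∈ js⁻
    kept a a∈ any = let b , b∈ , eq = find any in
      ∈-filter⁺ (others? (name j)) a∈ (subst (_≢ name j) eq (proj₂ (∈-filter⁻ (others? (name j)) {xs = js} b∈)))

  delete-directly : (∀ ν → ν < m → load-at ν ≤ load-at p) → Outcome m 5 js js⁻ σ
  delete-directly fullest = record
    { σ′ = σ⁻ ; inv = inv⁻
    ; realloc = ≤-trans (realloc≤ js js⁻ σ σ⁻ (position σ) (support P) uniq (λ a a∈ any ∉ → sym (unmoved a (kept a a∈ any) ∉)))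
        (≤-trans (size P) (n≤1+n 4))
    ; migrate = ≤-trans (migration≤ js js⁻ σ σ⁻ (position σ) [] uniq (λ a a∈ any _ → sym (same-machine a (kept a a∈ any)))) z≤n
    }
    where open Deletion 1≤m inv j∈ fullest sparse⁻ hiding (js⁻)

  -- A job with the same window on a fuller machine first takes over the position of the deleted job.
  delete-migrating : ∀ q → q < m → load-at p < load-at q → ∀ {j′} → j′ ∈ js → machineOf σ (name j′) ≡ q →
    ex j ≡ ex j′ → ix j ≡ ix j′ → Outcome m 5 js js⁻ σ
  delete-migrating q q<m fuller {j′} j′∈ on-q ex≡ ix≡ = record
    { σ′ = σ⁻ ; inv = inv⁻
    -- One position for the migrating job, and four for two unit decreases of load. `support P`
    -- refers to positions after the exchange, which for the remaining jobs are the original ones.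
    ; realloc = ≤-trans (realloc≤ js js⁻ σ σ⁻ (position σ) (position σ j′ ∷ pl₁-support) uniq (λ a a∈ any ∉ →
        trans (sym (stays a a∈ any (∉ ∘ here))) (sym (unmoved a (kept a a∈ any) λ ∈P →
          ∉ (there (subst (_∈ pl₁-support) (cong just (stays a a∈ any (∉ ∘ here))) ∈P))))))
        (s≤s (size P))
    ; migrate = migration≤ js js⁻ σ σ⁻ (position σ) (position σ j′ ∷ []) uniq (λ a a∈ any ∉ →
        trans (cong proj₁ (sym (stays a a∈ any (∉ ∘ here)))) (sym (same-machine a (kept a a∈ any))))
    }
    where
    p≢q : p ≢ q
    p≢q eq = <-irrefl (cong load-at eq) fuller
    module E = Exchange inv j∈ j′∈ ex≡ ix≡ (λ eq → p≢q (trans (cong proj₁ (Maybeₚ.just-injective eq)) on-q))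
    on-q₁ : machineOf E.σ₁ (name j) ≡ q
    on-q₁ = trans (cong proj₁ (Maybeₚ.just-injective E.pl₁-j)) on-q
    -- No machine has more than one job above `p` in this window, and `q` has more than `p`; so `q`,
    -- where `j` now is, is fullest.
    fullest : ∀ ν → ν < m → jobsOn ν (position E.σ₁) js (ex j) (ix j) ≤ jobsOn (machineOf E.σ₁ (name j)) (position E.σ₁) js (ex j) (ix j)
    fullest ν ν<m = begin
      jobsOn ν (position E.σ₁) js (ex j) (ix j)     ≡⟨ E.xw₁ ν (ex j) (ix j) ⟩
      load-at ν                           ≤⟨ balanced (ex j) (ix j) ν p ν<m (machines j j∈) ⟩
      suc (load-at p)                     ≤⟨ fuller ⟩
      load-at q                           ≡⟨ sym (E.xw₁ q (ex j) (ix j)) ⟩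
      jobsOn q (position E.σ₁) js (ex j) (ix j)     ≡⟨ cong (λ ν → jobsOn ν (position E.σ₁) js (ex j) (ix j)) (sym on-q₁) ⟩
      jobsOn (machineOf E.σ₁ (name j)) (position E.σ₁) js (ex j) (ix j) ∎
      where open ≤-Reasoning
    open Deletion 1≤m E.inv₁ j∈ fullest sparse⁻ hiding (js⁻)
    pl₁-support : List Pos
    pl₁-support = support P
    stays : ∀ a → a ∈ js → Any (λ b → name b ≡ name a) js⁻ → position σ a ≢ position σ j′ → E.σ₁ (name a) ≡ σ (name a)
    stays a a∈ any ne = Maybeₚ.just-injective (E.pl₁-other a
      (λ eq → proj₂ (∈-filter⁻ (others? (name j)) {xs = js} (kept a a∈ any)) (cong name (Uniq-injective uniq a∈ j∈ eq))) ne)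

  delete : Outcome m 5 js js⁻ σ
  delete = decide (anyUpTo? (λ ν → load-at p <? load-at ν) m)
    where
    decide : Dec (∃ λ ν → ν < m × load-at p < load-at ν) → Outcome m 5 js js⁻ σ
    decide (no none) = delete-directly (λ ν ν<m → ≮⇒≥ (λ lt → none (ν , ν<m , lt)))
    decide (yes (q , q<m , fuller)) =
      let a , a∈ , hit = ∑-pos js (λ a → ⟦ On? q (position σ a) ⟧ * at (ex a) (ix a) (ex j) (ix j)) (≤-<-trans z≤n fuller)
          on-q , same-window = both (On? q (position σ a)) ((ex j ≟ ex a) ×-dec (ix j ℤ.≟ ix a)) hit
      in delete-migrating q q<m fuller a∈ on-q (proj₁ same-window) (proj₂ same-window)
      where
      both : ∀ {A B : Set} (d : Dec A) (d′ : Dec B) → 0 < ⟦ d ⟧ * ⟦ d′ ⟧ → A × B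
      both (yes x) (yes x′) _ = x , x′

-- The number of relevant levels

n<2^1+log : ∀ n → n < 2 ^ suc ⌊log₂ n ⌋
n<2^1+log n = ≰⇒> λ le → 1+n≰n (≤-trans (≤-reflexive (sym (⌊log₂[2^n]⌋≡n (suc ⌊log₂ n ⌋)))) (⌊log₂⌋-mono-≤ le))

log≤pred : ∀ n → ⌊log₂ suc n ⌋ ≤ n
log≤pred n = ≤-trans (⌊log₂⌋-mono-≤ (n<2^n n)) (≤-reflexive (⌊log₂[2^n]⌋≡n n))

-- Each unit of log* undoes a logarithm, and each level takes `g` to at least `2 ^ g`. The offset is
-- 2 because `g 1` is 1 and does not exceed `n = 1`.
n<g-fuel : ∀ f n → n ≤ f → n < g (2 + logStarFuel f n)
n<g-fuel zero    .zero z≤n = s≤s z≤n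
n<g-fuel (suc f) n n≤f with n ≤? 1
... | yes n≤1 = ≤-trans (s≤s n≤1) (n≤1+n 2)
... | no n≰1 = ≤-trans (n<2^1+log n) (≤-trans (^-monoʳ-≤ 2 (n<g-fuel f ⌊log₂ n ⌋ (log≤ n n≤f)))
                 (m≤n+m _ (g (2 + logStarFuel f ⌊log₂ n ⌋))))
  where
  log≤ : ∀ n → n ≤ suc f → ⌊log₂ n ⌋ ≤ f
  log≤ zero    _  = z≤n
  log≤ (suc n) le = ≤-trans (log≤pred n) (s≤s⁻¹ le)

n<g : ∀ n → n < g (2 + logStar n)
n<g n = n<g-fuel n n ≤-refl

span≤maxSpan : ∀ js a → a ∈ js → span a ≤ maxSpan js
span≤maxSpan (x ∷ js) a (here refl) = m≤m⊔n _ _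
span≤maxSpan (x ∷ js) a (there m)   = ≤-trans (span≤maxSpan js a m) (m≤n⊔m (span x) _)

levels : List Job → ℕ
levels js = 2 + (logStar (length js) ⊓ logStar (maxSpan js))

-- The smaller of the two iterated logarithms decides the alternative: intervals that are long
-- compared with the number of jobs, or no larger windows at all.
levels-suffice : ∀ {m} js → Sparse m js →
  8 * length js ≤ 2 ^ eˡ (levels js) ⊎ (∀ a → a ∈ js → ex a ≤ eˡ (levels js))
levels-suffice js sparse with ⊓-sel (logStar (length js)) (logStar (maxSpan js))
... | inj₁ eq = inj₁ (begin
  8 * n                                ≤⟨ *-monoʳ-≤ 8 (<⇒≤ (n<2^n n)) ⟩
  8 * 2 ^ n                            ≡⟨ lem (2 ^ n) ⟩
  2 ^ (2 + suc n)                      ≤⟨ ^-monoʳ-≤ 2 (+-monoʳ-≤ 2 (n<g n)) ⟩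
  2 ^ (2 + g (2 + logStar n))          ≡⟨ cong (2 ^_) (sym (eˡ≡ _)) ⟩
  2 ^ eˡ (2 + logStar n)               ≡⟨ cong (λ z → 2 ^ eˡ (2 + z)) (sym eq) ⟩
  2 ^ eˡ (levels js)                   ∎)
  where
  open ≤-Reasoning
  n : ℕ
  n = length js
  lem : ∀ x → 8 * x ≡ 2 * (2 * (2 * x))
  lem = solve-∀
... | inj₂ eq = inj₂ λ a a∈ → begin
  ex a                                 ≤⟨ n≤1+n _ ⟩
  suc (ex a)                           ≤⟨ <⇒≤ (n<2^n (suc (ex a))) ⟩
  2 ^ suc (ex a)                       ≤⟨ span≥ {j = a} (All.lookup (proj₁ sparse) a∈) ⟩
  span a                               ≤⟨ span≤maxSpan js a a∈ ⟩
  maxSpan js                           ≤⟨ <⇒≤ (n<g (maxSpan js)) ⟩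
  g (2 + logStar (maxSpan js))         ≤⟨ m≤n+m _ 2 ⟩
  2 + g (2 + logStar (maxSpan js))     ≡⟨ sym (eˡ≡ _) ⟩
  eˡ (2 + logStar (maxSpan js))        ≡⟨ cong (λ z → eˡ (2 + z)) (sym eq) ⟩
  eˡ (levels js)                       ∎
  where open ≤-Reasoning

-- The scheduler

-- With `t = 2 + l` levels, an insertion pays `2 * t` for each of two units of load and
-- `2 * (t + 1)` for placing the job, altogether `14 + 6 * l`.
cost : List Job → ℕ
cost after = 14 * (1 + (logStar (length after) ⊓ logStar (maxSpan after)))

weaken : ∀ {m n n′ before after σ} → n ≤ n′ → Outcome m n before after σ → Outcome m n′ before after σ
weaken le o = record { Outcome o hiding (realloc) ; realloc = ≤-trans (Outcome.realloc o) le }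

transition : ∀ {m js σ} → 1 ≤ m → Inv m js σ → ∀ r → Valid js r → Sparse m (step js r) →
  Outcome m (cost (step js r)) js (step js r) σ
transition {m} {js} 1≤m inv (InsertJob n a d) (_ , fresh) sparse = weaken (≤-trans (≤-reflexive (lem₁ l)) (≤-trans (m≤m+n _ (8 * l)) (≤-reflexive (lem₂ l))))
    (Insertion.outcome 1≤m inv (job n a d) fresh sparse (levels js⁺) (levels-suffice {m} js⁺ sparse))
  where
  js⁺ : List Job
  js⁺ = job n a d ∷ js
  l : ℕ
  l = logStar (length js⁺) ⊓ logStar (maxSpan js⁺)
  lem₁ : ∀ l → (2 + l) * 2 + (2 + l) * 2 + suc (2 + l) * 2 ≡ 14 + 6 * l
  lem₁ = solve-∀
  lem₂ : ∀ l → 14 + 6 * l + 8 * l ≡ 14 * (1 + l)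
  lem₂ = solve-∀
transition 1≤m inv (DeleteJob n) any sparse with find any
... | j , j∈ , refl = weaken (≤-trans (m≤m+n 5 9) (m≤m*n 14 _)) (delete 1≤m inv j∈ sparse)

Valid? : ∀ js r → Dec (Valid js r)
Valid? js (InsertJob n a d) = (a ℤ.<? d) ×-dec all? (λ j → ¬? (name j ≟ n)) js
Valid? js (DeleteJob n)     = any? (λ j → name j ≟ n) js

State : ℕ → Set
State m = Σ (List Job) λ js → Σ Schedule λ σ → Inv m js σ

initial : ∀ m → State m
initial m = [] , (λ _ → dflt) , Inv-[] m _

-- After an invalid request or a job list that is not `Sparse` the state remains `nothing`. By
-- `under⇒Sparse` this does not occur in well-formed underallocated runs.
advance : ∀ m → 1 ≤ m → Maybe (State m) → Request → Maybe (State m)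
advance m 1≤m nothing               r = nothing
advance m 1≤m (just (js , σ , inv)) r with Valid? js r | Sparse? m (step js r)
... | yes v | yes s = let o = transition 1≤m inv r v s in just (step js r , Outcome.σ′ o , Outcome.inv o)
... | yes _ | no _  = nothing
... | no _  | _     = nothing

output : ∀ {m} → Maybe (State m) → Schedule
output nothing            = λ _ → dflt
output (just (_ , σ , _)) = σ

scheduler : Scheduler
scheduler zero    rs = λ _ → dflt
scheduler (suc m) rs = output (foldl (advance (suc m) (s≤s z≤n)) (just (initial (suc m))) rs)

advance-succeeds : ∀ {m} 1≤m {js σ} (inv : Inv m js σ) r → Valid js r → Sparse m (step js r) →
  ∃ λ (o : Outcome m (cost (step js r)) js (step js r) σ) →
    advance m 1≤m (just (js , σ , inv)) r ≡ just (step js r , Outcome.σ′ o , Outcome.inv o)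
advance-succeeds {m} 1≤m {js} inv r v s with Valid? js r | Sparse? m (step js r)
... | yes v′ | yes s′ = transition 1≤m inv r v′ s′ , refl
... | yes _  | no ¬s  = contradiction s ¬s
... | no ¬v  | _      = contradiction v ¬v

step-names : ∀ {js} r → Valid js r → Uniq name js → Uniq name (step js r)
step-names (InsertJob n a d) (_ , fresh) u = All.map (λ ne eq → ne (sym eq)) fresh ∷ u
step-names (DeleteJob n)     _           u = AllPairsₚ.filter⁺ (others? n) u

module _ {m : ℕ} (1≤m : 1 ≤ m) where

  -- The conclusion of the theorem for a run from an arbitrary state, as the induction over the
  -- requests demands.
  Correct : List Job → Maybe (State m) → List Request → Set
  Correct js st rs =
      (∀ i → i ≤ length rs → Feasible m (foldl step js (take i rs)) (output (foldl (advance m 1≤m) st (take i rs))))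
    × (∀ i → i < length rs →
         let before = foldl step js (take i rs)
             after  = foldl step js (take (suc i) rs)
             σ      = output (foldl (advance m 1≤m) st (take i rs))
             σ′     = output (foldl (advance m 1≤m) st (take (suc i) rs))
         in (reallocCost before after σ σ′ ≤ cost after) × (migrationCost before after σ σ′ ≤ 1))

  Correct-∷ : ∀ {js r rs st st′} → Feasible m js (output st) → advance m 1≤m st r ≡ st′ →
    reallocCost js (step js r) (output st) (output st′) ≤ cost (step js r) →
    migrationCost js (step js r) (output st) (output st′) ≤ 1 →
    Correct (step js r) st′ rs → Correct js st (r ∷ rs)
  Correct-∷ now refl realloc migrate (feasible , costs) =
    (λ { zero _ → now ; (suc i) (s≤s i≤) → feasible i i≤ }) ,
    (λ { zero _ → realloc , migrate ; (suc i) (s≤s i<) → costs i i< })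

  correct : ∀ rs {js σ} (inv : Inv m js σ) → WellFormedFrom js rs →
    (∀ i → i ≤ length rs → Underallocated γ m (foldl step js (take i rs))) → Correct js (just (js , σ , inv)) rs
  correct []       inv wf under = (λ { zero _ → Inv⇒Feasible inv }) , (λ _ ())
  correct (r ∷ rs) inv (valid , wf) under =
    let o , eq = advance-succeeds 1≤m inv r valid
                   (under⇒Sparse (step-names r valid (Inv.names inv)) (under 1 (s≤s z≤n)))
        open Outcome o renaming (inv to inv′)
    in Correct-∷ (Inv⇒Feasible inv) eq realloc migrate (correct rs inv′ wf (λ i i≤ → under (suc i) (s≤s i≤)))

theorem1 : Σ ℕ λ γ → (1 ≤ γ) × Σ Scheduler λ S → Σ ℕ λ C →
    ∀ (m : ℕ) → 1 ≤ m → ∀ (rs : List Request) → WellFormed rs →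
    UnderallocatedSeq γ m rs →
      (∀ i → i ≤ length rs → Feasible m (active (take i rs)) (S m (take i rs)))
    × (∀ i → i < length rs →
         let before = active (take i rs)
             after  = active (take (suc i) rs)
             σ      = S m (take i rs)
             σ'     = S m (take (suc i) rs)
         in (reallocCost before after σ σ'
               ≤ C * (1 + (logStar (length after) ⊓ logStar (maxSpan after))))
          × (migrationCost before after σ σ' ≤ 1))
theorem1 = γ , s≤s z≤n , scheduler , 14 , λ
  { (suc m) _ rs wf under → correct (s≤s z≤n) rs (Inv-[] (suc m) _) wf under }
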